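{- Let $G$ be a finite abelian group. Then $G\in\mathcal{G}_2$ if and only if $G\cong\mathbb{Z}_n$, where $n\in\{5,8,10,12\}$. Furthermore, a cycle of order $n$ is $2$-integral if and only if $n\in\{5,8,10,12\}$.
   Context: For a finite group $G$ and an inverse-closed subset $S\subseteq G\setminus\{1_G\}$, $\mathrm{Cay}(G,S)$ is the undirected graph with vertex set $G$ in which $g,h$ are adjacent if and only if $hg^{ -1}\in S$; it has valency $|S|$ and is connected if and only if $G=\langle S\rangle$. A graph $\Gamma$ is $2$-integral if $[\mathbb{SF}(\Gamma):\mathbb{Q}]=2$, where $\mathbb{SF}(\Gamma)$ is the smallest extension of $\mathbb{Q}$ containing all eigenvalues of the adjacency matrix of $\Gamma$. $\mathcal{G}_k$ denotes the set of all finite groups admitting a connected $2$-integral undirected Cayley graph with valency $k$. -}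

module Defs where

open import Level using (Level; 0ℓ; _⊔_) renaming (suc to lsuc)
open import Algebra.Apartness.Bundles using (HeytingField; HeytingCommutativeRing)
open import Algebra.Bundles using (Group; CommutativeRing)
open import Algebra.Bundles.Raw using (RawRing)
import Algebra.Definitions.RawMonoid as RawMonoidDefs
open import Algebra.Morphism.Structures using (module GroupMorphisms; module RingMorphisms)
import Algebra.Properties.Group as GroupProperties
open import Data.Bool.Base using (if_then_else_)
open import Data.Fin.Base using (Fin; zero; suc; toℕ; punchIn)
import Data.Fin.Properties as Fin
import Data.Integer.Base as ℤ
import Data.Integer.Properties as ℤ
import Data.Integer.Divisibility.Signed as ℤ
import Data.Integer.Solver as ℤSolver
open import Data.List.Base using (List; []; _∷_; map)
open import Data.Nat.Base as ℕ using (ℕ; zero; suc)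
import Data.Nat.Properties as ℕ
open import Data.Product.Base using (Σ; Σ-syntax; ∃; _×_; _,_)
open import Data.Rational.Base as ℚ using (ℚ; 0ℚ)
open import Data.Sum.Base as Sum using (_⊎_; inj₁; inj₂)
open import Data.Vec.Base as Vec using (count)
open import Data.Vec.Functional using (Vector; head; tail)
open import Function.Bundles using (Inverse)
open import Relation.Binary.Bundles using (Setoid)
open import Relation.Binary.Core using (Rel)
import Relation.Binary.Definitions as Rel₂
open import Relation.Binary.PropositionalEquality as ≡ using (_≡_; refl)
open import Relation.Nullary.Decidable using (does; _×-dec_; _⊎-dec_)
open import Relation.Nullary.Negation using (¬_)
open import Relation.Unary using (Pred; Decidable)

private
  variable
    c ℓ a : Level

------------------------------------------------------------------------
-- Finite graphs

-- The enumeration makes the graph finite and fixes the order of rows and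
-- columns in the adjacency matrix.
record Graph c ℓ a : Set (lsuc (c ⊔ ℓ ⊔ a)) where
  field
    vertices : Setoid c ℓ
  open Setoid vertices public using (_≈_) renaming (Carrier to Vertex)
  field
    order      : ℕ
    enumerated : Inverse (≡.setoid (Fin order)) vertices
    Adj        : Rel Vertex a
    adj?       : Rel₂.Decidable Adj
    resp       : Adj Rel₂.Respects₂ _≈_
    sym        : Rel₂.Symmetric Adj
    irrefl     : Rel₂.Irreflexive _≈_ Adj

  vertex : Fin order → Vertex
  vertex = Inverse.to enumerated

module _ (Γ : Graph c ℓ a) where
  open Graph Γ

  -- `Star Adj` would not do: it identifies end points up to _≡_, not _≈_.
  data Walk (u v : Vertex) : Set (c ⊔ ℓ ⊔ a) where
    stop : u ≈ v → Walk u v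
    step : ∀ {w} → Adj u w → Walk w v → Walk u v

  Connected : Set (c ⊔ ℓ ⊔ a)
  Connected = ∀ u v → Walk u v

  degree : Vertex → ℕ
  degree v = count (adj? v) (Vec.tabulate vertex)

  HasValency : ℕ → Set c
  HasValency k = ∀ v → degree v ≡ k

-- i and j are adjacent when one is the successor of the other modulo n.
module _ (n : ℕ) where
  Next : Rel (Fin n) 0ℓ
  Next i j = suc (toℕ i) ≡ toℕ j ⊎ (suc (toℕ i) ≡ n × toℕ j ≡ 0)

  next? : Rel₂.Decidable Next
  next? i j = (suc (toℕ i) ℕ.≟ toℕ j) ⊎-dec ((suc (toℕ i) ℕ.≟ n) ×-dec (toℕ j ℕ.≟ 0))

Cycle : (n : ℕ) → 3 ℕ.≤ n → Graph 0ℓ 0ℓ 0ℓ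
Cycle n 3≤n = record
  { vertices   = ≡.setoid (Fin n)
  ; order      = n
  ; enumerated = record
    { to        = λ i → i
    ; from      = λ i → i
    ; to-cong   = λ eq → eq
    ; from-cong = λ eq → eq
    ; inverse   = (λ eq → eq) , (λ eq → eq)
    }
  ; Adj        = λ i j → Next n i j ⊎ Next n j i
  ; adj?       = λ i j → next? n i j ⊎-dec next? n j i
  ; resp       = (λ { refl adj → adj }) , (λ { refl adj → adj })
  ; sym        = Sum.swap
  ; irrefl     = λ { refl → Sum.[ loopless , loopless ] }
  }
  where
  loopless : ∀ {i} → ¬ Next n i i
  loopless (inj₁ eq)          = ℕ.1+n≢n eq
  loopless (inj₂ (eq₁ , eq₂)) =
    ℕ.<⇒≢ (ℕ.≤-trans (ℕ.s≤s (ℕ.s≤s ℕ.z≤n)) 3≤n)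
          (≡.trans (≡.cong suc (≡.sym eq₂)) eq₁)

------------------------------------------------------------------------
-- Polynomials: lists of coefficients, constant term first, compared
-- coefficientwise so that trailing zeros do not matter.

module Polynomial {r ρ} (R : RawRing r ρ) where
  open RawRing R

  Poly : Set r
  Poly = List Carrier

  coeff : Poly → ℕ → Carrier
  coeff []      _       = 0#
  coeff (x ∷ p) zero    = x
  coeff (x ∷ p) (suc k) = coeff p k

  infixl 6 _+ₚ_
  _+ₚ_ : Poly → Poly → Poly
  []      +ₚ q       = q
  (x ∷ p) +ₚ []      = x ∷ p
  (x ∷ p) +ₚ (y ∷ q) = x + y ∷ p +ₚ q

  infixl 7 _*ₚ_
  _*ₚ_ : Poly → Poly → Poly
  []      *ₚ q = []
  (x ∷ p) *ₚ q = map (x *_) q +ₚ (0# ∷ p *ₚ q)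

  rawRing : RawRing r ρ
  rawRing = record
    { Carrier = Poly
    ; _≈_     = λ p q → ∀ k → coeff p k ≈ coeff q k
    ; _+_     = _+ₚ_
    ; _*_     = _*ₚ_
    ; -_      = map -_
    ; 0#      = []
    ; 1#      = 1# ∷ []
    }

  X : Poly
  X = 0# ∷ 1# ∷ []

  const : Carrier → Poly
  const x = x ∷ []

------------------------------------------------------------------------
-- Matrices

module Matrix {r ρ} (R : RawRing r ρ) where
  open RawRing R

  SquareMatrix : ℕ → Set r
  SquareMatrix n = Fin n → Fin n → Carrier

  -- f 0 - f 1 + f 2 - ...
  alternatingSum : ∀ {n} → Vector Carrier n → Carrier
  alternatingSum {zero}  f = 0#
  alternatingSum {suc n} f = head f + - alternatingSum (tail f)

  -- Laplace expansion along the first row.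
  det : ∀ {n} → SquareMatrix n → Carrier
  det {zero}  A = 1#
  det {suc n} A =
    alternatingSum λ j → A zero j * det (λ r s → A (suc r) (punchIn j s))

  adjacencyMatrix : (Γ : Graph c ℓ a) → SquareMatrix (Graph.order Γ)
  adjacencyMatrix Γ i j = if does (adj? (vertex i) (vertex j)) then 1# else 0#
    where open Graph Γ

-- det (X I - A)
charPoly : (R : RawRing c ℓ) → ∀ {n} → Matrix.SquareMatrix R n → Polynomial.Poly R
charPoly R A = Matrix.det rawRing λ i j →
  (if does (i Fin.≟ j) then X else []) R[X].+ R[X].- const (A i j)
  where
  open Polynomial R
  module R[X] = RawRing rawRing

------------------------------------------------------------------------
-- Field extensions of ℚ

record Extension : Set₁ where
  field
    heytingField : HeytingField 0ℓ 0ℓ 0ℓ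
  open HeytingField heytingField public
  rawRing : RawRing 0ℓ 0ℓ
  rawRing = CommutativeRing.rawRing
    (HeytingCommutativeRing.commutativeRing heytingCommutativeRing)
  field
    ι              : ℚ → Carrier
    ι-homomorphism : RingMorphisms.IsRingHomomorphism ℚ.+-*-rawRing rawRing ι

module _ (K : Extension) where
  open Extension K
  open RawMonoidDefs (RawRing.+-rawMonoid rawRing) using (sum)

  record IsBasis {d} (b : Vector Carrier d) : Set where
    combination : Vector ℚ d → Carrier
    combination q = sum λ i → ι (q i) * b i
    field
      spanning    : ∀ x → ∃ λ q → x ≈ combination q
      independent : ∀ q → combination q ≈ 0# → ∀ i → q i ≡ 0ℚ

  HasDegree : ℕ → Set
  HasDegree d = ∃ (IsBasis {d})

  -- A subfield automatically contains the image of ℚ.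
  record Subfield : Set₁ where
    field
      Member    : Pred Carrier 0ℓ
      resp      : ∀ {x y} → x ≈ y → Member x → Member y
      0-closed  : Member 0#
      1-closed  : Member 1#
      +-closed  : ∀ {x y} → Member x → Member y → Member (x + y)
      *-closed  : ∀ {x y} → Member x → Member y → Member (x * y)
      neg-closed : ∀ {x} → Member x → Member (- x)
      inv-closed : ∀ {x y} → x * y ≈ 1# → Member x → Member y

  -- K contains all eigenvalues of Γ, i.e. the characteristic polynomial of
  -- its adjacency matrix is a product of linear factors over K, and no
  -- proper subfield of K contains all of them.
  record IsSplittingField (Γ : Graph c ℓ a) : Set₁ where
    open Polynomial rawRing using (X; const) renaming (rawRing to K[X])
    module K[X] = RawRing K[X]
    open RawMonoidDefs K[X].*-rawMonoid using () renaming (sum to product)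
    field
      eigenvalue : Vector Carrier (Graph.order Γ)
      splits     : charPoly rawRing (Matrix.adjacencyMatrix rawRing Γ)
                   K[X].≈ product λ i → X K[X].+ K[X].- const (eigenvalue i)
      smallest   : (F : Subfield) → (∀ i → Subfield.Member F (eigenvalue i)) →
                   ∀ x → Subfield.Member F x

-- Splitting fields are unique up to isomorphism, so it does not matter
-- which one has degree 2.
TwoIntegral : Graph c ℓ a → Set₁
TwoIntegral Γ = Σ[ K ∈ Extension ] IsSplittingField K Γ × HasDegree K 2

------------------------------------------------------------------------
-- Groups and Cayley graphs

Finite : Group c ℓ → Set (c ⊔ ℓ)
Finite G = Σ[ n ∈ ℕ ] Inverse (≡.setoid (Fin n)) (Group.setoid G)

infix 4 _≅_
_≅_ : ∀ {c₁ ℓ₁ c₂ ℓ₂} → Group c₁ ℓ₁ → Group c₂ ℓ₂ → Set (c₁ ⊔ ℓ₁ ⊔ c₂ ⊔ ℓ₂)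
G ≅ H = ∃ (GroupMorphisms.IsGroupIsomorphism (Group.rawGroup G) (Group.rawGroup H))

-- The integers under addition, with equality taken to be congruence modulo n.
ℤ/_ : ℕ → Group 0ℓ 0ℓ
ℤ/ n = record
  { Carrier = ℤ.ℤ
  ; _≈_     = λ x y → ℤ.+ n ℤ.∣ x ℤ.- y
  ; _∙_     = ℤ._+_
  ; ε       = ℤ.0ℤ
  ; _⁻¹     = ℤ.-_
  ; isGroup = record
    { isMonoid = record
      { isSemigroup = record
        { isMagma = record
          { isEquivalence = record
            { refl  = λ {x} → ≡⇒≈ {x} refl
            ; sym   = λ {x} {y} p → ≡.subst (ℤ.+ n ℤ.∣_)
                (solve 2 (λ x y → :- (x :- y) := y :- x) refl x y)
                (ℤ.∣m⇒∣-m p)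
            ; trans = λ {x} {y} {z} p q → ≡.subst (ℤ.+ n ℤ.∣_)
                (solve 3 (λ x y z → (x :- y) :+ (y :- z) := x :- z) refl x y z)
                (ℤ.∣m∣n⇒∣m+n p q)
            }
          ; ∙-cong = λ {x} {y} {u} {v} p q → ≡.subst (ℤ.+ n ℤ.∣_)
              (solve 4 (λ x y u v → (x :- y) :+ (u :- v) := (x :+ u) :- (y :+ v))
                refl x y u v)
              (ℤ.∣m∣n⇒∣m+n p q)
          }
        ; assoc = λ x y z → ≡⇒≈ (ℤ.+-assoc x y z)
        }
      ; identity = (λ x → ≡⇒≈ (ℤ.+-identityˡ x)) , (λ x → ≡⇒≈ (ℤ.+-identityʳ x))
      }
    ; inverse = (λ x → ≡⇒≈ (ℤ.+-inverseˡ x)) , (λ x → ≡⇒≈ (ℤ.+-inverseʳ x))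
    ; ⁻¹-cong = λ {x} {y} p → ≡.subst (ℤ.+ n ℤ.∣_)
        (solve 2 (λ x y → :- (x :- y) := (:- x) :- (:- y)) refl x y)
        (ℤ.∣m⇒∣-m p)
    }
  }
  where
  open ℤSolver.+-*-Solver
  ≡⇒≈ : ∀ {x y} → x ≡ y → ℤ.+ n ℤ.∣ x ℤ.- y
  ≡⇒≈ {x} refl =
    ℤ.divides ℤ.0ℤ (≡.trans (ℤ.+-inverseʳ x) (≡.sym (ℤ.*-zeroˡ (ℤ.+ n))))

record ConnectionSet (G : Group c ℓ) : Set (c ⊔ lsuc ℓ) where
  open Group G
  field
    S          : Pred Carrier ℓ
    S?         : Decidable S
    S-resp     : ∀ {x y} → x ≈ y → S x → S y
    ε∉S        : ¬ S ε
    inv-closed : ∀ {x} → S x → S (x ⁻¹)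

Cay : (G : Group c ℓ) → Finite G → ConnectionSet G → Graph c ℓ ℓ
Cay G (n , enum) C = record
  { vertices   = setoid
  ; order      = n
  ; enumerated = enum
  ; Adj        = λ g h → S (h ∙ g ⁻¹)
  ; adj?       = λ g h → S? (h ∙ g ⁻¹)
  ; resp       = (λ h≈h′ → S-resp (∙-congʳ h≈h′))
               , (λ g≈g′ → S-resp (∙-congˡ (⁻¹-cong g≈g′)))
  ; sym        = λ {g} {h} s → S-resp
      (trans (⁻¹-anti-homo-∙ h (g ⁻¹)) (∙-congʳ (⁻¹-involutive g))) (inv-closed s)
  ; irrefl     = λ {g} {h} g≈h s →
      ε∉S (S-resp (trans (∙-congˡ (⁻¹-cong g≈h)) (inverseʳ h)) s)
  }
  where
  open Group G
  open GroupProperties G using (⁻¹-anti-homo-∙; ⁻¹-involutive)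
  open ConnectionSet C

-- G ∈𝒢 k: G is finite and has a connected 2-integral Cayley graph of valency k.
infix 4 _∈𝒢_
_∈𝒢_ : Group c ℓ → ℕ → Set (lsuc 0ℓ ⊔ c ⊔ lsuc ℓ)
G ∈𝒢 k = Σ[ fin ∈ Finite G ] Σ[ C ∈ ConnectionSet G ]
  Connected (Cay G fin C) × HasValency (Cay G fin C) k × TwoIntegral (Cay G fin C)

{-# OPTIONS --safe #-}
module Submission where

-- The characteristic polynomial of the n-cycle is D n X - 2, where D n is the Dickson polynomial
-- with D n (z + 1/z) = zⁿ + 1/zⁿ.  If it splits in a quadratic field K, each eigenvalue e satisfies
-- e² = a e - b with integers a and b: since the D k e are periodic in k, the powers of e and of 1 + e
-- have bounded denominators, so that their norms are integers.  For every residue of (a , b) modulo 8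
-- some D m e with m = 8, 10 or 12 is congruent to 2 modulo 8, and as in Minkowski's lemma on
-- congruence subgroups, D n (2 + w) = 2 with w divisible by 8 forces w = 0; hence D m e = 2.  So
-- (D 8 - 2) (D 10 - 2) (D 12 - 2) vanishes at all eigenvalues.  By Newton's identities the sum of D k
-- over the eigenvalues is 2n if n divides k and 0 otherwise, and summing the product over the
-- eigenvalues leaves only n = 3, 4, 5, 6, 8, 10 and 12.  For n = 3, 4 and 6 the eigenvalues are rational,
-- and for the others the polynomial splits explicitly over ℚ(√5), ℚ(√2) and ℚ(√3).
--
-- A connected Cayley graph of valency 2 on an abelian group is the cycle of the powers of a generator,
-- or, if the connection set consists of two involutions, the 4-cycle on the Klein four-group.

open import Defs
open import Algebra.Apartness.Bundles as Apartness using (HeytingField)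
open import Algebra.Bundles using (CommutativeRing; Group; AbelianGroup)
import Algebra.Definitions.RawMonoid as RawMonoidDefs
open import Algebra.Morphism.Structures using (module RingMorphisms; module GroupMorphisms)
import Algebra.Properties.AbelianGroup as AbelianGroupProperties
import Algebra.Properties.Group as GroupProperties
import Algebra.Properties.Monoid.Mult as MonoidMultiples
import Algebra.Properties.Ring as RingProperties
import Algebra.Properties.Semiring.Exp as Exp
import Algebra.Properties.Semiring.Mult.TCOptimised as Multiples
import Algebra.Solver.Ring as RingSolver
open import Algebra.Solver.Ring.AlmostCommutativeRing using (fromCommutativeRing; _-Raw-AlmostCommutative⟶_)
open import Data.Bool.Base using (true; false; Bool; if_then_else_)
open import Data.Fin using (#_)
open import Data.Fin.Base as Fin using (Fin; zero; suc; punchIn; toℕ; fromℕ<)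
open import Data.Fin.Permutation as Permutation using (Permutation′; _⟨$⟩ʳ_; Permutation; _⟨$⟩ˡ_; permutation; ↔⇒≡)
open import Data.Fin.Permutation.Components using (transpose)
open import Data.Fin.Permutation.Transposition.List using (eval; decompose; eval-decompose)
import Data.Fin.Properties as Fin
open import Data.Integer.Base as ℤ using (ℤ; +_; -[1+_])
import Data.Integer.DivMod as ℤ
import Data.Integer.Divisibility.Signed as ℤ
import Data.Integer.Properties as ℤ
import Data.Integer.Solver as ℤSolver
open import Data.List.Base using ([]; _∷_; List; map)
open import Data.List.Membership.Propositional using (_∈_; find)
open import Data.List.Relation.Unary.All as All using (All; []; _∷_)
open import Data.List.Relation.Unary.Any as Any using (Any; any?; here; there)
open import Data.Maybe.Base as Maybe using (Maybe)
open import Data.Nat.Base as ℕ using (ℕ; zero; suc; z<s; s<s; z≤n; s≤s; _≤_)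
open import Data.Nat.Coprimality as Coprimality using (Coprime; 1-coprimeTo; coprime-divisor)
import Data.Nat.DivMod as ℕ
open import Data.Nat.Divisibility as ℕ using (_∣_; divides; ∣⇒≤; ∣-trans)
import Data.Nat.Induction as ℕ
import Data.Nat.Properties as ℕ
open import Data.Product.Base using (_,_; _×_; ∃; proj₁; proj₂; ∃₂; Σ-syntax)
open import Data.Rational.Base as ℚ using (ℚ; mkℚ; 0ℚ; 1ℚ)
import Data.Rational.Properties as ℚ
open import Data.Rational.Unnormalised.Base as ℚᵘ using (*≡*)
import Data.Rational.Unnormalised.Properties as ℚᵘ
open import Data.Sum.Base as Sum using (_⊎_; inj₁; inj₂)
open import Data.Vec.Base as Vec using (Vec; lookup; []; _∷_; count)
open import Data.Vec.Functional using (Vector)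
open import Function.Base using (_∘_; id)
open import Function.Bundles using (Inverse; _⇔_; mk⇔; Equivalence)
import Level
open import Relation.Binary.Definitions as Rel₂ using (tri<; tri≈; tri>)
open import Relation.Binary.PropositionalEquality as ≡ using (_≡_; _≢_)
import Relation.Binary.Reasoning.Setoid as SetoidReasoning
open import Relation.Nullary.Decidable using (dec⇒maybe; yes; no; dec-true; dec-false; Dec; does; map′; _×-dec_; toWitness; _→-dec_; ¬?; decidable-stable; from-yes; does-⇔; _⊎-dec_)
open import Relation.Nullary.Negation using (¬_; contradiction)
open import Relation.Unary using (Decidable)

-- An eigenvalue should be thought of as z + 1/z with z a root of unity. It has degree at most 2
-- over ℚ exactly when z has order 1, 2, 3, 4, 5, 6, 8, 10 or 12, and each of these divides 8, 10 or
-- 12. But K is an abstract field in which neither z nor a complex embedding nor a Galois action is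
-- given. So `D` takes the place of the powers of z, the matrix of multiplication that of the
-- conjugates, and ℤ[e] that of the ring of integers. The modulus 8 is forced by D 2 (2 + w) = 2 + w
-- (w + 4): the value w = - 4 has to be excluded, and it is divisible by 4 but not by 8. Which
-- eigenvalue satisfies which of the three equations stays unknown. The product of the three is a
-- combination of the D k, however, and the power sums of the D k depend on n alone, whatever the
-- factorization. The characteristic polynomial is a Laplace expansion in a fixed enumeration of the
-- vertices, so the passage from Cayley graphs to cycles rests on the invariance of determinants
-- under simultaneous permutation of rows and columns.

-- Integers in a commutative ring, and a ring solver with integer constants.

module IntegerCoefficients {r ρ} (R : CommutativeRing r ρ) where
  open CommutativeRing R
  open RingProperties ring using (-0#≈0#; -‿involutive; -‿distribˡ-*; -‿distribʳ-*)
  open AbelianGroupProperties +-abelianGroup using (⁻¹-∙-comm)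
  open Multiples semiring using (1+×; ×-homo-+; ×1-homo-*) renaming (_×_ to _·_)
  open SetoidReasoning setoid

  fromℕ : ℕ → Carrier
  fromℕ n = n · 1#

  fromℤ : ℤ → Carrier
  fromℤ (+ n)    = fromℕ n
  fromℤ -[1+ n ] = - fromℕ (suc n)

  fromℤ-neg : ∀ i → fromℤ (ℤ.- i) ≈ - fromℤ i
  fromℤ-neg (+ zero)  = sym -0#≈0#
  fromℤ-neg (+ suc n) = refl
  fromℤ-neg -[1+ n ]  = sym (-‿involutive _)

  fromℤ-⊖ : ∀ m n → fromℤ (m ℤ.⊖ n) ≈ fromℕ m + - fromℕ n
  fromℤ-⊖ zero    zero    = sym (-‿inverseʳ 0#)
  fromℤ-⊖ zero    (suc n) = sym (+-identityˡ _)
  fromℤ-⊖ (suc m) zero    = sym (trans (+-congˡ -0#≈0#) (+-identityʳ _))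
  fromℤ-⊖ (suc m) (suc n) = begin
    fromℤ (suc m ℤ.⊖ suc n)                 ≡⟨ ≡.cong fromℤ (ℤ.[1+m]⊖[1+n]≡m⊖n m n) ⟩
    fromℤ (m ℤ.⊖ n)                         ≈⟨ fromℤ-⊖ m n ⟩
    fromℕ m + - fromℕ n                     ≈⟨ +-congʳ (+-identityʳ _) ⟨
    fromℕ m + 0# + - fromℕ n                ≈⟨ +-congʳ (+-congˡ (-‿inverseʳ 1#)) ⟨
    fromℕ m + (1# + - 1#) + - fromℕ n       ≈⟨ +-congʳ (+-assoc _ _ _) ⟨
    fromℕ m + 1# + - 1# + - fromℕ n         ≈⟨ +-assoc _ _ _ ⟩
    fromℕ m + 1# + (- 1# + - fromℕ n)       ≈⟨ +-cong (+-comm _ _) (⁻¹-∙-comm _ _) ⟩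
    1# + fromℕ m + - (1# + fromℕ n)         ≈⟨ +-cong (1+× m 1#) (-‿cong (1+× n 1#)) ⟨
    fromℕ (suc m) + - fromℕ (suc n)         ∎

  fromℤ-+ : ∀ i j → fromℤ (i ℤ.+ j) ≈ fromℤ i + fromℤ j
  fromℤ-+ (+ m)    (+ n)    = ×-homo-+ 1# m n
  fromℤ-+ (+ m)    -[1+ n ] = fromℤ-⊖ m (suc n)
  fromℤ-+ -[1+ m ] (+ n)    = trans (fromℤ-⊖ n (suc m)) (+-comm _ _)
  fromℤ-+ -[1+ m ] -[1+ n ] = begin
    - fromℕ (suc (suc (m ℕ.+ n)))           ≡⟨ ≡.cong (λ k → - fromℕ (suc k)) (ℕ.+-suc m n) ⟨
    - fromℕ (suc m ℕ.+ suc n)               ≈⟨ -‿cong (×-homo-+ 1# (suc m) (suc n)) ⟩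
    - (fromℕ (suc m) + fromℕ (suc n))       ≈⟨ ⁻¹-∙-comm _ _ ⟨
    - fromℕ (suc m) + - fromℕ (suc n)       ∎

  fromℤ-* : ∀ i j → fromℤ (i ℤ.* j) ≈ fromℤ i * fromℤ j
  fromℤ-* (+ m)    (+ n)    = begin
    fromℤ (+ m ℤ.* + n)       ≡⟨ ≡.cong fromℤ (ℤ.pos-* m n) ⟨
    fromℕ (m ℕ.* n)           ≈⟨ ×1-homo-* m n ⟩
    fromℕ m * fromℕ n         ∎
  fromℤ-* (+ m)    -[1+ n ] = begin
    fromℤ (+ m ℤ.* -[1+ n ])         ≡⟨ ≡.cong fromℤ (ℤ.neg-distribʳ-* (+ m) (+ suc n)) ⟨
    fromℤ (ℤ.- (+ m ℤ.* + suc n))    ≈⟨ fromℤ-neg (+ m ℤ.* + suc n) ⟩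
    - fromℤ (+ m ℤ.* + suc n)        ≈⟨ -‿cong (fromℤ-* (+ m) (+ suc n)) ⟩
    - (fromℕ m * fromℕ (suc n))      ≈⟨ -‿distribʳ-* _ _ ⟩
    fromℕ m * - fromℕ (suc n)        ∎
  fromℤ-* -[1+ m ] (+ n)    = begin
    fromℤ (-[1+ m ] ℤ.* + n)         ≡⟨ ≡.cong fromℤ (ℤ.neg-distribˡ-* (+ suc m) (+ n)) ⟨
    fromℤ (ℤ.- (+ suc m ℤ.* + n))    ≈⟨ fromℤ-neg (+ suc m ℤ.* + n) ⟩
    - fromℤ (+ suc m ℤ.* + n)        ≈⟨ -‿cong (fromℤ-* (+ suc m) (+ n)) ⟩
    - (fromℕ (suc m) * fromℕ n)      ≈⟨ -‿distribˡ-* _ _ ⟩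
    - fromℕ (suc m) * fromℕ n        ∎
  fromℤ-* -[1+ m ] -[1+ n ] = begin
    fromℕ (suc m ℕ.* suc n)               ≈⟨ ×1-homo-* (suc m) (suc n) ⟩
    fromℕ (suc m) * fromℕ (suc n)         ≈⟨ -‿involutive _ ⟨
    - - (fromℕ (suc m) * fromℕ (suc n))   ≈⟨ -‿cong (-‿distribˡ-* _ _) ⟩
    - (- fromℕ (suc m) * fromℕ (suc n))   ≈⟨ -‿distribʳ-* _ _ ⟩
    - fromℕ (suc m) * - fromℕ (suc n)     ∎

  private
    morphism : ℤ.+-*-rawRing -Raw-AlmostCommutative⟶ fromCommutativeRing R
    morphism = record
      { ⟦_⟧    = fromℤ
      ; +-homo = fromℤ-+
      ; *-homo = fromℤ-*
      ; -‿homo = fromℤ-neg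
      ; 0-homo = refl
      ; 1-homo = refl
      }

    fromℤ-≟ : ∀ i j → Maybe (fromℤ i ≈ fromℤ j)
    fromℤ-≟ i j = Maybe.map (λ eq → reflexive (≡.cong fromℤ eq)) (dec⇒maybe (i ℤ.≟ j))

  -- The coefficients are integers because equality in `R` need not be decidable, while the
  -- identities below contain numerals such as 2 and 4 that have to be collected.
  module Solver = RingSolver ℤ.+-*-rawRing (fromCommutativeRing R) morphism fromℤ-≟

-- Determinants by Laplace expansion: transposes and simultaneous permutations.

transpose-swap : ∀ {n} (i j k : Fin n) → transpose i j k ≡ transpose j i k
transpose-swap i j k with k Fin.≟ i | k Fin.≟ j
... | yes ≡.refl | yes ≡.refl = ≡.refl
... | yes ≡.refl | no k≢j rewrite dec-true (k Fin.≟ k) ≡.refl = ≡.refl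
... | no k≢i | yes ≡.refl rewrite dec-true (k Fin.≟ k) ≡.refl = ≡.refl
... | no k≢i | no k≢j rewrite dec-false (k Fin.≟ i) k≢i | dec-false (k Fin.≟ j) k≢j = ≡.refl

transpose-self : ∀ {n} (i k : Fin n) → transpose i i k ≡ k
transpose-self i k with k Fin.≟ i
... | yes k≡i = ≡.sym k≡i
... | no k≢i with k Fin.≟ i
...   | yes k≡i = ≡.sym k≡i
...   | no _    = ≡.refl

-- Conjugation by (0 1) moves the support away from 0. The middle factor fixes 0, so its effect on a
-- determinant can be read off from the minors of the first row.
transpose-conjugate : ∀ {n} (j : Fin n) (k : Fin (suc (suc n))) →
  transpose zero (suc (suc j)) k ≡
  transpose zero (suc zero) (transpose (suc zero) (suc (suc j)) (transpose zero (suc zero) k))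
transpose-conjugate j zero          = ≡.refl
transpose-conjugate j (suc zero)    = ≡.refl
transpose-conjugate j (suc (suc k)) with k Fin.≟ j
... | yes _ = ≡.refl
... | no _  = ≡.refl

-- For a ≢ b, the increasing enumeration of the indices other than a and b.
punchIn₂ : ∀ {n} → Fin (suc (suc n)) → Fin (suc (suc n)) → Fin n → Fin (suc (suc n))
punchIn₂ zero    zero    i       = suc (suc i)
punchIn₂ zero    (suc b) i       = suc (punchIn b i)
punchIn₂ (suc a) zero    i       = suc (punchIn a i)
punchIn₂ (suc a) (suc b) zero    = zero
punchIn₂ (suc a) (suc b) (suc i) = suc (punchIn₂ a b i)

punchIn₂-comm : ∀ {n} (a b : Fin (suc (suc n))) i → punchIn₂ a b i ≡ punchIn₂ b a i
punchIn₂-comm zero    zero    i       = ≡.refl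
punchIn₂-comm zero    (suc b) i       = ≡.refl
punchIn₂-comm (suc a) zero    i       = ≡.refl
punchIn₂-comm (suc a) (suc b) zero    = ≡.refl
punchIn₂-comm (suc a) (suc b) (suc i) = ≡.cong suc (punchIn₂-comm a b i)

-- Describes the columns left after two deletions by the deleted columns themselves. This form is
-- symmetric by `punchIn₂-comm`, so the minors of an expansion along two rows survive an exchange of
-- the rows.
punchIn-punchIn : ∀ {n} (j : Fin (suc (suc n))) (k : Fin (suc n)) i →
  punchIn j (punchIn k i) ≡ punchIn₂ j (punchIn j k) i
punchIn-punchIn zero    k       i       = ≡.refl
punchIn-punchIn (suc j) zero    i       = ≡.refl
punchIn-punchIn (suc j) (suc k) zero    = ≡.refl
punchIn-punchIn (suc j) (suc k) (suc i) = ≡.cong suc (punchIn-punchIn j k i)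

module Determinant {r ρ} (R : CommutativeRing r ρ) where
  open CommutativeRing R hiding (zero)
  open RingProperties ring using (-0#≈0#; -‿distribʳ-*; -‿involutive; -1*x≈-x)
  open IntegerCoefficients R using (module Solver)
  open Solver using (solve; _:+_; _:*_; _:=_; :-_)
  open Matrix rawRing using (SquareMatrix; alternatingSum; det)
  open SetoidReasoning setoid

  -- Opaque copies, since Agda cannot infer the arguments of functions that unfold.
  opaque
    Σ± : ∀ {n} → Vector Carrier n → Carrier
    Σ± = alternatingSum

    ∣_∣ : ∀ {n} → SquareMatrix n → Carrier
    ∣ A ∣ = det A

    ∣∣≡det : ∀ {n} (A : SquareMatrix n) → ∣ A ∣ ≡ det A
    ∣∣≡det A = ≡.refl

    Σ±-[] : (f : Vector Carrier 0) → Σ± f ≈ 0#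
    Σ±-[] f = refl

    Σ±-∷ : ∀ {n} (f : Vector Carrier (suc n)) → Σ± f ≈ f zero + - Σ± (f ∘ suc)
    Σ±-∷ f = refl

    Σ±-cong : ∀ {n} {f g : Vector Carrier n} → (∀ i → f i ≈ g i) → Σ± f ≈ Σ± g
    Σ±-cong {zero}  f≈g = refl
    Σ±-cong {suc n} f≈g = +-cong (f≈g zero) (-‿cong (Σ±-cong (f≈g ∘ suc)))

    expand-row : ∀ {n} (A : SquareMatrix (suc n)) →
      ∣ A ∣ ≈ Σ± (λ j → A zero j * ∣ (λ r s → A (suc r) (punchIn j s)) ∣)
    expand-row A = refl

    det-[] : (A : SquareMatrix 0) → ∣ A ∣ ≈ 1#
    det-[] A = refl

    det-cong : ∀ {n} {A B : SquareMatrix n} → (∀ i j → A i j ≈ B i j) → ∣ A ∣ ≈ ∣ B ∣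
    det-cong {zero}  A≈B = refl
    det-cong {suc n} A≈B =
      Σ±-cong λ j → *-cong (A≈B zero j) (det-cong λ r s → A≈B (suc r) (punchIn j s))

  Σ±-zero : ∀ {n} (f : Vector Carrier n) → (∀ i → f i ≈ 0#) → Σ± f ≈ 0#
  Σ±-zero {zero}  f f≈0 = Σ±-[] f
  Σ±-zero {suc n} f f≈0 = begin
    Σ± f                     ≈⟨ Σ±-∷ f ⟩
    f zero + - Σ± (f ∘ suc)  ≈⟨ +-cong (f≈0 zero) (-‿cong (Σ±-zero (f ∘ suc) (f≈0 ∘ suc))) ⟩
    0# + - 0#                ≈⟨ -‿inverseʳ 0# ⟩
    0#                       ∎

  Σ±-+ : ∀ {n} (f g : Vector Carrier n) → Σ± (λ i → f i + g i) ≈ Σ± f + Σ± g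
  Σ±-+ {zero}  f g = trans (Σ±-[] _) (sym (trans (+-cong (Σ±-[] f) (Σ±-[] g)) (+-identityˡ 0#)))
  Σ±-+ {suc n} f g = begin
    Σ± (λ i → f i + g i)
      ≈⟨ Σ±-∷ _ ⟩
    (f zero + g zero) + - Σ± (λ i → f (suc i) + g (suc i))
      ≈⟨ +-congˡ (-‿cong (Σ±-+ (f ∘ suc) (g ∘ suc))) ⟩
    (f zero + g zero) + - (Σ± (f ∘ suc) + Σ± (g ∘ suc))
      ≈⟨ solve 4 (λ a b c d → (a :+ b) :+ :- (c :+ d) := (a :+ :- c) :+ (b :+ :- d)) refl _ _ _ _ ⟩
    (f zero + - Σ± (f ∘ suc)) + (g zero + - Σ± (g ∘ suc))
      ≈⟨ +-cong (Σ±-∷ f) (Σ±-∷ g) ⟨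
    Σ± f + Σ± g ∎

  Σ±-* : ∀ {n} c (f : Vector Carrier n) → Σ± (λ i → c * f i) ≈ c * Σ± f
  Σ±-* {zero}  c f = trans (Σ±-[] _) (sym (trans (*-congˡ (Σ±-[] f)) (zeroʳ c)))
  Σ±-* {suc n} c f = begin
    Σ± (λ i → c * f i)
      ≈⟨ Σ±-∷ _ ⟩
    c * f zero + - Σ± (λ i → c * f (suc i))
      ≈⟨ +-congˡ (-‿cong (Σ±-* c (f ∘ suc))) ⟩
    c * f zero + - (c * Σ± (f ∘ suc))
      ≈⟨ solve 3 (λ c a b → c :* a :+ :- (c :* b) := c :* (a :+ :- b)) refl _ _ _ ⟩
    c * (f zero + - Σ± (f ∘ suc))
      ≈⟨ *-congˡ (Σ±-∷ f) ⟨
    c * Σ± f ∎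

  Σ±-neg : ∀ {n} (f : Vector Carrier n) → Σ± (λ i → - f i) ≈ - Σ± f
  Σ±-neg f = begin
    Σ± (λ i → - f i)        ≈⟨ Σ±-cong (λ i → sym (-1*x≈-x (f i))) ⟩
    Σ± (λ i → - 1# * f i)   ≈⟨ Σ±-* (- 1#) f ⟩
    - 1# * Σ± f             ≈⟨ -1*x≈-x _ ⟩
    - Σ± f                  ∎

  Σ±-comm : ∀ {m n} (f : Fin m → Fin n → Carrier) →
    Σ± (λ i → Σ± (f i)) ≈ Σ± (λ j → Σ± (λ i → f i j))
  Σ±-comm {zero}  f = trans (Σ±-[] _) (sym (Σ±-zero _ λ j → Σ±-[] _))
  Σ±-comm {suc m} f = begin
    Σ± (λ i → Σ± (f i))
      ≈⟨ Σ±-∷ _ ⟩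
    Σ± (f zero) + - Σ± (λ i → Σ± (f (suc i)))
      ≈⟨ +-congˡ (-‿cong (Σ±-comm (f ∘ suc))) ⟩
    Σ± (f zero) + - Σ± (λ j → Σ± (λ i → f (suc i) j))
      ≈⟨ +-congˡ (Σ±-neg _) ⟨
    Σ± (f zero) + Σ± (λ j → - Σ± (λ i → f (suc i) j))
      ≈⟨ Σ±-+ _ _ ⟨
    Σ± (λ j → f zero j + - Σ± (λ i → f (suc i) j))
      ≈⟨ Σ±-cong (λ j → Σ±-∷ _) ⟨
    Σ± (λ j → Σ± (λ i → f i j)) ∎

  -- The pair (a, b) carries the sign of a + b if b < a and of a + b - 1 if a < b, because the
  -- deletion of a lowers the position of a later b. Exchanging the arguments therefore flips every
  -- sign. The induction separates the pairs in which one index is 0.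
  Σ±-antisym : ∀ {n} (f : Fin (suc n) → Fin (suc n) → Carrier) →
    Σ± (λ j → Σ± (λ k → f j (punchIn j k))) ≈ - Σ± (λ j → Σ± (λ k → f (punchIn j k) j))
  Σ±-antisym {zero}  f = begin
    Σ± (λ j → Σ± (λ k → f j (punchIn j k)))     ≈⟨ Σ±-zero _ (λ j → Σ±-[] _) ⟩
    0#                                          ≈⟨ -0#≈0# ⟨
    - 0#                                        ≈⟨ -‿cong (Σ±-zero _ (λ j → Σ±-[] _)) ⟨
    - Σ± (λ j → Σ± (λ k → f (punchIn j k) j))   ∎
  Σ±-antisym {suc n} f = begin
    Σ± (λ j → Σ± (λ k → f j (punchIn j k)))
      ≈⟨ split f ⟩
    P + - (Q + - Σ± Z)
      ≈⟨ +-congˡ (-‿cong (+-congˡ (-‿cong (Σ±-antisym (λ i j → f (suc i) (suc j)))))) ⟩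
    P + - (Q + - - Σ± Z′)
      ≈⟨ solve 3 (λ p q z → p :+ :- (q :+ :- :- z) := :- (q :+ :- (p :+ :- z))) refl P Q _ ⟩
    - (Q + - (P + - Σ± Z′))
      ≈⟨ -‿cong (split (λ i j → f j i)) ⟨
    - Σ± (λ j → Σ± (λ k → f (punchIn j k) j)) ∎
    where
    P  = Σ± (λ k → f zero (suc k))
    Q  = Σ± (λ k → f (suc k) zero)
    Z  = λ j → Σ± (λ k → f (suc j) (suc (punchIn j k)))
    Z′ = λ j → Σ± (λ k → f (suc (punchIn j k)) (suc j))
    split : ∀ f → Σ± (λ j → Σ± (λ k → f j (punchIn j k))) ≈
      Σ± (λ k → f zero (suc k)) +
      - (Σ± (λ k → f (suc k) zero) + - Σ± (λ j → Σ± (λ k → f (suc j) (suc (punchIn j k)))))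
    split f = begin
      Σ± (λ j → Σ± (λ k → f j (punchIn j k)))
        ≈⟨ Σ±-∷ _ ⟩
      Σ± (λ k → f zero (suc k)) + - Σ± (λ j → Σ± (λ k → f (suc j) (punchIn (suc j) k)))
        ≈⟨ +-congˡ (-‿cong (Σ±-cong λ j → Σ±-∷ _)) ⟩
      Σ± (λ k → f zero (suc k)) +
      - Σ± (λ j → f (suc j) zero + - Σ± (λ k → f (suc j) (suc (punchIn j k))))
        ≈⟨ +-congˡ (-‿cong (trans (Σ±-+ _ _) (+-congˡ (Σ±-neg _)))) ⟩
      Σ± (λ k → f zero (suc k)) +
      - (Σ± (λ k → f (suc k) zero) + - Σ± (λ j → Σ± (λ k → f (suc j) (suc (punchIn j k))))) ∎

  det-cong-≡ : ∀ {m n p} (A : Fin m → Fin n → Carrier) {f f′ : Fin p → Fin m} {g g′ : Fin p → Fin n} →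
    (∀ i → f i ≡ f′ i) → (∀ i → g i ≡ g′ i) →
    ∣ (λ i j → A (f i) (g j)) ∣ ≈ ∣ (λ i j → A (f′ i) (g′ j)) ∣
  det-cong-≡ A f≡f′ g≡g′ = det-cong λ i j → reflexive (≡.cong₂ A (f≡f′ i) (g≡g′ j))

  private
    TransposeInvariant : ℕ → Set _
    TransposeInvariant n = (A : SquareMatrix n) → ∣ A ∣ ≈ ∣ (λ i j → A j i) ∣

    minor : ∀ {n} → SquareMatrix (suc (suc n)) → Fin (suc n) → Fin (suc n) → Carrier
    minor A i j = ∣ (λ r s → A (suc (punchIn i r)) (suc (punchIn j s))) ∣

  -- Along the first row, and then along the first column.
  expand-border : ∀ {n} → TransposeInvariant n → TransposeInvariant (suc n) →
    (A : SquareMatrix (suc (suc n))) →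
    ∣ A ∣ ≈ A zero zero * ∣ (λ r s → A (suc r) (suc s)) ∣ +
      - Σ± (λ j → Σ± (λ i → A zero (suc j) * A (suc i) zero * minor A i j))
  expand-border ih₀ ih₁ A = trans (expand-row A) (trans (Σ±-∷ _) (+-congˡ (-‿cong (Σ±-cong λ j → begin
    A zero (suc j) * ∣ (λ r s → A (suc r) (punchIn (suc j) s)) ∣
      ≈⟨ *-congˡ (trans (ih₁ _) (expand-row _)) ⟩
    A zero (suc j) * Σ± (λ i → A (suc i) zero * ∣ (λ r s → A (suc (punchIn i s)) (suc (punchIn j r))) ∣)
      ≈⟨ *-congˡ (Σ±-cong λ i → *-congˡ (ih₀ _)) ⟩
    A zero (suc j) * Σ± (λ i → A (suc i) zero * minor A i j)
      ≈⟨ Σ±-* _ _ ⟨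
    Σ± (λ i → A zero (suc j) * (A (suc i) zero * minor A i j))
      ≈⟨ Σ±-cong (λ i → sym (*-assoc _ _ _)) ⟩
    Σ± (λ i → A zero (suc j) * A (suc i) zero * minor A i j) ∎))))

  -- The border expansion treats rows and columns alike once its minors are known to be invariant;
  -- it involves minors of two consecutive sizes, whence the induction in steps of two.
  det-transpose : ∀ {n} (A : SquareMatrix n) → ∣ A ∣ ≈ ∣ (λ i j → A j i) ∣
  det-transpose {zero}        A = trans (det-[] A) (sym (det-[] _))
  det-transpose {suc zero}    A = begin
    ∣ A ∣
      ≈⟨ trans (expand-row A) (Σ±-∷ _) ⟩
    A zero zero * ∣ (λ r s → A (suc r) (suc s)) ∣ + - Σ± _
      ≈⟨ +-cong (*-congˡ (trans (det-[] _) (sym (det-[] _)))) (-‿cong (trans (Σ±-[] _) (sym (Σ±-[] _)))) ⟩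
    A zero zero * ∣ (λ r s → A (suc s) (suc r)) ∣ + - Σ± _
      ≈⟨ trans (expand-row _) (Σ±-∷ _) ⟨
    ∣ (λ i j → A j i) ∣ ∎
  det-transpose {suc (suc n)} A = begin
    ∣ A ∣
      ≈⟨ expand-border det-transpose det-transpose A ⟩
    A zero zero * ∣ (λ r s → A (suc r) (suc s)) ∣ +
      - Σ± (λ j → Σ± (λ i → A zero (suc j) * A (suc i) zero * minor A i j))
      ≈⟨ +-cong (*-congˡ (det-transpose _)) (-‿cong (Σ±-comm _)) ⟩
    A zero zero * ∣ (λ r s → A (suc s) (suc r)) ∣ +
      - Σ± (λ i → Σ± (λ j → A zero (suc j) * A (suc i) zero * minor A i j))
      ≈⟨ +-congˡ (-‿cong (Σ±-cong λ i → Σ±-cong λ j → *-cong (*-comm _ _) (det-transpose _))) ⟩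
    A zero zero * ∣ (λ r s → A (suc s) (suc r)) ∣ +
      - Σ± (λ i → Σ± (λ j → A (suc i) zero * A zero (suc j) * minor (λ i j → A j i) j i))
      ≈⟨ expand-border det-transpose det-transpose (λ i j → A j i) ⟨
    ∣ (λ i j → A j i) ∣ ∎
  expand-column : ∀ {n} (A : SquareMatrix (suc n)) →
    ∣ A ∣ ≈ Σ± (λ i → A i zero * ∣ (λ r s → A (punchIn i r) (suc s)) ∣)
  expand-column A = begin
    ∣ A ∣                                                               ≈⟨ det-transpose A ⟩
    ∣ (λ i j → A j i) ∣                                                 ≈⟨ expand-row _ ⟩
    Σ± (λ i → A i zero * ∣ (λ r s → A (punchIn i s) (suc r)) ∣)         ≈⟨ Σ±-cong (λ i → *-congˡ (det-transpose _)) ⟩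
    Σ± (λ i → A i zero * ∣ (λ r s → A (punchIn i r) (suc s)) ∣)         ∎

  -- Expanded along its first two rows, the determinant is an alternating sum over ordered pairs of
  -- distinct columns. Exchanging the rows exchanges the members of the pair, and `Σ±-antisym`
  -- supplies the sign.
  det-swap₀₁ : ∀ {n} (A : SquareMatrix (suc (suc n))) →
    ∣ (λ i j → A (transpose zero (suc zero) i) j) ∣ ≈ - ∣ A ∣
  det-swap₀₁ {n} A = begin
    ∣ B ∣
      ≈⟨ expand₂ B ⟩
    Σ± (λ j → Σ± (λ k → term B j (punchIn j k)))
      ≈⟨ Σ±-antisym (term B) ⟩
    - Σ± (λ j → Σ± (λ k → term B (punchIn j k) j))
      ≈⟨ -‿cong (Σ±-cong λ j → Σ±-cong λ k → *-cong (*-comm _ _)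
           (det-cong λ r s → reflexive (≡.cong (A (suc (suc r))) (punchIn₂-comm (punchIn j k) j s)))) ⟩
    - Σ± (λ j → Σ± (λ k → term A j (punchIn j k)))
      ≈⟨ -‿cong (expand₂ A) ⟨
    - ∣ A ∣ ∎
    where
    B = λ i j → A (transpose zero (suc zero) i) j
    term : SquareMatrix (suc (suc n)) → Fin (suc (suc n)) → Fin (suc (suc n)) → Carrier
    term A a b = A zero a * A (suc zero) b * ∣ (λ r s → A (suc (suc r)) (punchIn₂ a b s)) ∣
    expand₂ : ∀ A → ∣ A ∣ ≈ Σ± (λ j → Σ± (λ k → term A j (punchIn j k)))
    expand₂ A = trans (expand-row A) (Σ±-cong λ j → begin
      A zero j * ∣ (λ r s → A (suc r) (punchIn j s)) ∣
        ≈⟨ *-congˡ (expand-row _) ⟩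
      A zero j * Σ± (λ k → A (suc zero) (punchIn j k) *
        ∣ (λ r s → A (suc (suc r)) (punchIn j (punchIn k s))) ∣)
        ≈⟨ Σ±-* _ _ ⟨
      Σ± (λ k → A zero j * (A (suc zero) (punchIn j k) *
        ∣ (λ r s → A (suc (suc r)) (punchIn j (punchIn k s))) ∣))
        ≈⟨ Σ±-cong (λ k → trans (sym (*-assoc _ _ _)) (*-congˡ (det-cong λ r s →
             reflexive (≡.cong (A (suc (suc r))) (punchIn-punchIn j k s))))) ⟩
      Σ± (λ k → term A j (punchIn j k)) ∎)

  -- The induction step for row operations that leave the first row in place.
  det-negate-minors : ∀ {n} (A B : SquareMatrix (suc n)) → (∀ j → B zero j ≈ A zero j) →
    (∀ k → ∣ (λ r s → B (suc r) (punchIn k s)) ∣ ≈ - ∣ (λ r s → A (suc r) (punchIn k s)) ∣) →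
    ∣ B ∣ ≈ - ∣ A ∣
  det-negate-minors A B row minors = begin
    ∣ B ∣                                                                   ≈⟨ expand-row B ⟩
    Σ± (λ k → B zero k * ∣ (λ r s → B (suc r) (punchIn k s)) ∣)             ≈⟨ Σ±-cong (λ k → *-cong (row k) (minors k)) ⟩
    Σ± (λ k → A zero k * - ∣ (λ r s → A (suc r) (punchIn k s)) ∣)           ≈⟨ Σ±-cong (λ k → sym (-‿distribʳ-* _ _)) ⟩
    Σ± (λ k → - (A zero k * ∣ (λ r s → A (suc r) (punchIn k s)) ∣))         ≈⟨ Σ±-neg _ ⟩
    - Σ± (λ k → A zero k * ∣ (λ r s → A (suc r) (punchIn k s)) ∣)           ≈⟨ -‿cong (expand-row A) ⟨
    - ∣ A ∣                                                                 ∎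

  det-transpose-rows : ∀ {n} (A : SquareMatrix n) i j → i Fin.< j →
    ∣ (λ r s → A (transpose i j r) s) ∣ ≈ - ∣ A ∣
  det-transpose-rows A (suc i) (suc j) (s<s i<j) =
    det-negate-minors A (λ r s → A (transpose (suc i) (suc j) r) s) (λ _ → refl) λ k → begin
      ∣ (λ r s → A (transpose (suc i) (suc j) (suc r)) (punchIn k s)) ∣
        ≈⟨ det-cong-≡ A (λ r → Permutation.lift₀-transpose i j (suc r)) (λ _ → ≡.refl) ⟩
      ∣ (λ r s → A (suc (transpose i j r)) (punchIn k s)) ∣
        ≈⟨ det-transpose-rows (λ r s → A (suc r) (punchIn k s)) i j i<j ⟩
      - ∣ (λ r s → A (suc r) (punchIn k s)) ∣ ∎
  det-transpose-rows A zero (suc zero) _ = det-swap₀₁ A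
  -- Three sign changes: two from the swaps of the first two rows, one from the transposition
  -- between them, which fixes the first row and falls to the minors.
  det-transpose-rows A zero (suc (suc j)) _ = begin
    ∣ (λ r s → A (transpose zero (suc (suc j)) r) s) ∣
      ≈⟨ det-cong-≡ A (transpose-conjugate j) (λ _ → ≡.refl) ⟩
    ∣ (λ r s → A (t (transpose (suc zero) (suc (suc j)) (t r))) s) ∣
      ≈⟨ det-swap₀₁ (λ r s → A (t (transpose (suc zero) (suc (suc j)) r)) s) ⟩
    - ∣ (λ r s → A (t (transpose (suc zero) (suc (suc j)) r)) s) ∣
      ≈⟨ -‿cong (det-negate-minors (λ r s → A (t r) s) _ (λ _ → refl) λ k → begin
        ∣ (λ r s → A (t (transpose (suc zero) (suc (suc j)) (suc r))) (punchIn k s)) ∣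
          ≈⟨ det-cong-≡ A (λ r → ≡.cong t (Permutation.lift₀-transpose zero (suc j) (suc r))) (λ _ → ≡.refl) ⟩
        ∣ (λ r s → A (t (suc (transpose zero (suc j) r))) (punchIn k s)) ∣
          ≈⟨ det-transpose-rows (λ r s → A (t (suc r)) (punchIn k s)) zero (suc j) z<s ⟩
        - ∣ (λ r s → A (t (suc r)) (punchIn k s)) ∣ ∎) ⟩
    - - ∣ (λ r s → A (t r) s) ∣
      ≈⟨ -‿cong (-‿cong (det-swap₀₁ A)) ⟩
    - - - ∣ A ∣
      ≈⟨ -‿involutive _ ⟩
    - ∣ A ∣ ∎
    where
    t : ∀ {n} → Fin (suc (suc n)) → Fin (suc (suc n))
    t = transpose zero (suc zero)

  det-transpose-< : ∀ {n} (A : SquareMatrix n) {i j} → i Fin.< j →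
    ∣ (λ r s → A (transpose i j r) (transpose i j s)) ∣ ≈ ∣ A ∣
  det-transpose-< A {i} {j} i<j = begin
    ∣ (λ r s → A (transpose i j r) (transpose i j s)) ∣
      ≈⟨ det-transpose-rows (λ r s → A r (transpose i j s)) i j i<j ⟩
    - ∣ (λ r s → A r (transpose i j s)) ∣
      ≈⟨ -‿cong (det-transpose λ r s → A r (transpose i j s)) ⟩
    - ∣ (λ r s → A s (transpose i j r)) ∣
      ≈⟨ -‿cong (det-transpose-rows (λ r s → A s r) i j i<j) ⟩
    - - ∣ (λ r s → A s r) ∣
      ≈⟨ -‿involutive _ ⟩
    ∣ (λ r s → A s r) ∣
      ≈⟨ det-transpose A ⟨
    ∣ A ∣ ∎

  det-transpose-both : ∀ {n} (A : SquareMatrix n) i j →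
    ∣ (λ r s → A (transpose i j r) (transpose i j s)) ∣ ≈ ∣ A ∣
  det-transpose-both A i j with Fin.<-cmp i j
  ... | tri< i<j _ _    = det-transpose-< A i<j
  ... | tri≈ _ ≡.refl _ = det-cong-≡ A (transpose-self i) (transpose-self i)
  ... | tri> _ _ j<i    =
    trans (det-cong-≡ A (transpose-swap i j) (transpose-swap i j)) (det-transpose-< A j<i)

  -- Rows and columns move together, so that each transposition contributes two signs, which cancel.
  det-permute : ∀ {n} (A : SquareMatrix n) (π : Permutation′ n) →
    ∣ (λ r s → A (π ⟨$⟩ʳ r) (π ⟨$⟩ʳ s)) ∣ ≈ ∣ A ∣
  det-permute A π = begin
    ∣ (λ r s → A (π ⟨$⟩ʳ r) (π ⟨$⟩ʳ s)) ∣
      ≈⟨ det-cong-≡ A (eval-decompose π) (eval-decompose π) ⟨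
    ∣ (λ r s → A (eval (decompose π) ⟨$⟩ʳ r) (eval (decompose π) ⟨$⟩ʳ s)) ∣
      ≈⟨ transpositions (decompose π) ⟩
    ∣ A ∣ ∎
    where
    transpositions : ∀ xs → ∣ (λ r s → A (eval xs ⟨$⟩ʳ r) (eval xs ⟨$⟩ʳ s)) ∣ ≈ ∣ A ∣
    transpositions []             = refl
    transpositions ((i , j) ∷ xs) =
      trans (det-transpose-both (λ r s → A (eval xs ⟨$⟩ʳ r) (eval xs ⟨$⟩ʳ s)) i j) (transpositions xs)

-- The commutative ring of polynomials and evaluation.

module PolynomialRing {r ρ} (R : CommutativeRing r ρ) where
  open CommutativeRing R hiding (zero; _-_)
  open RingProperties ring using (-0#≈0#)
  open IntegerCoefficients R using (module Solver)
  open Solver using (solve; _:+_; _:*_; _:=_)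
  open Polynomial (CommutativeRing.rawRing R) using (Poly; coeff; _+ₚ_; _*ₚ_; const)
  open SetoidReasoning setoid

  Sequence : Set r
  Sequence = ℕ → Carrier

  infix 4 _≋_
  _≋_ : Sequence → Sequence → Set ρ
  s ≋ t = ∀ k → s k ≈ t k

  shift : Sequence → Sequence
  shift s zero    = 0#
  shift s (suc k) = s k

  -- Sequences as formal power series, a module over the polynomials.
  infixr 7 _▷_
  _▷_ : Poly → Sequence → Sequence
  ([] ▷ s) k      = 0#
  ((x ∷ p) ▷ s) k = x * s k + shift (p ▷ s) k

  shift-cong : ∀ {s t} → s ≋ t → shift s ≋ shift t
  shift-cong s≋t zero    = refl
  shift-cong s≋t (suc k) = s≋t k

  shift-+ : ∀ s t → shift (λ k → s k + t k) ≋ λ k → shift s k + shift t k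
  shift-+ s t zero    = sym (+-identityˡ 0#)
  shift-+ s t (suc k) = refl

  shift-* : ∀ c s → shift (λ k → c * s k) ≋ λ k → c * shift s k
  shift-* c s zero    = sym (zeroʳ c)
  shift-* c s (suc k) = refl

  ▷-congʳ : ∀ p {s t} → s ≋ t → p ▷ s ≋ p ▷ t
  ▷-congʳ []      s≋t k = refl
  ▷-congʳ (x ∷ p) s≋t k = +-cong (*-congˡ (s≋t k)) (shift-cong (▷-congʳ p s≋t) k)

  ▷-+ʳ : ∀ p s t → p ▷ (λ k → s k + t k) ≋ λ k → (p ▷ s) k + (p ▷ t) k
  ▷-+ʳ []      s t k = sym (+-identityˡ 0#)
  ▷-+ʳ (x ∷ p) s t k = begin
    x * (s k + t k) + shift (p ▷ (λ k → s k + t k)) k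
      ≈⟨ +-congˡ (trans (shift-cong (▷-+ʳ p s t) k) (shift-+ (p ▷ s) (p ▷ t) k)) ⟩
    x * (s k + t k) + (shift (p ▷ s) k + shift (p ▷ t) k)
      ≈⟨ solve 5 (λ x s t a b → x :* (s :+ t) :+ (a :+ b) := (x :* s :+ a) :+ (x :* t :+ b)) refl _ _ _ _ _ ⟩
    (x * s k + shift (p ▷ s) k) + (x * t k + shift (p ▷ t) k) ∎

  ▷-*ʳ : ∀ p c s → p ▷ (λ k → c * s k) ≋ λ k → c * (p ▷ s) k
  ▷-*ʳ []      c s k = sym (zeroʳ c)
  ▷-*ʳ (x ∷ p) c s k = begin
    x * (c * s k) + shift (p ▷ (λ k → c * s k)) k
      ≈⟨ +-congˡ (trans (shift-cong (▷-*ʳ p c s) k) (shift-* c (p ▷ s) k)) ⟩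
    x * (c * s k) + c * shift (p ▷ s) k
      ≈⟨ solve 4 (λ x c s a → x :* (c :* s) :+ c :* a := c :* (x :* s :+ a)) refl _ _ _ _ ⟩
    c * (x * s k + shift (p ▷ s) k) ∎

  ▷-shift : ∀ p s → p ▷ shift s ≋ shift (p ▷ s)
  ▷-shift []      s zero    = refl
  ▷-shift []      s (suc k) = refl
  ▷-shift (x ∷ p) s zero    = trans (+-congʳ (zeroʳ x)) (+-identityˡ 0#)
  ▷-shift (x ∷ p) s (suc k) = +-congˡ (▷-shift p s k)

  ▷-zero : ∀ p → p ▷ (λ _ → 0#) ≋ λ _ → 0#
  ▷-zero []      k       = refl
  ▷-zero (x ∷ p) zero    = trans (+-congʳ (zeroʳ x)) (+-identityˡ 0#)
  ▷-zero (x ∷ p) (suc k) = trans (+-cong (zeroʳ x) (▷-zero p k)) (+-identityˡ 0#)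

  ▷-+ˡ : ∀ p q s → (p +ₚ q) ▷ s ≋ λ k → (p ▷ s) k + (q ▷ s) k
  ▷-+ˡ []      q       s k = sym (+-identityˡ _)
  ▷-+ˡ (x ∷ p) []      s k = sym (+-identityʳ _)
  ▷-+ˡ (x ∷ p) (y ∷ q) s k = begin
    (x + y) * s k + shift ((p +ₚ q) ▷ s) k
      ≈⟨ +-congˡ (trans (shift-cong (▷-+ˡ p q s) k) (shift-+ (p ▷ s) (q ▷ s) k)) ⟩
    (x + y) * s k + (shift (p ▷ s) k + shift (q ▷ s) k)
      ≈⟨ solve 5 (λ x y s a b → (x :+ y) :* s :+ (a :+ b) := (x :* s :+ a) :+ (y :* s :+ b)) refl _ _ _ _ _ ⟩
    (x * s k + shift (p ▷ s) k) + (y * s k + shift (q ▷ s) k) ∎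

  ▷-*ˡ : ∀ c p s → map (c *_) p ▷ s ≋ λ k → c * (p ▷ s) k
  ▷-*ˡ c []      s k = sym (zeroʳ c)
  ▷-*ˡ c (x ∷ p) s k = begin
    c * x * s k + shift (map (c *_) p ▷ s) k
      ≈⟨ +-congˡ (trans (shift-cong (▷-*ˡ c p s) k) (shift-* c (p ▷ s) k)) ⟩
    c * x * s k + c * shift (p ▷ s) k
      ≈⟨ solve 4 (λ x c s a → c :* x :* s :+ c :* a := c :* (x :* s :+ a)) refl _ _ _ _ ⟩
    c * (x * s k + shift (p ▷ s) k) ∎

  coeff-+ : ∀ p q → coeff (p +ₚ q) ≋ λ k → coeff p k + coeff q k
  coeff-+ []      q       k       = sym (+-identityˡ _)
  coeff-+ (x ∷ p) []      k       = sym (+-identityʳ _)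
  coeff-+ (x ∷ p) (y ∷ q) zero    = refl
  coeff-+ (x ∷ p) (y ∷ q) (suc k) = coeff-+ p q k

  coeff-neg : ∀ p → coeff (map -_ p) ≋ λ k → - coeff p k
  coeff-neg []      k       = sym -0#≈0#
  coeff-neg (x ∷ p) zero    = refl
  coeff-neg (x ∷ p) (suc k) = coeff-neg p k

  coeff-scale : ∀ c p → coeff (map (c *_) p) ≋ λ k → c * coeff p k
  coeff-scale c []      k       = sym (zeroʳ c)
  coeff-scale c (x ∷ p) zero    = refl
  coeff-scale c (x ∷ p) (suc k) = coeff-scale c p k

  coeff-∷ : ∀ x p → coeff (x ∷ p) ≋ λ k → x * coeff (1# ∷ []) k + shift (coeff p) k
  coeff-∷ x p zero    = sym (trans (+-identityʳ _) (*-identityʳ x))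
  coeff-∷ x p (suc k) = sym (trans (+-congʳ (zeroʳ x)) (+-identityˡ _))

  -- Turns the ring laws for lists into laws of the action on sequences, where trailing zeros have
  -- disappeared and addition is pointwise.
  coeff-* : ∀ p q → coeff (p *ₚ q) ≋ p ▷ coeff q
  coeff-* []      q k = refl
  coeff-* (x ∷ p) q k = trans (coeff-+ (map (x *_) q) (0# ∷ p *ₚ q) k) (+-cong (coeff-scale x q k) (tail k))
    where
    tail : coeff (0# ∷ p *ₚ q) ≋ shift (p ▷ coeff q)
    tail zero    = refl
    tail (suc k) = coeff-* p q k

  ▷-assoc : ∀ p q s → (p *ₚ q) ▷ s ≋ p ▷ q ▷ s
  ▷-assoc []      q s k = refl
  ▷-assoc (x ∷ p) q s k = begin
    ((map (x *_) q +ₚ (0# ∷ p *ₚ q)) ▷ s) k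
      ≈⟨ ▷-+ˡ (map (x *_) q) (0# ∷ p *ₚ q) s k ⟩
    (map (x *_) q ▷ s) k + (0# * s k + shift ((p *ₚ q) ▷ s) k)
      ≈⟨ +-cong (▷-*ˡ x q s k) (trans (+-congʳ (zeroˡ _)) (+-identityˡ _)) ⟩
    x * (q ▷ s) k + shift ((p *ₚ q) ▷ s) k
      ≈⟨ +-congˡ (shift-cong (▷-assoc p q s) k) ⟩
    x * (q ▷ s) k + shift (p ▷ q ▷ s) k ∎

  ▷-const : ∀ x s → const x ▷ s ≋ λ k → x * s k
  ▷-const x s zero    = +-identityʳ _
  ▷-const x s (suc k) = +-identityʳ _

  ▷-coeff-1 : ∀ p → p ▷ coeff (1# ∷ []) ≋ coeff p
  ▷-coeff-1 []      k = refl
  ▷-coeff-1 (x ∷ p) k = trans (+-congˡ (shift-cong (▷-coeff-1 p) k)) (sym (coeff-∷ x p k))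

  -- The action of `q` commutes with scaling and with `shift`, from which every `p` is built.
  ▷-comm : ∀ p q → p ▷ coeff q ≋ q ▷ coeff p
  ▷-comm []      q k = sym (▷-zero q k)
  ▷-comm (x ∷ p) q k = begin
    x * coeff q k + shift (p ▷ coeff q) k
      ≈⟨ +-cong (*-congˡ (sym (▷-coeff-1 q k))) (shift-cong (▷-comm p q) k) ⟩
    x * (q ▷ coeff (1# ∷ [])) k + shift (q ▷ coeff p) k
      ≈⟨ +-cong (▷-*ʳ q x _ k) (▷-shift q (coeff p) k) ⟨
    (q ▷ (λ k → x * coeff (1# ∷ []) k)) k + (q ▷ shift (coeff p)) k
      ≈⟨ ▷-+ʳ q _ _ k ⟨
    (q ▷ (λ k → x * coeff (1# ∷ []) k + shift (coeff p) k)) k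
      ≈⟨ ▷-congʳ q (coeff-∷ x p) k ⟨
    (q ▷ coeff (x ∷ p)) k ∎

  infix 4 _≈ₚ_
  _≈ₚ_ : Poly → Poly → Set ρ
  p ≈ₚ q = coeff p ≋ coeff q

  -- Equality ignores trailing zeros, so a polynomial equal to zero may still be a nonempty list.
  ▷-null : ∀ p s → p ≈ₚ [] → p ▷ s ≋ λ _ → 0#
  ▷-null []      s p≈0 k = refl
  ▷-null (x ∷ p) s p≈0 k = begin
    x * s k + shift (p ▷ s) k        ≈⟨ +-cong (*-congʳ (p≈0 zero)) (shift-cong (▷-null p s (p≈0 ∘ suc)) k) ⟩
    0# * s k + shift (λ _ → 0#) k    ≈⟨ +-cong (zeroˡ _) (shift-0 k) ⟩
    0# + 0#                          ≈⟨ +-identityˡ 0# ⟩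
    0#                               ∎
    where
    shift-0 : shift (λ _ → 0#) ≋ λ _ → 0#
    shift-0 zero    = refl
    shift-0 (suc k) = refl

  ▷-congˡ : ∀ p q s → p ≈ₚ q → p ▷ s ≋ q ▷ s
  ▷-congˡ []      q       s p≈q k = sym (▷-null q s (sym ∘ p≈q) k)
  ▷-congˡ (x ∷ p) []      s p≈q k = ▷-null (x ∷ p) s p≈q k
  ▷-congˡ (x ∷ p) (y ∷ q) s p≈q k =
    +-cong (*-congʳ (p≈q zero)) (shift-cong (▷-congˡ p q s (p≈q ∘ suc)) k)

  polynomialRing : CommutativeRing r ρ
  polynomialRing = record
    { Carrier = Poly
    ; _≈_     = _≈ₚ_
    ; _+_     = _+ₚ_
    ; _*_     = _*ₚ_
    ; -_      = map -_
    ; 0#      = []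
    ; 1#      = 1# ∷ []
    ; isCommutativeRing = record
      { isRing = record
        { +-isAbelianGroup = record
          { isGroup = record
            { isMonoid = record
              { isSemigroup = record
                { isMagma = record
                  { isEquivalence = record
                    { refl  = λ k → refl
                    ; sym   = λ p≈q k → sym (p≈q k)
                    ; trans = λ p≈q q≈r k → trans (p≈q k) (q≈r k)
                    }
                  ; ∙-cong = λ {p} {p′} {q} {q′} p≈p′ q≈q′ k →
                      trans (coeff-+ p q k) (trans (+-cong (p≈p′ k) (q≈q′ k)) (sym (coeff-+ p′ q′ k)))
                  }
                ; assoc = λ p q s k → begin
                    coeff ((p +ₚ q) +ₚ s) k              ≈⟨ trans (coeff-+ (p +ₚ q) s k) (+-congʳ (coeff-+ p q k)) ⟩
                    coeff p k + coeff q k + coeff s k    ≈⟨ +-assoc _ _ _ ⟩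
                    coeff p k + (coeff q k + coeff s k)  ≈⟨ trans (coeff-+ p (q +ₚ s) k) (+-congˡ (coeff-+ q s k)) ⟨
                    coeff (p +ₚ (q +ₚ s)) k              ∎
                }
              ; identity = (λ p k → refl)
                         , (λ p k → trans (coeff-+ p [] k) (+-identityʳ _))
              }
            ; inverse = (λ p k → trans (coeff-+ (map -_ p) p k) (trans (+-congʳ (coeff-neg p k)) (-‿inverseˡ _)))
                      , (λ p k → trans (coeff-+ p (map -_ p) k) (trans (+-congˡ (coeff-neg p k)) (-‿inverseʳ _)))
            ; ⁻¹-cong = λ {p} {q} p≈q k → trans (coeff-neg p k) (trans (-‿cong (p≈q k)) (sym (coeff-neg q k)))
            }
          ; comm = λ p q k → trans (coeff-+ p q k) (trans (+-comm _ _) (sym (coeff-+ q p k)))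
          }
        ; *-cong = λ {p} {p′} {q} {q′} p≈p′ q≈q′ k → begin
            coeff (p *ₚ q) k     ≈⟨ coeff-* p q k ⟩
            (p ▷ coeff q) k      ≈⟨ ▷-congˡ p p′ (coeff q) p≈p′ k ⟩
            (p′ ▷ coeff q) k     ≈⟨ ▷-congʳ p′ q≈q′ k ⟩
            (p′ ▷ coeff q′) k    ≈⟨ coeff-* p′ q′ k ⟨
            coeff (p′ *ₚ q′) k   ∎
        ; *-assoc = λ p q s k → begin
            coeff ((p *ₚ q) *ₚ s) k   ≈⟨ coeff-* (p *ₚ q) s k ⟩
            ((p *ₚ q) ▷ coeff s) k    ≈⟨ ▷-assoc p q (coeff s) k ⟩
            (p ▷ q ▷ coeff s) k       ≈⟨ ▷-congʳ p (coeff-* q s) k ⟨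
            (p ▷ coeff (q *ₚ s)) k    ≈⟨ coeff-* p (q *ₚ s) k ⟨
            coeff (p *ₚ (q *ₚ s)) k   ∎
        ; *-identity = (λ p k → trans (coeff-* (1# ∷ []) p k) (trans (▷-const 1# (coeff p) k) (*-identityˡ _)))
                     , (λ p k → trans (coeff-* p (1# ∷ []) k) (▷-coeff-1 p k))
        ; distrib = (λ p q s k → begin
              coeff (p *ₚ (q +ₚ s)) k               ≈⟨ trans (coeff-* p (q +ₚ s) k) (▷-congʳ p (coeff-+ q s) k) ⟩
              (p ▷ (λ k → coeff q k + coeff s k)) k ≈⟨ ▷-+ʳ p (coeff q) (coeff s) k ⟩
              (p ▷ coeff q) k + (p ▷ coeff s) k     ≈⟨ +-cong (coeff-* p q k) (coeff-* p s k) ⟨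
              coeff (p *ₚ q) k + coeff (p *ₚ s) k   ≈⟨ coeff-+ (p *ₚ q) (p *ₚ s) k ⟨
              coeff (p *ₚ q +ₚ p *ₚ s) k            ∎)
          , (λ p q s k → begin
              coeff ((q +ₚ s) *ₚ p) k               ≈⟨ trans (coeff-* (q +ₚ s) p k) (▷-+ˡ q s (coeff p) k) ⟩
              (q ▷ coeff p) k + (s ▷ coeff p) k     ≈⟨ +-cong (coeff-* q p k) (coeff-* s p k) ⟨
              coeff (q *ₚ p) k + coeff (s *ₚ p) k   ≈⟨ coeff-+ (q *ₚ p) (s *ₚ p) k ⟨
              coeff (q *ₚ p +ₚ s *ₚ p) k            ∎)
        }
      ; *-comm = λ p q k → trans (coeff-* p q k) (trans (▷-comm p q k) (sym (coeff-* q p k)))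
      }
    }

  evaluate : Carrier → Poly → Carrier
  evaluate x []      = 0#
  evaluate x (a ∷ p) = a + x * evaluate x p

  evaluate-+ : ∀ x p q → evaluate x (p +ₚ q) ≈ evaluate x p + evaluate x q
  evaluate-+ x []      q       = sym (+-identityˡ _)
  evaluate-+ x (a ∷ p) []      = sym (+-identityʳ _)
  evaluate-+ x (a ∷ p) (b ∷ q) = begin
    a + b + x * evaluate x (p +ₚ q)
      ≈⟨ +-congˡ (*-congˡ (evaluate-+ x p q)) ⟩
    a + b + x * (evaluate x p + evaluate x q)
      ≈⟨ solve 5 (λ a b x p q → a :+ b :+ x :* (p :+ q) := (a :+ x :* p) :+ (b :+ x :* q)) refl _ _ _ _ _ ⟩
    (a + x * evaluate x p) + (b + x * evaluate x q) ∎

  evaluate-scale : ∀ x c p → evaluate x (map (c *_) p) ≈ c * evaluate x p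
  evaluate-scale x c []      = sym (zeroʳ c)
  evaluate-scale x c (a ∷ p) = begin
    c * a + x * evaluate x (map (c *_) p)   ≈⟨ +-congˡ (*-congˡ (evaluate-scale x c p)) ⟩
    c * a + x * (c * evaluate x p)          ≈⟨ solve 4 (λ c a x p → c :* a :+ x :* (c :* p) := c :* (a :+ x :* p)) refl _ _ _ _ ⟩
    c * (a + x * evaluate x p)              ∎

  evaluate-* : ∀ x p q → evaluate x (p *ₚ q) ≈ evaluate x p * evaluate x q
  evaluate-* x []      q = sym (zeroˡ _)
  evaluate-* x (a ∷ p) q = begin
    evaluate x (map (a *_) q +ₚ (0# ∷ p *ₚ q))
      ≈⟨ evaluate-+ x (map (a *_) q) (0# ∷ p *ₚ q) ⟩
    evaluate x (map (a *_) q) + (0# + x * evaluate x (p *ₚ q))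
      ≈⟨ +-cong (evaluate-scale x a q) (trans (+-identityˡ _) (*-congˡ (evaluate-* x p q))) ⟩
    a * evaluate x q + x * (evaluate x p * evaluate x q)
      ≈⟨ solve 4 (λ a x p q → a :* q :+ x :* (p :* q) := (a :+ x :* p) :* q) refl _ _ _ _ ⟩
    (a + x * evaluate x p) * evaluate x q ∎

  evaluate-null : ∀ x p → p ≈ₚ [] → evaluate x p ≈ 0#
  evaluate-null x []      p≈0 = refl
  evaluate-null x (a ∷ p) p≈0 = begin
    a + x * evaluate x p   ≈⟨ +-cong (p≈0 zero) (*-congˡ (evaluate-null x p (p≈0 ∘ suc))) ⟩
    0# + x * 0#            ≈⟨ trans (+-identityˡ _) (zeroʳ x) ⟩
    0#                     ∎

  evaluate-cong : ∀ x p q → p ≈ₚ q → evaluate x p ≈ evaluate x q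
  evaluate-cong x []      q       p≈q = sym (evaluate-null x q (sym ∘ p≈q))
  evaluate-cong x (a ∷ p) []      p≈q = evaluate-null x (a ∷ p) p≈q
  evaluate-cong x (a ∷ p) (b ∷ q) p≈q = +-cong (p≈q zero) (*-congˡ (evaluate-cong x p q (p≈q ∘ suc)))

-- Identities and periodicity of Dickson polynomials.

-- Dickson polynomials: D n (z + 1/z) = zⁿ + 1/zⁿ.
module Dickson {r ρ} (R : CommutativeRing r ρ) where
  open CommutativeRing R hiding (zero)
  open IntegerCoefficients R using (fromℤ; fromℤ-+; fromℤ-*; fromℤ-neg; module Solver)
  open Solver using (solve; _:+_; _:*_; _:-_; _:=_; :-_; con)
  open SetoidReasoning setoid

  D : ℕ → Carrier → Carrier
  D zero          x = fromℤ (+ 2)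
  D (suc zero)    x = x
  D (suc (suc n)) x = x * D (suc n) x - D n x

  D-cong : ∀ n {x y} → x ≈ y → D n x ≈ D n y
  D-cong zero          x≈y = refl
  D-cong (suc zero)    x≈y = x≈y
  D-cong (suc (suc n)) x≈y = +-cong (*-cong x≈y (D-cong (suc n) x≈y)) (-‿cong (D-cong n x≈y))

  D-index : ∀ {m n} x → m ≡ n → D m x ≈ D n x
  D-index x ≡.refl = refl

  -- The product of z^j + z^-j and z^(j+k) + z^-(j+k). The second index is written as j + k so that
  -- the difference of the indices is the natural number k.
  D-* : ∀ j k x → D j x * D (j ℕ.+ k) x ≈ D (j ℕ.+ (j ℕ.+ k)) x + D k x
  D-* zero          k x = solve 1 (λ d → con (+ 2) :* d := d :+ d) refl (D k x)
  D-* (suc zero)    k x = solve 3 (λ x a b → x :* a := (x :* a :- b) :+ b) refl x (D (suc k) x) (D k x)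
  D-* (suc (suc j)) k x = begin
    (x * D (suc j) x - D j x) * D (suc (suc (j ℕ.+ k))) x
      ≈⟨ solve 4 (λ x a b c → (x :* a :- b) :* c := x :* (a :* c) :- b :* c) refl _ _ _ _ ⟩
    x * (D (suc j) x * D (suc (suc (j ℕ.+ k))) x) - D j x * D (suc (suc (j ℕ.+ k))) x
      ≈⟨ +-cong (*-congˡ (*-congˡ (D-index x (≡.cong suc (ℕ.+-suc j k)))))
           (-‿cong (*-congˡ (D-index x (≡.trans (ℕ.+-suc j (suc k)) (≡.cong suc (ℕ.+-suc j k)))))) ⟨
    x * (D (suc j) x * D (suc j ℕ.+ suc k) x) - D j x * D (j ℕ.+ suc (suc k)) x
      ≈⟨ +-cong (*-congˡ (D-* (suc j) (suc k) x)) (-‿cong (D-* j (suc (suc k)) x)) ⟩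
    x * (D (suc j ℕ.+ (suc j ℕ.+ suc k)) x + D (suc k) x) - (D (j ℕ.+ (j ℕ.+ suc (suc k))) x + D (suc (suc k)) x)
      ≈⟨ +-cong (*-congˡ (+-congʳ (D-index x e₁))) (-‿cong (+-congʳ (D-index x e₀))) ⟩
    x * (D (suc l) x + D (suc k) x) - (D l x + D (suc (suc k)) x)
      ≈⟨ solve 5 (λ x a b c d → x :* (a :+ c) :- (b :+ (x :* c :- d)) := (x :* a :- b) :+ d) refl
           x (D (suc l) x) (D l x) (D (suc k) x) (D k x) ⟩
    D (suc (suc l)) x + D k x
      ≈⟨ +-congʳ (D-index x e₂) ⟩
    D (suc (suc j) ℕ.+ (suc (suc j) ℕ.+ k)) x + D k x ∎
    where
    l = suc (suc (j ℕ.+ (j ℕ.+ k)))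
    e₀ : j ℕ.+ (j ℕ.+ suc (suc k)) ≡ l
    e₀ rewrite ℕ.+-suc j (suc k) | ℕ.+-suc j k | ℕ.+-suc j (suc (j ℕ.+ k)) | ℕ.+-suc j (j ℕ.+ k) = ≡.refl
    e₁ : suc j ℕ.+ (suc j ℕ.+ suc k) ≡ suc l
    e₁ rewrite ℕ.+-suc j k | ℕ.+-suc j (suc (j ℕ.+ k)) | ℕ.+-suc j (j ℕ.+ k) = ≡.refl
    e₂ : suc (suc l) ≡ suc (suc j) ℕ.+ (suc (suc j) ℕ.+ k)
    e₂ rewrite ℕ.+-suc j (suc (j ℕ.+ k)) | ℕ.+-suc j (j ℕ.+ k) = ≡.refl

  -- Replacing z by z^k turns D m into D (m k). In the induction, `D-*` shows that the multiples of
  -- k satisfy the recursion with D k x in place of x.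
  D-∘ : ∀ m k x → D m (D k x) ≈ D (m ℕ.* k) x
  D-∘ zero          k x = refl
  D-∘ (suc zero)    k x = D-index x (≡.sym (ℕ.+-identityʳ k))
  D-∘ (suc (suc m)) k x = begin
    D k x * D (suc m) (D k x) - D m (D k x)
      ≈⟨ +-cong (*-congˡ (D-∘ (suc m) k x)) (-‿cong (D-∘ m k x)) ⟩
    D k x * D (k ℕ.+ m ℕ.* k) x - D (m ℕ.* k) x
      ≈⟨ +-congʳ (D-* k (m ℕ.* k) x) ⟩
    D (k ℕ.+ (k ℕ.+ m ℕ.* k)) x + D (m ℕ.* k) x - D (m ℕ.* k) x
      ≈⟨ solve 2 (λ a b → a :+ b :- b := a) refl _ _ ⟩
    D (suc (suc m) ℕ.* k) x ∎

  D-2 : ∀ n → D n (fromℤ (+ 2)) ≈ fromℤ (+ 2)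
  D-2 zero          = refl
  D-2 (suc zero)    = refl
  D-2 (suc (suc n)) = begin
    fromℤ (+ 2) * D (suc n) (fromℤ (+ 2)) - D n (fromℤ (+ 2))
      ≈⟨ +-cong (*-congˡ (D-2 (suc n))) (-‿cong (D-2 n)) ⟩
    fromℤ (+ 2) * fromℤ (+ 2) - fromℤ (+ 2)
      ≈⟨ solve 0 (con (+ 2) :* con (+ 2) :- con (+ 2) := con (+ 2)) refl ⟩
    fromℤ (+ 2) ∎

  -- The step (b, a) to (a, x a - b) preserves the form a² - x a b + b². Its value on the initial
  -- pair is x² - 2 x² + 4, which in terms of z is - (z - 1/z)².
  D-invariant : ∀ n x → D (suc n) x * D (suc n) x - x * D (suc n) x * D n x + D n x * D n x ≈
    fromℤ (+ 4) - x * x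
  D-invariant zero    x = solve 1 (λ x → x :* x :- x :* x :* con (+ 2) :+ con (+ 2) :* con (+ 2) := con (+ 4) :- x :* x) refl x
  D-invariant (suc n) x = trans
    (solve 3 (λ x a b → (x :* a :- b) :* (x :* a :- b) :- x :* (x :* a :- b) :* a :+ a :* a
                        := a :* a :- x :* a :* b :+ b :* b) refl x (D (suc n) x) (D n x))
    (D-invariant n x)

  -- If D n x = 2, the invariant says that (D (n + 1) x - x)² = 0.
  module _ (reduced : ∀ y → y * y ≈ 0# → y ≈ 0#) {x n} (Dn≈2 : D n x ≈ fromℤ (+ 2)) where

    D-suc-period : D (suc n) x ≈ x
    D-suc-period = begin
      D (suc n) x            ≈⟨ solve 2 (λ a x → a := (a :- x) :+ x) refl _ x ⟩
      (D (suc n) x - x) + x  ≈⟨ +-congʳ (reduced _ square≈0) ⟩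
      0# + x                 ≈⟨ +-identityˡ x ⟩
      x                      ∎
      where
      d = D (suc n) x
      square≈0 : (d - x) * (d - x) ≈ 0#
      square≈0 = begin
        (d - x) * (d - x)
          ≈⟨ solve 2 (λ d x → (d :- x) :* (d :- x) :=
               (d :* d :- x :* d :* con (+ 2) :+ con (+ 2) :* con (+ 2)) :- (con (+ 4) :- x :* x)) refl d x ⟩
        (d * d - x * d * fromℤ (+ 2) + fromℤ (+ 2) * fromℤ (+ 2)) - (fromℤ (+ 4) - x * x)
          ≈⟨ +-congʳ (+-cong (+-congˡ (-‿cong (*-congˡ Dn≈2))) (*-cong Dn≈2 Dn≈2)) ⟨
        (d * d - x * d * D n x + D n x * D n x) - (fromℤ (+ 4) - x * x)
          ≈⟨ +-congʳ (D-invariant n x) ⟩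
        (fromℤ (+ 4) - x * x) - (fromℤ (+ 4) - x * x)
          ≈⟨ -‿inverseʳ _ ⟩
        0# ∎

    D-period : ∀ k → D (k ℕ.+ n) x ≈ D k x
    D-period zero          = Dn≈2
    D-period (suc zero)    = D-suc-period
    D-period (suc (suc k)) = +-cong (*-congˡ (D-period (suc k))) (-‿cong (D-period k))

  -- The quadratic remainder in D n (2 + w) = 2 + n² w + O(w²).
  D-remainder : ℕ → Carrier → Carrier
  D-remainder zero          w = 0#
  D-remainder (suc zero)    w = 0#
  D-remainder (suc (suc n)) w =
    (fromℤ (+ 2) + w) * D-remainder (suc n) w + fromℤ (+ suc n ℤ.* + suc n) - D-remainder n w

  -- The linear coefficients are squares since (n + 2)² = 2 (n + 1)² + 2 - n². They are kept as
  -- images of integers because their parity decides the odd case of `near-2⇒2`.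
  D-near-2 : ∀ n w → D n (fromℤ (+ 2) + w) ≈
    fromℤ (+ 2) + fromℤ (+ n ℤ.* + n) * w + w * w * D-remainder n w
  D-near-2 zero    w = solve 1 (λ w → con (+ 2) := con (+ 2) :+ con (+ 0) :* w :+ w :* w :* con (+ 0)) refl w
  D-near-2 (suc zero) w = solve 1 (λ w → con (+ 2) :+ w := con (+ 2) :+ con (+ 1) :* w :+ w :* w :* con (+ 0)) refl w
  D-near-2 (suc (suc n)) w = begin
    (fromℤ (+ 2) + w) * D (suc n) (fromℤ (+ 2) + w) - D n (fromℤ (+ 2) + w)
      ≈⟨ +-cong (*-congˡ (D-near-2 (suc n) w)) (-‿cong (D-near-2 n w)) ⟩
    (fromℤ (+ 2) + w) * (fromℤ (+ 2) + s₁ * w + w * w * g₁) - (fromℤ (+ 2) + s₀ * w + w * w * g₀)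
      ≈⟨ solve 5 (λ w s₁ g₁ s₀ g₀ →
           (con (+ 2) :+ w) :* (con (+ 2) :+ s₁ :* w :+ w :* w :* g₁) :- (con (+ 2) :+ s₀ :* w :+ w :* w :* g₀) :=
           con (+ 2) :+ (con (+ 2) :* s₁ :+ con (+ 2) :+ :- s₀) :* w :+ w :* w :* ((con (+ 2) :+ w) :* g₁ :+ s₁ :- g₀))
           refl w s₁ g₁ s₀ g₀ ⟩
    fromℤ (+ 2) + (fromℤ (+ 2) * s₁ + fromℤ (+ 2) + - s₀) * w + w * w * D-remainder (suc (suc n)) w
      ≈⟨ +-congʳ (+-congˡ (*-congʳ squares)) ⟨
    fromℤ (+ 2) + fromℤ (+ suc (suc n) ℤ.* + suc (suc n)) * w + w * w * D-remainder (suc (suc n)) w ∎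
    where
    s₁ = fromℤ (+ suc n ℤ.* + suc n)
    g₁ = D-remainder (suc n) w
    s₀ = fromℤ (+ n ℤ.* + n)
    g₀ = D-remainder n w
    open import Data.Integer.Solver as ℤSolver using ()
    module Z = ℤSolver.+-*-Solver
    squares : fromℤ (+ suc (suc n) ℤ.* + suc (suc n)) ≈ fromℤ (+ 2) * s₁ + fromℤ (+ 2) + - s₀
    squares = begin
      fromℤ (+ suc (suc n) ℤ.* + suc (suc n))
        ≡⟨ ≡.cong fromℤ (Z.solve 1 (λ n →
             (Z.con (+ 2) Z.:+ n) Z.:* (Z.con (+ 2) Z.:+ n) Z.:=
             Z.con (+ 2) Z.:* ((Z.con (+ 1) Z.:+ n) Z.:* (Z.con (+ 1) Z.:+ n)) Z.:+ Z.con (+ 2) Z.:+ Z.:- (n Z.:* n))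
             ≡.refl (+ n)) ⟩
      fromℤ (+ 2 ℤ.* (+ suc n ℤ.* + suc n) ℤ.+ + 2 ℤ.+ ℤ.- (+ n ℤ.* + n))
        ≈⟨ trans (fromℤ-+ (+ 2 ℤ.* (+ suc n ℤ.* + suc n) ℤ.+ + 2) (ℤ.- (+ n ℤ.* + n))) (+-cong (trans (fromℤ-+ (+ 2 ℤ.* (+ suc n ℤ.* + suc n)) (+ 2)) (+-congʳ (fromℤ-* (+ 2) (+ suc n ℤ.* + suc n)))) (fromℤ-neg (+ n ℤ.* + n))) ⟩
      fromℤ (+ 2) * s₁ + fromℤ (+ 2) + - s₀ ∎

-- The characteristic polynomial of a cycle.

toℕ-punchIn-fromℕ : ∀ {n} (i : Fin n) → toℕ (punchIn (Fin.fromℕ n) i) ≡ toℕ i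
toℕ-punchIn-fromℕ zero    = ≡.refl
toℕ-punchIn-fromℕ (suc i) = ≡.cong suc (toℕ-punchIn-fromℕ i)

module CycleDeterminant {r ρ} (R : CommutativeRing r ρ) (x : CommutativeRing.Carrier R) where
  open CommutativeRing R hiding (zero)
  open IntegerCoefficients R using (fromℤ; module Solver)
  open Solver using (solve; _:+_; _:*_; _:-_; _:=_; :-_; con)
  open Matrix (CommutativeRing.rawRing R) using (SquareMatrix; det)
  open Determinant R
  open Dickson R
  open SetoidReasoning setoid

  Σ±-head : ∀ {n} (f : Vector Carrier (suc n)) → (∀ i → f (suc i) ≈ 0#) → Σ± f ≈ f zero
  Σ±-head f f≈0 = begin
    Σ± f                     ≈⟨ Σ±-∷ f ⟩
    f zero + - Σ± (f ∘ suc)  ≈⟨ +-congˡ (-‿cong (Σ±-zero _ f≈0)) ⟩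
    f zero + - 0#            ≈⟨ solve 1 (λ a → a :+ :- con (+ 0) := a) refl _ ⟩
    f zero                   ∎

  -- Indexed by natural numbers, so that submatrices of consecutive rows and columns reduce.
  neighbour : ℕ → Carrier
  neighbour zero    = - 1#
  neighbour (suc i) = 0#

  band : ℕ → ℕ → Carrier
  band zero    zero    = x
  band zero    (suc j) = neighbour j
  band (suc i) zero    = neighbour i
  band (suc i) (suc j) = band i j

  band-sym : ∀ i j → band i j ≈ band j i
  band-sym zero    zero    = refl
  band-sym zero    (suc j) = refl
  band-sym (suc i) zero    = refl
  band-sym (suc i) (suc j) = band-sym i j

  -- The characteristic determinant of the path on n vertices, the Chebyshev polynomial of the
  -- second kind U n (x/2).
  path : ℕ → Carrier
  path n = ∣ (λ (i j : Fin n) → band (toℕ i) (toℕ j)) ∣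

  path-step : ∀ n → path (suc (suc n)) ≈ x * path (suc n) - path n
  path-step n = begin
    path (suc (suc n))
      ≈⟨ trans (expand-row _) (Σ±-∷ _) ⟩
    x * path (suc n) - Σ± (λ j → band 0 (suc (toℕ j)) * minor (suc j))
      ≈⟨ +-congˡ (-‿cong (Σ±-head _ λ j → zeroˡ _)) ⟩
    x * path (suc n) - - 1# * minor (suc zero)
      ≈⟨ +-congˡ (-‿cong (*-congˡ (trans (expand-column _) (Σ±-head _ λ j → zeroˡ _)))) ⟩
    x * path (suc n) - - 1# * (- 1# * path n)
      ≈⟨ solve 3 (λ x a b → x :* a :- (:- con (+ 1)) :* ((:- con (+ 1)) :* b) := x :* a :- b) refl _ _ _ ⟩
    x * path (suc n) - path n ∎
    where
    minor : Fin (suc (suc n)) → Carrier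
    minor j = ∣ (λ (r s : Fin (suc n)) → band (suc (toℕ r)) (toℕ (punchIn j s))) ∣

  path-0 : path 0 ≈ 1#
  path-0 = det-[] _

  path-1 : path 1 ≈ x
  path-1 = begin
    path 1      ≈⟨ trans (expand-row _) (Σ±-head _ λ ()) ⟩
    x * path 0  ≈⟨ *-congˡ path-0 ⟩
    x * 1#      ≈⟨ *-identityʳ x ⟩
    x           ∎

  -- The relation D m = U m - U (m - 2) between the two kinds of Chebyshev polynomials, with U m
  -- eliminated by the recursion.
  path-D : ∀ n → x * path (suc n) - fromℤ (+ 2) * path n ≈ D (suc (suc n)) x
  path-D zero = begin
    x * path 1 - fromℤ (+ 2) * path 0   ≈⟨ +-cong (*-congˡ path-1) (-‿cong (*-congˡ path-0)) ⟩
    x * x - fromℤ (+ 2) * 1#            ≈⟨ +-congˡ (-‿cong (*-identityʳ _)) ⟩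
    x * x - fromℤ (+ 2)                 ∎
  path-D (suc zero) = begin
    x * path 2 - fromℤ (+ 2) * path 1
      ≈⟨ +-cong (*-congˡ (trans (path-step 0) (+-cong (*-congˡ path-1) (-‿cong path-0)))) (-‿cong (*-congˡ path-1)) ⟩
    x * (x * x - 1#) - fromℤ (+ 2) * x
      ≈⟨ solve 1 (λ x → x :* (x :* x :- con (+ 1)) :- con (+ 2) :* x := x :* (x :* x :- con (+ 2)) :- x) refl x ⟩
    D 3 x ∎
  path-D (suc (suc n)) = begin
    x * path (3 ℕ.+ n) - fromℤ (+ 2) * path (2 ℕ.+ n)
      ≈⟨ +-cong (*-congˡ (path-step (suc n))) (-‿cong (*-congˡ (path-step n))) ⟩
    x * (x * path (2 ℕ.+ n) - path (suc n)) - fromℤ (+ 2) * (x * path (suc n) - path n)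
      ≈⟨ solve 4 (λ x a b c → x :* (x :* a :- b) :- con (+ 2) :* (x :* b :- c) :=
           x :* (x :* a :- con (+ 2) :* b) :- (x :* b :- con (+ 2) :* c)) refl _ _ _ _ ⟩
    x * (x * path (2 ℕ.+ n) - fromℤ (+ 2) * path (suc n)) - (x * path (suc n) - fromℤ (+ 2) * path n)
      ≈⟨ +-cong (*-congˡ (path-D (suc n))) (-‿cong (path-D n)) ⟩
    D (4 ℕ.+ n) x ∎

  sign : ℕ → Carrier
  sign zero    = 1#
  sign (suc n) = - sign n

  sign² : ∀ n → sign n * sign n ≈ 1#
  sign² zero    = *-identityˡ 1#
  sign² (suc n) = trans (solve 1 (λ s → (:- s) :* (:- s) := s :* s) refl (sign n)) (sign² n)

  -- The shifted matrix is lower triangular with - 1 on the diagonal: its entries with j > i lie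
  -- outside the band.
  lower : ∀ n → ∣ (λ (i j : Fin n) → band (toℕ i) (suc (toℕ j))) ∣ ≈ sign n
  lower zero    = det-[] _
  lower (suc n) = begin
    ∣ (λ (i j : Fin (suc n)) → band (toℕ i) (suc (toℕ j))) ∣
      ≈⟨ trans (expand-row _) (Σ±-head _ λ j → zeroˡ _) ⟩
    - 1# * ∣ (λ (i j : Fin n) → band (toℕ i) (suc (toℕ j))) ∣
      ≈⟨ *-congˡ (lower n) ⟩
    - 1# * sign n
      ≈⟨ solve 1 (λ s → (:- con (+ 1)) :* s := :- s) refl _ ⟩
    - sign n ∎

  upper : ∀ n → ∣ (λ (i j : Fin n) → band (suc (toℕ i)) (toℕ j)) ∣ ≈ sign n
  upper n = begin
    ∣ (λ (i j : Fin n) → band (suc (toℕ i)) (toℕ j)) ∣   ≈⟨ det-cong (λ i j → band-sym (suc (toℕ i)) (toℕ j)) ⟩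
    ∣ (λ (i j : Fin n) → band (toℕ j) (suc (toℕ i))) ∣   ≈⟨ det-transpose (λ (i j : Fin n) → band (toℕ i) (suc (toℕ j))) ⟨
    ∣ (λ (i j : Fin n) → band (toℕ i) (suc (toℕ j))) ∣   ≈⟨ lower n ⟩
    sign n                                               ∎

  last-entry : ∀ {n} → Fin (suc n) → Carrier
  last-entry {zero}  zero    = - 1#
  last-entry {suc n} zero    = 0#
  last-entry {suc n} (suc i) = last-entry i

  -- Vertex 0 is joined to the first and the last vertex of the path that remains without it.
  end-entries : ∀ {n} → Fin (suc (suc n)) → Carrier
  end-entries zero    = - 1#
  end-entries (suc i) = last-entry i

  Σ±-last-entry : ∀ {n} (f : Vector Carrier (suc n)) →
    Σ± (λ i → last-entry i * f i) ≈ - (sign n * f (Fin.fromℕ n))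
  Σ±-last-entry {zero}  f = trans (Σ±-head _ λ ())
    (solve 1 (λ a → (:- con (+ 1)) :* a := :- (con (+ 1) :* a)) refl _)
  Σ±-last-entry {suc n} f = begin
    Σ± (λ i → last-entry i * f i)
      ≈⟨ Σ±-∷ _ ⟩
    0# * f zero - Σ± (λ i → last-entry i * f (suc i))
      ≈⟨ +-congˡ (-‿cong (Σ±-last-entry (f ∘ suc))) ⟩
    0# * f zero - - (sign n * f (Fin.fromℕ (suc n)))
      ≈⟨ solve 3 (λ a s b → con (+ 0) :* a :- :- (s :* b) := :- ((:- s) :* b)) refl _ _ _ ⟩
    - (- sign n * f (Fin.fromℕ (suc n))) ∎

  Σ±-end-entries : ∀ {n} (f : Vector Carrier (suc (suc n))) →
    Σ± (λ i → end-entries i * f i) ≈ - (f zero + sign (suc n) * f (Fin.fromℕ (suc n)))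
  Σ±-end-entries {n} f = begin
    Σ± (λ i → end-entries i * f i)
      ≈⟨ Σ±-∷ _ ⟩
    - 1# * f zero - Σ± (λ i → last-entry i * f (suc i))
      ≈⟨ +-congˡ (-‿cong (Σ±-last-entry (f ∘ suc))) ⟩
    - 1# * f zero - - (sign n * f (Fin.fromℕ (suc n)))
      ≈⟨ solve 3 (λ a s b → (:- con (+ 1)) :* a :- :- (s :* b) := :- (a :+ (:- s) :* b)) refl _ _ _ ⟩
    - (f zero + - sign n * f (Fin.fromℕ (suc n))) ∎

  cycleMatrix : ∀ n → SquareMatrix (3 ℕ.+ n)
  cycleMatrix n zero    zero    = x
  cycleMatrix n zero    (suc j) = end-entries j
  cycleMatrix n (suc i) zero    = end-entries i
  cycleMatrix n (suc i) (suc j) = band (toℕ i) (toℕ j)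

  -- Without vertex 0 the cycle is a path on n + 2 vertices. The border entries select the minors at
  -- its ends: deleting the same end from rows and columns leaves a shorter path, deleting opposite
  -- ends leaves a triangular matrix. The two triangular minors, each multiplied by its own sign,
  -- account for the constant 2.
  det-cycleMatrix : ∀ n → ∣ cycleMatrix n ∣ ≈ D (3 ℕ.+ n) x - fromℤ (+ 2)
  det-cycleMatrix n = begin
    ∣ cycleMatrix n ∣
      ≈⟨ expand-border det-transpose det-transpose (cycleMatrix n) ⟩
    x * path (2 ℕ.+ n) - Σ± (λ j → Σ± (λ i → end-entries j * end-entries i * minor i j))
      ≈⟨ +-congˡ (-‿cong (Σ±-cong λ j → trans (Σ±-cong λ i → *-assoc _ _ _) (Σ±-* (end-entries j) _))) ⟩
    x * path (2 ℕ.+ n) - Σ± (λ j → end-entries j * Σ± (λ i → end-entries i * minor i j))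
      ≈⟨ +-congˡ (-‿cong (Σ±-end-entries (λ j → Σ± (λ i → end-entries i * minor i j)))) ⟩
    x * path (2 ℕ.+ n) - - (Σ± (λ i → end-entries i * minor i zero) + s * Σ± (λ i → end-entries i * minor i l))
      ≈⟨ +-congˡ (-‿cong (-‿cong (+-cong (Σ±-end-entries (λ i → minor i zero)) (*-congˡ (Σ±-end-entries (λ i → minor i l)))))) ⟩
    x * path (2 ℕ.+ n) - - (- (minor zero zero + s * minor l zero) + s * - (minor zero l + s * minor l l))
      ≈⟨ solve 7 (λ x p a b c d s → x :* p :- :- (:- (a :+ s :* b) :+ s :* :- (c :+ s :* d)) :=
           x :* p :- a :- s :* b :- s :* c :- s :* s :* d) refl x (path (2 ℕ.+ n)) (minor zero zero) (minor l zero) (minor zero l) (minor l l) s ⟩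
    x * path (2 ℕ.+ n) - minor zero zero - s * minor l zero - s * minor zero l - s * s * minor l l
      ≈⟨ +-cong (+-cong (+-congˡ (-‿cong (*-congˡ minor-l0))) (-‿cong (*-congˡ minor-0l)))
           (-‿cong (*-cong (sign² (suc n)) minor-ll)) ⟩
    x * path (2 ℕ.+ n) - path (suc n) - s * s - s * s - 1# * path (suc n)
      ≈⟨ +-congʳ (+-cong (+-congˡ (-‿cong (sign² (suc n)))) (-‿cong (sign² (suc n)))) ⟩
    x * path (2 ℕ.+ n) - path (suc n) - 1# - 1# - 1# * path (suc n)
      ≈⟨ solve 3 (λ x p q → x :* p :- q :- con (+ 1) :- con (+ 1) :- con (+ 1) :* q :=
           x :* p :- con (+ 2) :* q :- con (+ 2)) refl _ _ _ ⟩
    x * path (2 ℕ.+ n) - fromℤ (+ 2) * path (suc n) - fromℤ (+ 2)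
      ≈⟨ +-congʳ (path-D (suc n)) ⟩
    D (3 ℕ.+ n) x - fromℤ (+ 2) ∎
    where
    s = sign (suc n)
    l = Fin.fromℕ (suc n)
    minor : Fin (2 ℕ.+ n) → Fin (2 ℕ.+ n) → Carrier
    minor i j = ∣ (λ (r s : Fin (suc n)) → band (toℕ (punchIn i r)) (toℕ (punchIn j s))) ∣
    minor-ll : minor l l ≈ path (suc n)
    minor-ll = det-cong λ i j → reflexive (≡.cong₂ band (toℕ-punchIn-fromℕ i) (toℕ-punchIn-fromℕ j))
    minor-l0 : minor l zero ≈ s
    minor-l0 = trans (det-cong λ i j → reflexive (≡.cong (λ k → band k (suc (toℕ j))) (toℕ-punchIn-fromℕ i))) (lower (suc n))
    minor-0l : minor zero l ≈ s
    minor-0l = trans (det-cong λ i j → reflexive (≡.cong (band (suc (toℕ i))) (toℕ-punchIn-fromℕ j))) (upper (suc n))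

  det-cycle : ∀ n (A : SquareMatrix (3 ℕ.+ n)) → (∀ i j → A i j ≈ cycleMatrix n i j) →
    det A ≈ D (3 ℕ.+ n) x - fromℤ (+ 2)
  det-cycle n A A≈ = begin
    det A                        ≡⟨ ∣∣≡det A ⟨
    ∣ A ∣                        ≈⟨ det-cong A≈ ⟩
    ∣ cycleMatrix n ∣            ≈⟨ det-cycleMatrix n ⟩
    D (3 ℕ.+ n) x - fromℤ (+ 2)  ∎

  band-diagonal : ∀ i → band i i ≡ x
  band-diagonal zero    = ≡.refl
  band-diagonal (suc i) = band-diagonal i

  band-adjacent : ∀ i → band i (suc i) ≡ - 1#
  band-adjacent zero    = ≡.refl
  band-adjacent (suc i) = band-adjacent i

  band-adjacent′ : ∀ i → band (suc i) i ≡ - 1#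
  band-adjacent′ zero    = ≡.refl
  band-adjacent′ (suc i) = band-adjacent′ i

  band-distant : ∀ i j → i ≢ j → suc i ≢ j → suc j ≢ i → band i j ≡ 0#
  band-distant zero          zero          i≢j _ _ = contradiction ≡.refl i≢j
  band-distant zero          (suc zero)    _ p _   = contradiction ≡.refl p
  band-distant zero          (suc (suc j)) _ _ _   = ≡.refl
  band-distant (suc zero)    zero          _ _ p   = contradiction ≡.refl p
  band-distant (suc (suc i)) zero          _ _ _   = ≡.refl
  band-distant (suc i)       (suc j)       p q r   =
    band-distant i j (p ∘ ≡.cong suc) (q ∘ ≡.cong suc) (r ∘ ≡.cong suc)

  last-entry-last : ∀ {n} (i : Fin (suc n)) → toℕ i ≡ n → last-entry i ≡ - 1#
  last-entry-last {zero}  zero    _  = ≡.refl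
  last-entry-last {suc n} (suc i) eq = last-entry-last i (ℕ.suc-injective eq)

  last-entry-other : ∀ {n} (i : Fin (suc n)) → toℕ i ≢ n → last-entry i ≡ 0#
  last-entry-other {zero}  zero    ne = contradiction ≡.refl ne
  last-entry-other {suc n} zero    _  = ≡.refl
  last-entry-other {suc n} (suc i) ne = last-entry-other i (ne ∘ ≡.cong suc)

module _ {r ρ} (R : CommutativeRing r ρ) where
  open CommutativeRing R hiding (zero; _-_)
  open RingProperties ring using (-0#≈0#)
  open PolynomialRing R
  open Polynomial (CommutativeRing.rawRing R) using (Poly; X; const)
  open Matrix (CommutativeRing.rawRing R) using (adjacencyMatrix)
  private module R[X] = CommutativeRing polynomialRing
  open Dickson polynomialRing using (D)
  open IntegerCoefficients polynomialRing using (fromℤ)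
  open CycleDeterminant polynomialRing X
  private module CR = CommutativeRing

  ≡⇒≈ : ∀ {p q} → p ≡ q → p ≈ₚ q
  ≡⇒≈ ≡.refl k = refl

  -- Abstracts from the two decisions in an entry of X I - A, so that each can be replaced by its
  -- outcome.
  charEntry : Bool → Bool → Poly
  charEntry diagonal adjacent =
    (if diagonal then X else []) R[X].+ R[X].- const (if adjacent then CR.1# R else CR.0# R)

  charEntry-diagonal : charEntry true false ≈ₚ X
  charEntry-diagonal zero          = trans (+-identityˡ _) -0#≈0#
  charEntry-diagonal (suc zero)    = refl
  charEntry-diagonal (suc (suc k)) = refl

  charEntry-distant : charEntry false false ≈ₚ []
  charEntry-distant zero    = -0#≈0#
  charEntry-distant (suc k) = refl

  cycle-entry : ∀ n (3≤n : 3 ℕ.≤ 3 ℕ.+ n) i j →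
    charEntry (does (i Fin.≟ j)) (does (Graph.adj? (Cycle (3 ℕ.+ n) 3≤n) i j)) ≈ₚ cycleMatrix n i j
  cycle-entry n 3≤n = entry
    where
    open Graph (Cycle (3 ℕ.+ n) 3≤n) using (adj?; Adj; irrefl)

    adjacent : ∀ i j {p} → Adj i j → p ≡ charEntry false true → charEntry false (does (adj? i j)) ≈ₚ p
    adjacent i j adj eq =
      ≡⇒≈ (≡.trans (≡.cong (charEntry false) (dec-true (adj? i j) adj)) (≡.sym eq))

    distant : ∀ i j {p} → ¬ Adj i j → p ≡ [] → charEntry false (does (adj? i j)) ≈ₚ p
    distant i j ¬adj ≡.refl k = trans
      (≡⇒≈ (≡.cong (charEntry false) (dec-false (adj? i j) ¬adj)) k) (charEntry-distant k)

    suc³-injective : ∀ {k l} → suc (suc (suc k)) ≡ suc (suc (suc l)) → k ≡ l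
    suc³-injective ≡.refl = ≡.refl

    entry : ∀ i j → charEntry (does (i Fin.≟ j)) (does (adj? i j)) ≈ₚ cycleMatrix n i j
    entry zero zero             = charEntry-diagonal
    entry zero (suc zero)       = λ k → refl
    entry (suc zero) zero       = λ k → refl
    entry zero (suc (suc j)) with toℕ j ℕ.≟ n
    ... | yes j≡n = adjacent zero (suc (suc j)) (inj₂ (inj₂ (≡.cong (3 ℕ.+_) j≡n , ≡.refl))) (last-entry-last j j≡n)
    ... | no j≢n  = distant zero (suc (suc j))
      (λ { (inj₁ (inj₁ ())) ; (inj₁ (inj₂ (() , _))) ; (inj₂ (inj₁ ()))
         ; (inj₂ (inj₂ (eq , _))) → j≢n (suc³-injective eq) })
      (last-entry-other j j≢n)
    entry (suc (suc i)) zero with toℕ i ℕ.≟ n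
    ... | yes i≡n = adjacent (suc (suc i)) zero (inj₁ (inj₂ (≡.cong (3 ℕ.+_) i≡n , ≡.refl))) (last-entry-last i i≡n)
    ... | no i≢n  = distant (suc (suc i)) zero
      (λ { (inj₁ (inj₁ ())) ; (inj₁ (inj₂ (eq , _))) → i≢n (suc³-injective eq)
         ; (inj₂ (inj₁ ())) ; (inj₂ (inj₂ (() , _))) })
      (last-entry-other i i≢n)
    entry (suc i) (suc j) with i Fin.≟ j
    ... | yes ≡.refl = λ k → trans
      (≡⇒≈ (≡.cong (charEntry true) (dec-false (adj? (suc i) (suc i)) (irrefl {suc i} ≡.refl))) k)
      (trans (charEntry-diagonal k) (≡⇒≈ (≡.sym (band-diagonal (toℕ i))) k))
    ... | no i≢j with suc (toℕ i) ℕ.≟ toℕ j | suc (toℕ j) ℕ.≟ toℕ i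
    ...   | yes i+1≡j | _ = adjacent (suc i) (suc j) (inj₁ (inj₁ (≡.cong suc i+1≡j)))
      (≡.trans (≡.cong (band (toℕ i)) (≡.sym i+1≡j)) (band-adjacent (toℕ i)))
    ...   | no _ | yes j+1≡i = adjacent (suc i) (suc j) (inj₂ (inj₁ (≡.cong suc j+1≡i)))
      (≡.trans (≡.cong (λ k → band k (toℕ j)) (≡.sym j+1≡i)) (band-adjacent′ (toℕ j)))
    ...   | no i+1≢j | no j+1≢i = distant (suc i) (suc j)
      (λ { (inj₁ (inj₁ eq)) → i+1≢j (ℕ.suc-injective eq) ; (inj₁ (inj₂ (_ , ())))
         ; (inj₂ (inj₁ eq)) → j+1≢i (ℕ.suc-injective eq) ; (inj₂ (inj₂ (_ , ()))) })
      (band-distant (toℕ i) (toℕ j) (i≢j ∘ Fin.toℕ-injective) i+1≢j j+1≢i)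

  charPoly-Cycle : ∀ n (3≤n : 3 ℕ.≤ n) →
    charPoly (CR.rawRing R) (adjacencyMatrix (Cycle n 3≤n)) ≈ₚ D n X R[X].- fromℤ (+ 2)
  charPoly-Cycle (suc (suc (suc n))) 3≤n@(s≤s (s≤s (s≤s _))) = det-cycle n
    (λ i j → charEntry (does (i Fin.≟ j)) (does (Graph.adj? (Cycle (3 ℕ.+ n) 3≤n) i j)))
    (cycle-entry n 3≤n)

-- Rational numbers whose powers have bounded denominators.

coprime-* : ∀ {d m p} → Coprime d p → Coprime m p → Coprime (d ℕ.* m) p
coprime-* {d} d⊥p m⊥p {i} (i∣dm , i∣p) = m⊥p (coprime-divisor i⊥d i∣dm , i∣p)
  where
  i⊥d : Coprime i d
  i⊥d (j∣i , j∣d) = d⊥p (j∣d , ∣-trans j∣i i∣p)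

coprime-^ : ∀ {d p} k → Coprime d p → Coprime (d ℕ.^ k) p
coprime-^ zero    d⊥p = 1-coprimeTo _
coprime-^ (suc k) d⊥p = coprime-* d⊥p (coprime-^ k d⊥p)

d^k∣cp^k⇒d^k∣c : ∀ {d p} k c → Coprime d p → d ℕ.^ k ∣ c ℕ.* p ℕ.^ k → d ℕ.^ k ∣ c
d^k∣cp^k⇒d^k∣c {d} {p} k c d⊥p d^k∣ = coprime-divisor
  (Coprimality.sym (coprime-^ k (Coprimality.sym (coprime-^ k d⊥p))))
  (≡.subst (d ℕ.^ k ∣_) (ℕ.*-comm c _) d^k∣)

k<2^k : ∀ k → k ℕ.< 2 ℕ.^ k
k<2^k zero    = s≤s z≤n
k<2^k (suc k) = ℕ.≤-trans (s≤s (k<2^k k))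
  (≡.subst (ℕ._≤ 2 ℕ.^ suc k) (ℕ.+-comm _ 1) (ℕ.+-mono-≤ (ℕ.≤-refl {2 ℕ.^ k}) (ℕ.≤-trans (ℕ.≤-trans (s≤s z≤n) (k<2^k k)) (ℕ.m≤m+n _ 0))))

-- Built directly with denominator 1, so that no normalization stands in the way: `int (+ 0)` and
-- `int (+ 1)` are `0ℚ` and `1ℚ` by computation.
int : ℤ → ℚ
int i = mkℚ i 0 (Coprimality.sym (1-coprimeTo _))

int-injective : ∀ {i j} → int i ≡ int j → i ≡ j
int-injective eq = proj₁ (ℚ.mkℚ-injective eq)

int-+ : ∀ i j → int (i ℤ.+ j) ≡ int i ℚ.+ int j
int-+ i j = ℚ.toℚᵘ-injective (ℚᵘ.≃-trans
  (*≡* (solve 2 (λ i j → (i :+ j) :* con (+ 1) := (i :* con (+ 1) :+ j :* con (+ 1)) :* con (+ 1)) ≡.refl i j))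
  (ℚᵘ.≃-sym (ℚ.toℚᵘ-homo-+ (int i) (int j))))
  where open ℤSolver.+-*-Solver

int-* : ∀ i j → int (i ℤ.* j) ≡ int i ℚ.* int j
int-* i j = ℚ.toℚᵘ-injective (ℚᵘ.≃-trans
  (*≡* (≡.refl {x = i ℤ.* j ℤ.* + 1}))
  (ℚᵘ.≃-sym (ℚ.toℚᵘ-homo-* (int i) (int j))))

int-neg : ∀ i → int (ℤ.- i) ≡ ℚ.- int i
int-neg (+ zero)  = ≡.refl
int-neg (+ suc n) = ≡.refl
int-neg -[1+ n ]  = ≡.refl

q*↧≡↥ : ∀ q → q ℚ.* int (ℚ.↧ q) ≡ int (ℚ.↥ q)
q*↧≡↥ q@(mkℚ p d-1 _) = ℚ.toℚᵘ-injective (ℚᵘ.≃-trans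
  (ℚ.toℚᵘ-homo-* q (int (+ suc d-1)))
  (*≡* (ℤ.*-assoc p (+ suc d-1) (+ 1))))

IsInteger : ℚ → Set
IsInteger q = ∃ λ i → q ≡ int i

integer-+ : ∀ {p q} → IsInteger p → IsInteger q → IsInteger (p ℚ.+ q)
integer-+ (i , ≡.refl) (j , ≡.refl) = i ℤ.+ j , ≡.sym (int-+ i j)

integer-* : ∀ {p q} → IsInteger p → IsInteger q → IsInteger (p ℚ.* q)
integer-* (i , ≡.refl) (j , ≡.refl) = i ℤ.* j , ≡.sym (int-* i j)

integer-neg : ∀ {p} → IsInteger p → IsInteger (ℚ.- p)
integer-neg (i , ≡.refl) = ℤ.- i , ≡.sym (int-neg i)

open Exp (CommutativeRing.semiring ℚ.+-*-commutativeRing) using () renaming (_^_ to _^ℚ_)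

-- If the denominator of q is d, then dᵏ divides c for all k.
bounded-denominators⇒integer : ∀ q c → c ≢ + 0 → (∀ k → IsInteger (int c ℚ.* q ^ℚ k)) → IsInteger q
bounded-denominators⇒integer q@(mkℚ p d-1 p⊥d) c c≢0 bounded = main d-1 ≡.refl
  where
  d = suc d-1

  power : ∀ k → int (+ (d ℕ.^ k)) ℚ.* q ^ℚ k ≡ int (p ℤ.^ k)
  power zero    = ≡.refl
  power (suc k) = begin
    int (+ (d ℕ.* d ℕ.^ k)) ℚ.* (q ℚ.* q ^ℚ k)
      ≡⟨ ≡.cong (λ i → int i ℚ.* (q ℚ.* q ^ℚ k)) (ℤ.pos-* d (d ℕ.^ k)) ⟩
    int (+ d ℤ.* + (d ℕ.^ k)) ℚ.* (q ℚ.* q ^ℚ k)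
      ≡⟨ ≡.cong (ℚ._* (q ℚ.* q ^ℚ k)) (int-* (+ d) (+ (d ℕ.^ k))) ⟩
    int (+ d) ℚ.* int (+ (d ℕ.^ k)) ℚ.* (q ℚ.* q ^ℚ k)
      ≡⟨ solve 4 (λ a b c d → a :* b :* (c :* d) := (c :* a) :* (b :* d)) ≡.refl (int (+ d)) (int (+ (d ℕ.^ k))) q (q ^ℚ k) ⟩
    (q ℚ.* int (+ d)) ℚ.* (int (+ (d ℕ.^ k)) ℚ.* q ^ℚ k)
      ≡⟨ ≡.cong₂ ℚ._*_ (q*↧≡↥ q) (power k) ⟩
    int p ℚ.* int (p ℤ.^ k)
      ≡⟨ int-* p (p ℤ.^ k) ⟨
    int (p ℤ.^ suc k) ∎
    where
    open ≡.≡-Reasoning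
    open IntegerCoefficients.Solver ℚ.+-*-commutativeRing

  abs-^ : ∀ k → ℤ.∣ p ℤ.^ k ∣ ≡ ℤ.∣ p ∣ ℕ.^ k
  abs-^ zero    = ≡.refl
  abs-^ (suc k) = ≡.trans (ℤ.abs-* p (p ℤ.^ k)) (≡.cong (ℤ.∣ p ∣ ℕ.*_) (abs-^ k))

  d^k∣c : ∀ k → d ℕ.^ k ∣ ℤ.∣ c ∣
  d^k∣c k = d^k∣cp^k⇒d^k∣c k ℤ.∣ c ∣ (Coprimality.sym (Coprimality.recompute p⊥d)) (divides ℤ.∣ z ∣ (begin
    ℤ.∣ c ∣ ℕ.* ℤ.∣ p ∣ ℕ.^ k       ≡⟨ ≡.cong (ℤ.∣ c ∣ ℕ.*_) (abs-^ k) ⟨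
    ℤ.∣ c ∣ ℕ.* ℤ.∣ p ℤ.^ k ∣       ≡⟨ ℤ.abs-* c (p ℤ.^ k) ⟨
    ℤ.∣ c ℤ.* p ℤ.^ k ∣             ≡⟨ ≡.cong ℤ.∣_∣ cp^k≡zd^k ⟩
    ℤ.∣ z ℤ.* + (d ℕ.^ k) ∣         ≡⟨ ℤ.abs-* z (+ (d ℕ.^ k)) ⟩
    ℤ.∣ z ∣ ℕ.* d ℕ.^ k             ∎))
    where
    open ≡.≡-Reasoning
    open IntegerCoefficients.Solver ℚ.+-*-commutativeRing
    z = proj₁ (bounded k)
    cp^k≡zd^k : c ℤ.* p ℤ.^ k ≡ z ℤ.* + (d ℕ.^ k)
    cp^k≡zd^k = int-injective (begin
      int (c ℤ.* p ℤ.^ k)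
        ≡⟨ int-* c (p ℤ.^ k) ⟩
      int c ℚ.* int (p ℤ.^ k)
        ≡⟨ ≡.cong (int c ℚ.*_) (power k) ⟨
      int c ℚ.* (int (+ (d ℕ.^ k)) ℚ.* q ^ℚ k)
        ≡⟨ solve 3 (λ a b c → a :* (b :* c) := (a :* c) :* b) ≡.refl (int c) (int (+ (d ℕ.^ k))) (q ^ℚ k) ⟩
      (int c ℚ.* q ^ℚ k) ℚ.* int (+ (d ℕ.^ k))
        ≡⟨ ≡.cong (ℚ._* int (+ (d ℕ.^ k))) (proj₂ (bounded k)) ⟩
      int z ℚ.* int (+ (d ℕ.^ k))
        ≡⟨ int-* z (+ (d ℕ.^ k)) ⟨
      int (z ℤ.* + (d ℕ.^ k)) ∎)

  main : ∀ e → e ≡ d-1 → IsInteger q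
  main zero    ≡.refl = p , ≡.refl
  -- For d ≥ 2, the exponent k = |c| gives 2^|c| ≤ d^|c| ≤ |c|, which is impossible.
  main (suc e) ≡.refl = contradiction
    (ℕ.≤-trans (ℕ.^-monoˡ-≤ ℤ.∣ c ∣ (s≤s (s≤s z≤n))) (∣⇒≤ {{ℕ.≢-nonZero (λ eq → c≢0 (ℤ.∣i∣≡0⇒i≡0 eq))}} (d^k∣c ℤ.∣ c ∣)))
    (ℕ.<⇒≱ (k<2^k ℤ.∣ c ∣))

-- Quadratic extensions: coordinates, norm and trace.

commutativeRing : Extension → CommutativeRing _ _
commutativeRing K = Apartness.HeytingCommutativeRing.commutativeRing (Extension.heytingCommutativeRing K)

module FieldProperties (K : Extension) where
  open Extension K using (tight; #⇒invertible; invertible⇒#; ι; ι-homomorphism)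
  open CommutativeRing (commutativeRing K) hiding (zero)
  open IntegerCoefficients (commutativeRing K) using (fromℕ; fromℤ)
  open IntegerCoefficients.Solver (commutativeRing K)
  open RingMorphisms.IsRingHomomorphism ι-homomorphism public
    using () renaming (+-homo to ι-+; *-homo to ι-*; -‿homo to ι-neg; 0#-homo to ι-0; 1#-homo to ι-1)
  open import Algebra.Properties.Semiring.Mult.TCOptimised semiring using (1+×)
  open SetoidReasoning setoid

  ≡⇒ι : ∀ {p q} → p ≡ q → ι p ≈ ι q
  ≡⇒ι ≡.refl = refl

  ι-fromℕ : ∀ n → ι (int (+ n)) ≈ fromℕ n
  ι-fromℕ zero    = ι-0
  ι-fromℕ (suc n) = begin
    ι (int (+ suc n))             ≈⟨ ≡⇒ι (int-+ (+ 1) (+ n)) ⟩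
    ι (1ℚ ℚ.+ int (+ n))          ≈⟨ ι-+ 1ℚ (int (+ n)) ⟩
    ι 1ℚ + ι (int (+ n))          ≈⟨ +-cong ι-1 (ι-fromℕ n) ⟩
    1# + fromℕ n                  ≈⟨ 1+× n 1# ⟨
    fromℕ (suc n)                 ∎

  ι-int : ∀ i → ι (int i) ≈ fromℤ i
  ι-int (+ n)    = ι-fromℕ n
  ι-int -[1+ n ] = trans (ι-neg (int (+ suc n))) (-‿cong (ι-fromℕ (suc n)))

  -- Only an element apart from 0 is known to be invertible. If y were apart from 0, its inverse
  -- would make x vanish; so y is not apart from 0, and tightness applies.
  *-nonzero : ∀ {x y} → x * y ≈ 0# → ¬ x ≈ 0# → y ≈ 0#
  *-nonzero {x} {y} xy≈0 x≉0 = proj₁ (tight y 0#) λ y#0 → x≉0 (x≈0 (#⇒invertible y#0))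
    where
    x≈0 : (∃ λ z → z * (y - 0#) ≈ 1# × (y - 0#) * z ≈ 1#) → x ≈ 0#
    x≈0 (z , _ , yz≈1) = begin
      x                  ≈⟨ *-identityʳ x ⟨
      x * 1#             ≈⟨ *-congˡ yz≈1 ⟨
      x * ((y - 0#) * z) ≈⟨ solve 3 (λ x y z → x :* ((y :- con (+ 0)) :* z) := x :* y :* z) refl x y z ⟩
      x * y * z          ≈⟨ *-congʳ xy≈0 ⟩
      0# * z             ≈⟨ zeroˡ z ⟩
      0#                 ∎

  1≉0 : ¬ 1# ≈ 0#
  1≉0 1≈0 = proj₂ (tight 1# 0#) 1≈0 (invertible⇒# (1# ,
    solve 0 (con (+ 1) :* (con (+ 1) :- con (+ 0)) := con (+ 1)) refl ,
    solve 0 ((con (+ 1) :- con (+ 0)) :* con (+ 1) := con (+ 1)) refl))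

module MatrixIdentities {r ρ} (R : CommutativeRing r ρ) where
  open CommutativeRing R
  open IntegerCoefficients.Solver R

  det-product : ∀ a b c d a′ b′ c′ d′ →
    (a′ * a + c′ * b) * (b′ * c + d′ * d) - (b′ * a + d′ * b) * (a′ * c + c′ * d) ≈
    (a * d - b * c) * (a′ * d′ - b′ * c′)
  det-product = solve 8 (λ a b c d a′ b′ c′ d′ →
    (a′ :* a :+ c′ :* b) :* (b′ :* c :+ d′ :* d) :- (b′ :* a :+ d′ :* b) :* (a′ :* c :+ c′ :* d) :=
    (a :* d :- b :* c) :* (a′ :* d′ :- b′ :* c′)) refl

  -- The determinant of 1 + A. The summands `0#` are the off-diagonal entries of the identity
  -- matrix, in the shape in which `norm-1+` meets them.
  det-1+ : ∀ a b c d → (1# + a) * (1# + d) - (0# + b) * (0# + c) ≈ 1# + (a + d) + (a * d - b * c)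
  det-1+ = solve 4 (λ a b c d →
    (con (+ 1) :+ a) :* (con (+ 1) :+ d) :- (con (+ 0) :+ b) :* (con (+ 0) :+ c) :=
    con (+ 1) :+ (a :+ d) :+ (a :* d :- b :* c)) refl

  +-cancel-- : ∀ p r → p ≈ (p - r) + r
  +-cancel-- = solve 2 (λ p r → p := (p :- r) :+ r) refl

  trace-from-norms : ∀ t n → t ≈ (1# + t + n) - 1# - n
  trace-from-norms = solve 2 (λ t n → t := (con (+ 1) :+ t :+ n) :- con (+ 1) :- n) refl

  det-scale : ∀ s a b c d → (s * s) * (a * d - b * c) ≈ (s * a) * (s * d) - (s * b) * (s * c)
  det-scale = solve 5 (λ s a b c d → (s :* s) :* (a :* d :- b :* c) := (s :* a) :* (s :* d) :- (s :* b) :* (s :* c)) refl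

module QuadraticExtension (K : Extension) (quadratic : HasDegree K 2) where
  open Extension K using (ι)
  open CommutativeRing (commutativeRing K) hiding (zero)
  open IntegerCoefficients (commutativeRing K) using (fromℤ)
  open IntegerCoefficients.Solver (commutativeRing K)
  private module ℚ-Matrix = MatrixIdentities ℚ.+-*-commutativeRing
  open FieldProperties K public
  open Dickson (commutativeRing K)
  open Exp semiring using (_^_)
  open SetoidReasoning setoid
  private
    basis = proj₁ quadratic
    module Basis = IsBasis (proj₂ quadratic)
    b₀ = basis zero
    b₁ = basis (suc zero)

  combine : ℚ → ℚ → Carrier
  combine p q = ι p * b₀ + ι q * b₁

  private
    pair : ℚ → ℚ → Vector ℚ 2
    pair p q zero       = p
    pair p q (suc zero) = q

  combine-null : ∀ p q → combine p q ≈ 0# → p ≡ 0ℚ × q ≡ 0ℚ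
  combine-null p q eq = null zero , null (suc zero)
    where null = Basis.independent (pair p q) (trans (+-congˡ (+-identityʳ _)) eq)

  x₀ x₁ : Carrier → ℚ
  x₀ α = proj₁ (Basis.spanning α) zero
  x₁ α = proj₁ (Basis.spanning α) (suc zero)

  coordinates : ∀ α → α ≈ combine (x₀ α) (x₁ α)
  coordinates α = trans (proj₂ (Basis.spanning α)) (+-congˡ (+-identityʳ _))

  ι-- : ∀ p q → ι (p ℚ.- q) ≈ ι p - ι q
  ι-- p q = trans (ι-+ p (ℚ.- q)) (+-congˡ (ι-neg q))

  combine-injective : ∀ {p q r s} → combine p q ≈ combine r s → p ≡ r × q ≡ s
  combine-injective {p} {q} {r} {s} eq = difference p r (proj₁ null) , difference q s (proj₂ null)
    where
    difference : ∀ p r → p ℚ.- r ≡ 0ℚ → p ≡ r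
    difference p r eq = ≡.trans (ℚ-Matrix.+-cancel-- p r) (≡.trans (≡.cong (ℚ._+ r) eq) (ℚ.+-identityˡ r))
    null = combine-null (p ℚ.- r) (q ℚ.- s) (begin
      ι (p ℚ.- r) * b₀ + ι (q ℚ.- s) * b₁
        ≈⟨ +-cong (*-congʳ (ι-- p r)) (*-congʳ (ι-- q s)) ⟩
      (ι p - ι r) * b₀ + (ι q - ι s) * b₁
        ≈⟨ solve 6 (λ p r q s b c → (p :- r) :* b :+ (q :- s) :* c := (p :* b :+ q :* c) :- (r :* b :+ s :* c))
             refl _ _ _ _ _ _ ⟩
      combine p q - combine r s
        ≈⟨ trans (+-congʳ eq) (-‿inverseʳ _) ⟩
      0# ∎)

  coordinates-unique : ∀ {α p q} → α ≈ combine p q → x₀ α ≡ p × x₁ α ≡ q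
  coordinates-unique {α} eq = combine-injective (trans (sym (coordinates α)) eq)

  coordinates-cong : ∀ {α β} → α ≈ β → x₀ α ≡ x₀ β × x₁ α ≡ x₁ β
  coordinates-cong {α} {β} α≈β = coordinates-unique (trans α≈β (coordinates β))

  coordinates-linear : ∀ p q α β →
    x₀ (ι p * α + ι q * β) ≡ p ℚ.* x₀ α ℚ.+ q ℚ.* x₀ β ×
    x₁ (ι p * α + ι q * β) ≡ p ℚ.* x₁ α ℚ.+ q ℚ.* x₁ β
  coordinates-linear p q α β = coordinates-unique (begin
    ι p * α + ι q * β
      ≈⟨ +-cong (*-congˡ (coordinates α)) (*-congˡ (coordinates β)) ⟩
    ι p * combine (x₀ α) (x₁ α) + ι q * combine (x₀ β) (x₁ β)
      ≈⟨ solve 8 (λ p q a b c d u v →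
           p :* (a :* u :+ b :* v) :+ q :* (c :* u :+ d :* v) := (p :* a :+ q :* c) :* u :+ (p :* b :+ q :* d) :* v)
           refl _ _ _ _ _ _ _ _ ⟩
    (ι p * ι (x₀ α) + ι q * ι (x₀ β)) * b₀ + (ι p * ι (x₁ α) + ι q * ι (x₁ β)) * b₁
      ≈⟨ +-cong (*-congʳ (lin (x₀ α) (x₀ β))) (*-congʳ (lin (x₁ α) (x₁ β))) ⟨
    combine (p ℚ.* x₀ α ℚ.+ q ℚ.* x₀ β) (p ℚ.* x₁ α ℚ.+ q ℚ.* x₁ β) ∎)
    where
    lin : ∀ r s → ι (p ℚ.* r ℚ.+ q ℚ.* s) ≈ ι p * ι r + ι q * ι s
    lin r s = trans (ι-+ (p ℚ.* r) (q ℚ.* s)) (+-cong (ι-* p r) (ι-* q s))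

  ι-injective : ∀ {p q} → ι p ≈ ι q → p ≡ q
  ι-injective {p} {q} eq = proj₁ (combine-injective {p} {0ℚ} {q} {0ℚ} (+-congʳ (*-congʳ eq)))

  fromℤ-injective : ∀ {i j} → fromℤ i ≈ fromℤ j → i ≡ j
  fromℤ-injective {i} {j} eq = int-injective (ι-injective (trans (ι-int i) (trans eq (sym (ι-int j)))))

  infix 4 _≟_
  -- Coordinates are unique and rational, so a field given with a mere apartness acquires decidable
  -- equality from its basis.
  _≟_ : Rel₂.Decidable _≈_
  α ≟ β = map′
    (λ { (eq₀ , eq₁) → trans (coordinates α) (trans
       (+-cong (*-congʳ (≡⇒ι eq₀)) (*-congʳ (≡⇒ι eq₁))) (sym (coordinates β))) })
    coordinates-cong
    (x₀ α ℚ.≟ x₀ β ×-dec x₁ α ℚ.≟ x₁ β)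

  integral-domain : ∀ {α β} → α * β ≈ 0# → α ≈ 0# ⊎ β ≈ 0#
  integral-domain {α} {β} αβ≈0 = decide (α ≟ 0#)
    where
    decide : Dec (α ≈ 0#) → α ≈ 0# ⊎ β ≈ 0#
    decide (yes α≈0) = inj₁ α≈0
    decide (no α≉0)  = inj₂ (*-nonzero αβ≈0 α≉0)

  reduced : ∀ α → α * α ≈ 0# → α ≈ 0#
  reduced α α²≈0 = Sum.[ (λ α≈0 → α≈0) , (λ α≈0 → α≈0) ] (integral-domain α²≈0)

  -- The matrix of multiplication by α.
  m₀₀ m₀₁ m₁₀ m₁₁ trace norm : Carrier → ℚ
  m₀₀ α = x₀ (α * b₀)
  m₀₁ α = x₀ (α * b₁)
  m₁₀ α = x₁ (α * b₀)
  m₁₁ α = x₁ (α * b₁)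
  trace α = m₀₀ α ℚ.+ m₁₁ α
  norm α  = m₀₀ α ℚ.* m₁₁ α ℚ.- m₀₁ α ℚ.* m₁₀ α

  coordinates-* : ∀ α β →
    x₀ (α * β) ≡ x₀ β ℚ.* m₀₀ α ℚ.+ x₁ β ℚ.* m₀₁ α ×
    x₁ (α * β) ≡ x₀ β ℚ.* m₁₀ α ℚ.+ x₁ β ℚ.* m₁₁ α
  coordinates-* α β = ≡.trans (proj₁ eq) (proj₁ lin) , ≡.trans (proj₂ eq) (proj₂ lin)
    where
    lin = coordinates-linear (x₀ β) (x₁ β) (α * b₀) (α * b₁)
    eq  = coordinates-cong (begin
      α * β                                       ≈⟨ *-congˡ (coordinates β) ⟩
      α * combine (x₀ β) (x₁ β)                   ≈⟨ solve 5 (λ a p u q v → a :* (p :* u :+ q :* v) := p :* (a :* u) :+ q :* (a :* v)) refl _ _ _ _ _ ⟩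
      ι (x₀ β) * (α * b₀) + ι (x₁ β) * (α * b₁)   ∎)

  -- The matrix of multiplication by αβ is the product of the two matrices, and determinants
  -- multiply.
  norm-* : ∀ α β → norm (α * β) ≡ norm α ℚ.* norm β
  norm-* α β = ≡.trans
    (≡.cong₂ ℚ._-_
      (≡.cong₂ ℚ._*_ (proj₁ (entries b₀)) (proj₂ (entries b₁)))
      (≡.cong₂ ℚ._*_ (proj₁ (entries b₁)) (proj₂ (entries b₀))))
    (ℚ-Matrix.det-product (m₀₀ α) (m₀₁ α) (m₁₀ α) (m₁₁ α) (m₀₀ β) (m₀₁ β) (m₁₀ β) (m₁₁ β))
    where
    entries : ∀ b → x₀ (α * β * b) ≡ x₀ (β * b) ℚ.* m₀₀ α ℚ.+ x₁ (β * b) ℚ.* m₀₁ α ×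
                    x₁ (α * β * b) ≡ x₀ (β * b) ℚ.* m₁₀ α ℚ.+ x₁ (β * b) ℚ.* m₁₁ α
    entries b = ≡.trans (proj₁ eq) (proj₁ (coordinates-* α (β * b))) , ≡.trans (proj₂ eq) (proj₂ (coordinates-* α (β * b)))
      where eq = coordinates-cong (*-assoc α β b)

  coordinates-b₀ : x₀ b₀ ≡ 1ℚ × x₁ b₀ ≡ 0ℚ
  coordinates-b₀ = coordinates-unique (sym (begin
    ι 1ℚ * b₀ + ι 0ℚ * b₁   ≈⟨ +-cong (*-congʳ ι-1) (*-congʳ ι-0) ⟩
    1# * b₀ + 0# * b₁       ≈⟨ solve 2 (λ b c → con (+ 1) :* b :+ con (+ 0) :* c := b) refl _ _ ⟩
    b₀                      ∎))

  coordinates-b₁ : x₀ b₁ ≡ 0ℚ × x₁ b₁ ≡ 1ℚ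
  coordinates-b₁ = coordinates-unique (sym (begin
    ι 0ℚ * b₀ + ι 1ℚ * b₁   ≈⟨ +-cong (*-congʳ ι-0) (*-congʳ ι-1) ⟩
    0# * b₀ + 1# * b₁       ≈⟨ solve 2 (λ b c → con (+ 0) :* b :+ con (+ 1) :* c := c) refl _ _ ⟩
    b₁                      ∎))

  coordinates-+ : ∀ α β → x₀ (α + β) ≡ x₀ α ℚ.+ x₀ β × x₁ (α + β) ≡ x₁ α ℚ.+ x₁ β
  coordinates-+ α β = coordinates-unique (begin
    α + β
      ≈⟨ +-cong (coordinates α) (coordinates β) ⟩
    combine (x₀ α) (x₁ α) + combine (x₀ β) (x₁ β)
      ≈⟨ solve 6 (λ a b c d u v → (a :* u :+ b :* v) :+ (c :* u :+ d :* v) := (a :+ c) :* u :+ (b :+ d) :* v) refl _ _ _ _ _ _ ⟩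
    (ι (x₀ α) + ι (x₀ β)) * b₀ + (ι (x₁ α) + ι (x₁ β)) * b₁
      ≈⟨ +-cong (*-congʳ (ι-+ _ _)) (*-congʳ (ι-+ _ _)) ⟨
    combine (x₀ α ℚ.+ x₀ β) (x₁ α ℚ.+ x₁ β) ∎)

  norm-1 : norm 1# ≡ 1ℚ
  norm-1 = ≡.cong₂ ℚ._-_
    (≡.cong₂ ℚ._*_ (≡.trans (proj₁ e₀) (proj₁ coordinates-b₀)) (≡.trans (proj₂ e₁) (proj₂ coordinates-b₁)))
    (≡.cong₂ ℚ._*_ (≡.trans (proj₁ e₁) (proj₁ coordinates-b₁)) (≡.trans (proj₂ e₀) (proj₂ coordinates-b₀)))
    where
    e₀ = coordinates-cong (*-identityˡ b₀)
    e₁ = coordinates-cong (*-identityˡ b₁)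

  norm-^ : ∀ α k → norm (α ^ k) ≡ norm α ^ℚ k
  norm-^ α zero    = norm-1
  norm-^ α (suc k) = ≡.trans (norm-* α (α ^ k)) (≡.cong (norm α ℚ.*_) (norm-^ α k))

  -- Recovers the trace from two norms. Norms are multiplicative, so their denominators can be
  -- controlled through powers, which would not work for the trace directly.
  norm-1+ : ∀ α → norm (1# + α) ≡ 1ℚ ℚ.+ trace α ℚ.+ norm α
  norm-1+ α = ≡.trans
    (≡.cong₂ ℚ._-_
      (≡.cong₂ ℚ._*_ (entry₀ b₀ (proj₁ coordinates-b₀)) (entry₁ b₁ (proj₂ coordinates-b₁)))
      (≡.cong₂ ℚ._*_ (entry₀ b₁ (proj₁ coordinates-b₁)) (entry₁ b₀ (proj₂ coordinates-b₀))))
    (ℚ-Matrix.det-1+ (m₀₀ α) (m₀₁ α) (m₁₀ α) (m₁₁ α))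
    where
    distribute : ∀ b → (1# + α) * b ≈ b + α * b
    distribute b = solve 2 (λ a b → (con (+ 1) :+ a) :* b := b :+ a :* b) refl α b
    entry₀ : ∀ b {r} → x₀ b ≡ r → x₀ ((1# + α) * b) ≡ r ℚ.+ x₀ (α * b)
    entry₀ b ≡.refl = ≡.trans (proj₁ (coordinates-cong (distribute b))) (proj₁ (coordinates-+ b (α * b)))
    entry₁ : ∀ b {r} → x₁ b ≡ r → x₁ ((1# + α) * b) ≡ r ℚ.+ x₁ (α * b)
    entry₁ b ≡.refl = ≡.trans (proj₂ (coordinates-cong (distribute b))) (proj₂ (coordinates-+ b (α * b)))

  -- The value p of the characteristic polynomial at α annihilates both basis elements, hence also
  -- 1, which is a combination of them.
  cayley-hamilton : ∀ α → α * α ≈ ι (trace α) * α - ι (norm α)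
  cayley-hamilton α = begin
    α * α
      ≈⟨ solve 3 (λ a t n → a :* a := (t :* a :- n) :+ (a :* a :- t :* a :+ n) :* con (+ 1)) refl α t n ⟩
    (t * α - n) + p * 1#
      ≈⟨ +-congˡ (*-congˡ (coordinates 1#)) ⟩
    (t * α - n) + p * combine (x₀ 1#) (x₁ 1#)
      ≈⟨ +-congˡ (solve 5 (λ p a u b v → p :* (a :* u :+ b :* v) := a :* (p :* u) :+ b :* (p :* v)) refl _ _ _ _ _) ⟩
    (t * α - n) + (ι (x₀ 1#) * (p * b₀) + ι (x₁ 1#) * (p * b₁))
      ≈⟨ +-congˡ (+-cong (*-congˡ pb₀≈0) (*-congˡ pb₁≈0)) ⟩
    (t * α - n) + (ι (x₀ 1#) * 0# + ι (x₁ 1#) * 0#)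
      ≈⟨ solve 3 (λ a b c → a :+ (b :* con (+ 0) :+ c :* con (+ 0)) := a) refl _ _ _ ⟩
    t * α - n ∎
    where
    t = ι (trace α)
    n = ι (norm α)
    p = α * α - t * α + n
    a = ι (m₀₀ α)
    b = ι (m₀₁ α)
    c = ι (m₁₀ α)
    d = ι (m₁₁ α)
    t≈ : t ≈ a + d
    t≈ = ι-+ _ _
    n≈ : n ≈ a * d - b * c
    n≈ = trans (ι-- (m₀₀ α ℚ.* m₁₁ α) (m₀₁ α ℚ.* m₁₀ α)) (+-cong (ι-* _ _) (-‿cong (ι-* _ _)))
    pb₀≈0 : p * b₀ ≈ 0#
    pb₀≈0 = begin
      (α * α - t * α + n) * b₀
        ≈⟨ solve 4 (λ α t n b → (α :* α :- t :* α :+ n) :* b := α :* (α :* b) :- t :* (α :* b) :+ n :* b) refl α t n b₀ ⟩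
      α * (α * b₀) - t * (α * b₀) + n * b₀
        ≈⟨ +-cong (+-cong (*-congˡ (coordinates (α * b₀))) (-‿cong (*-cong t≈ (coordinates (α * b₀))))) (*-congʳ n≈) ⟩
      α * (a * b₀ + c * b₁) - (a + d) * (a * b₀ + c * b₁) + (a * d - b * c) * b₀
        ≈⟨ solve 7 (λ α a b c d u v →
             α :* (a :* u :+ c :* v) :- (a :+ d) :* (a :* u :+ c :* v) :+ (a :* d :- b :* c) :* u :=
             a :* (α :* u) :+ c :* (α :* v) :- (a :+ d) :* (a :* u :+ c :* v) :+ (a :* d :- b :* c) :* u)
             refl α a b c d b₀ b₁ ⟩
      a * (α * b₀) + c * (α * b₁) - (a + d) * (a * b₀ + c * b₁) + (a * d - b * c) * b₀
        ≈⟨ +-congʳ (+-congʳ (+-cong (*-congˡ (coordinates (α * b₀))) (*-congˡ (coordinates (α * b₁))))) ⟩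
      a * (a * b₀ + c * b₁) + c * (b * b₀ + d * b₁) - (a + d) * (a * b₀ + c * b₁) + (a * d - b * c) * b₀
        ≈⟨ solve 6 (λ a b c d u v →
             a :* (a :* u :+ c :* v) :+ c :* (b :* u :+ d :* v) :- (a :+ d) :* (a :* u :+ c :* v) :+ (a :* d :- b :* c) :* u :=
             con (+ 0)) refl a b c d b₀ b₁ ⟩
      0# ∎
    pb₁≈0 : p * b₁ ≈ 0#
    pb₁≈0 = begin
      (α * α - t * α + n) * b₁
        ≈⟨ solve 4 (λ α t n b → (α :* α :- t :* α :+ n) :* b := α :* (α :* b) :- t :* (α :* b) :+ n :* b) refl α t n b₁ ⟩
      α * (α * b₁) - t * (α * b₁) + n * b₁
        ≈⟨ +-cong (+-cong (*-congˡ (coordinates (α * b₁))) (-‿cong (*-cong t≈ (coordinates (α * b₁))))) (*-congʳ n≈) ⟩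
      α * (b * b₀ + d * b₁) - (a + d) * (b * b₀ + d * b₁) + (a * d - b * c) * b₁
        ≈⟨ solve 7 (λ α a b c d u v →
             α :* (b :* u :+ d :* v) :- (a :+ d) :* (b :* u :+ d :* v) :+ (a :* d :- b :* c) :* v :=
             b :* (α :* u) :+ d :* (α :* v) :- (a :+ d) :* (b :* u :+ d :* v) :+ (a :* d :- b :* c) :* v)
             refl α a b c d b₀ b₁ ⟩
      b * (α * b₀) + d * (α * b₁) - (a + d) * (b * b₀ + d * b₁) + (a * d - b * c) * b₁
        ≈⟨ +-congʳ (+-congʳ (+-cong (*-congˡ (coordinates (α * b₀))) (*-congˡ (coordinates (α * b₁))))) ⟩
      b * (a * b₀ + c * b₁) + d * (b * b₀ + d * b₁) - (a + d) * (b * b₀ + d * b₁) + (a * d - b * c) * b₁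
        ≈⟨ solve 6 (λ a b c d u v →
             b :* (a :* u :+ c :* v) :+ d :* (b :* u :+ d :* v) :- (a :+ d) :* (b :* u :+ d :* v) :+ (a :* d :- b :* c) :* v :=
             con (+ 0)) refl a b c d b₀ b₁ ⟩
      0# ∎

-- Integrality of the solutions of D n e = 2.

module Integrality (K : Extension) (quadratic : HasDegree K 2) where
  open Extension K using (ι)
  open CommutativeRing (commutativeRing K) hiding (zero)
  open IntegerCoefficients (commutativeRing K) using (fromℤ)
  open IntegerCoefficients.Solver (commutativeRing K)
  open QuadraticExtension K quadratic
  open Dickson (commutativeRing K)
  open Exp semiring using (_^_)
  open SetoidReasoning setoid
  private
    module ℚ-Matrix = MatrixIdentities ℚ.+-*-commutativeRing
    b₀ = proj₁ quadratic zero
    b₁ = proj₁ quadratic (suc zero)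

  -- For N different from 0, the elements of (1/N) (ℤ b₀ + ℤ b₁).
  record Lattice (N : ℤ) (β : Carrier) : Set where
    constructor lattice
    field
      integer₀ : IsInteger (int N ℚ.* x₀ β)
      integer₁ : IsInteger (int N ℚ.* x₁ β)

  lattice-cong : ∀ {N α β} → α ≈ β → Lattice N α → Lattice N β
  lattice-cong {N} α≈β (lattice l₀ l₁) = lattice
    (≡.subst (λ x → IsInteger (int N ℚ.* x)) (proj₁ (coordinates-cong α≈β)) l₀)
    (≡.subst (λ x → IsInteger (int N ℚ.* x)) (proj₂ (coordinates-cong α≈β)) l₁)

  lattice-+ : ∀ {N α β} → Lattice N α → Lattice N β → Lattice N (α + β)
  lattice-+ {N} {α} {β} (lattice l₀ l₁) (lattice m₀ m₁) = lattice
    (≡.subst IsInteger (sum (x₀ α) (x₀ β) (proj₁ (coordinates-+ α β))) (integer-+ l₀ m₀))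
    (≡.subst IsInteger (sum (x₁ α) (x₁ β) (proj₂ (coordinates-+ α β))) (integer-+ l₁ m₁))
    where
    sum : ∀ p q {r} → r ≡ p ℚ.+ q → int N ℚ.* p ℚ.+ int N ℚ.* q ≡ int N ℚ.* r
    sum p q ≡.refl = ≡.sym (ℚ.*-distribˡ-+ (int N) p q)

  lattice-scale : ∀ {N} M {β} → Lattice N β → Lattice (M ℤ.* N) β
  lattice-scale {N} M {β} (lattice l₀ l₁) = lattice
    (≡.subst IsInteger (scale (x₀ β)) (integer-* (M , ≡.refl) l₀))
    (≡.subst IsInteger (scale (x₁ β)) (integer-* (M , ≡.refl) l₁))
    where
    scale : ∀ q → int M ℚ.* (int N ℚ.* q) ≡ int (M ℤ.* N) ℚ.* q
    scale q = ≡.trans (≡.sym (ℚ.*-assoc (int M) (int N) q)) (≡.cong (ℚ._* q) (≡.sym (int-* M N)))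

  lattice-scale′ : ∀ {N} M {β} → Lattice N β → Lattice (N ℤ.* M) β
  lattice-scale′ {N} M {β} l = ≡.subst (λ i → Lattice i β) (ℤ.*-comm M N) (lattice-scale M l)

  private
    nonzero-* : ∀ {i j} → i ≢ + 0 → j ≢ + 0 → i ℤ.* j ≢ + 0
    nonzero-* {i} i≢0 j≢0 eq = Sum.[ i≢0 , j≢0 ] (ℤ.i*j≡0⇒i≡0∨j≡0 i eq)

  denominator : ∀ β → ∃ λ N → N ≢ + 0 × Lattice N β
  denominator β = ℚ.↧ x₀ β ℤ.* ℚ.↧ x₁ β , nonzero-* {ℚ.↧ x₀ β} {ℚ.↧ x₁ β} (λ ()) (λ ()) , lattice
    (≡.subst IsInteger (≡.trans (ℚ.*-comm (x₀ β) (int (ℚ.↧ x₁ β ℤ.* ℚ.↧ x₀ β))) (≡.cong (λ i → int i ℚ.* x₀ β) (ℤ.*-comm (ℚ.↧ x₁ β) (ℚ.↧ x₀ β))))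
      (clear (x₀ β) (ℚ.↧ x₁ β)))
    (≡.subst IsInteger (ℚ.*-comm (x₁ β) (int (ℚ.↧ x₀ β ℤ.* ℚ.↧ x₁ β))) (clear (x₁ β) (ℚ.↧ x₀ β)))
    where
    clear : ∀ q M → IsInteger (q ℚ.* int (M ℤ.* ℚ.↧ q))
    clear q M = ≡.subst IsInteger
      (≡.trans (ℚ.*-assoc q (int (ℚ.↧ q)) (int M)) (≡.cong (q ℚ.*_)
        (≡.trans (≡.sym (int-* (ℚ.↧ q) M)) (≡.cong int (ℤ.*-comm (ℚ.↧ q) M)))))
      (integer-* {q ℚ.* int (ℚ.↧ q)} (ℚ.↥ q , q*↧≡↥ q) (M , ≡.refl))

  common-denominator : ∀ (f : ℕ → Carrier) m → ∃ λ N → N ≢ + 0 × (∀ k → k ℕ.< m → Lattice N (f k))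
  common-denominator f zero    = + 1 , (λ ()) , λ k ()
  common-denominator f (suc m) =
    let N , N≢0 , l  = common-denominator f m
        M , M≢0 , l′ = denominator (f m)
    in N ℤ.* M , nonzero-* N≢0 M≢0 , λ k k<1+m → Sum.[
         (λ k<m → lattice-scale′ M (l k k<m)) ,
         (λ k≡m → ≡.subst (λ j → Lattice (N ℤ.* M) (f j)) (≡.sym k≡m) (lattice-scale N l′)) ]
       (ℕ.m≤n⇒m<n∨m≡n (ℕ.≤-pred k<1+m))

  module _ {e n} (De≈2 : D (suc n) e ≈ fromℤ (+ 2)) where

    D-mod : ∀ k → D k e ≈ D (k ℕ.% suc n) e
    D-mod k = trans (D-index {k} {k ℕ.% suc n ℕ.+ k ℕ./ suc n ℕ.* suc n} e (ℕ.m≡m%n+[m/n]*n k (suc n))) (multiples (k ℕ./ suc n))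
      where
      multiples : ∀ q → D (k ℕ.% suc n ℕ.+ q ℕ.* suc n) e ≈ D (k ℕ.% suc n) e
      multiples zero    = reflexive (≡.cong (λ m → D m e) (ℕ.+-identityʳ (k ℕ.% suc n)))
      multiples (suc q) = begin
        D (r ℕ.+ (suc n ℕ.+ q ℕ.* suc n)) e    ≡⟨ ≡.cong (λ m → D m e) index ⟩
        D (r ℕ.+ q ℕ.* suc n ℕ.+ suc n) e      ≈⟨ D-period reduced De≈2 (r ℕ.+ q ℕ.* suc n) ⟩
        D (r ℕ.+ q ℕ.* suc n) e                ≈⟨ multiples q ⟩
        D r e                                  ∎
        where
        r = k ℕ.% suc n
        index : r ℕ.+ (suc n ℕ.+ q ℕ.* suc n) ≡ r ℕ.+ q ℕ.* suc n ℕ.+ suc n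
        index = ≡.trans (≡.cong (r ℕ.+_) (ℕ.+-comm (suc n) _)) (≡.sym (ℕ.+-assoc r _ _))

    -- Stable under multiplication by e, as D (k + 1) e * e = D (k + 2) e + D k e.
    Stable : ℤ → Carrier → Set
    Stable N α = ∀ k → Lattice N (D k e * α * b₀) × Lattice N (D k e * α * b₁)

    stable-+ : ∀ {N α β} → Stable N α → Stable N β → Stable N (α + β)
    stable-+ {α = α} {β} s t k = sum b₀ (proj₁ (s k)) (proj₁ (t k)) , sum b₁ (proj₂ (s k)) (proj₂ (t k))
      where
      sum : ∀ {N} b → Lattice N (D k e * α * b) → Lattice N (D k e * β * b) → Lattice N (D k e * (α + β) * b)
      sum b l m = lattice-cong
        (solve 4 (λ d α β b → d :* α :* b :+ d :* β :* b := d :* (α :+ β) :* b) refl _ _ _ _) (lattice-+ l m)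

    stable-cong : ∀ {N α β} → α ≈ β → Stable N α → Stable N β
    stable-cong α≈β s k = lattice-cong (*-congʳ (*-congˡ α≈β)) (proj₁ (s k))
                        , lattice-cong (*-congʳ (*-congˡ α≈β)) (proj₂ (s k))

    stable-* : ∀ {N α} → Stable N α → Stable N (e * α)
    -- As D 0 e is 2, the element wanted is the sum of two copies of D 1 e * α * b.
    stable-* {N} {α} s zero = double b₀ (proj₁ (s 1)) , double b₁ (proj₂ (s 1))
      where
      double : ∀ b → Lattice N (e * α * b) → Lattice N (fromℤ (+ 2) * (e * α) * b)
      double b l = lattice-cong
        (solve 3 (λ e α b → e :* α :* b :+ e :* α :* b := con (+ 2) :* (e :* α) :* b) refl _ _ _) (lattice-+ l l)
    stable-* {N} {α} s (suc k) =
      next b₀ (proj₁ (s (suc (suc k)))) (proj₁ (s k)) , next b₁ (proj₂ (s (suc (suc k)))) (proj₂ (s k))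
      where
      next : ∀ b → Lattice N (D (suc (suc k)) e * α * b) → Lattice N (D k e * α * b) →
        Lattice N (D (suc k) e * (e * α) * b)
      next b l m = lattice-cong
        (solve 5 (λ e d₁ d₀ α b → (e :* d₁ :- d₀) :* α :* b :+ d₀ :* α :* b := d₁ :* (e :* α) :* b) refl _ _ _ _ _)
        (lattice-+ l m)

    -- By periodicity only finitely many values D k e occur, and their products with the two basis
    -- elements have a common denominator.
    stable-1 : ∃ λ N → N ≢ + 0 × Stable N 1#
    stable-1 =
      let N , N≢0 , l = common-denominator (λ k → D k e * 1# * b₀) (suc n)
          M , M≢0 , m = common-denominator (λ k → D k e * 1# * b₁) (suc n)
      in N ℤ.* M , nonzero-* N≢0 M≢0 , λ k →
           lattice-cong (*-congʳ (*-congʳ (sym (D-mod k)))) (lattice-scale′ M (l (k ℕ.% suc n) (ℕ.m%n<n k (suc n)))) ,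
           lattice-cong (*-congʳ (*-congʳ (sym (D-mod k)))) (lattice-scale N (m (k ℕ.% suc n) (ℕ.m%n<n k (suc n))))

    -- At k = 0 stability speaks of 2α, so 2N clears the denominators of the matrix of α. The
    -- determinant is quadratic in the entries, which squares this factor.
    stable-norm : ∀ {N α} → Stable N α →
      IsInteger (int ((N ℤ.* + 2) ℤ.* (N ℤ.* + 2)) ℚ.* norm α)
    stable-norm {N} {α} s = ≡.subst IsInteger
      (≡.trans (≡.sym (ℚ-Matrix.det-scale (int M) (m₀₀ α) (m₀₁ α) (m₁₀ α) (m₁₁ α)))
               (≡.cong (ℚ._* norm α) (≡.sym (int-* M M))))
      (integer-+ (integer-* (entry₀ b₀ (proj₁ (s 0))) (entry₁ b₁ (proj₂ (s 0))))
                 (integer-neg (integer-* (entry₀ b₁ (proj₂ (s 0))) (entry₁ b₀ (proj₁ (s 0))))))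
      where
      M = N ℤ.* + 2
      scale : ∀ q {p} → p ≡ int (+ 2) ℚ.* q → int N ℚ.* p ≡ int M ℚ.* q
      scale q ≡.refl = ≡.trans (≡.sym (ℚ.*-assoc (int N) (int (+ 2)) q)) (≡.cong (ℚ._* q) (≡.sym (int-* N (+ 2))))
      double : ∀ β → x₀ (fromℤ (+ 2) * α * β) ≡ int (+ 2) ℚ.* x₀ (α * β) ×
                     x₁ (fromℤ (+ 2) * α * β) ≡ int (+ 2) ℚ.* x₁ (α * β)
      double β = ≡.trans (proj₁ eq) (ℚ-double (x₀ (α * β))) , ≡.trans (proj₂ eq) (ℚ-double (x₁ (α * β)))
        where
        ℚ-double : ∀ q → q ℚ.+ q ≡ int (+ 2) ℚ.* q
        ℚ-double q = ≡.sym (≡.trans (≡.cong (ℚ._* q) (int-+ (+ 1) (+ 1)))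
          (≡.trans (ℚ.*-distribʳ-+ q 1ℚ 1ℚ) (≡.cong₂ ℚ._+_ (ℚ.*-identityˡ q) (ℚ.*-identityˡ q))))
        eq : x₀ (fromℤ (+ 2) * α * β) ≡ x₀ (α * β) ℚ.+ x₀ (α * β) ×
             x₁ (fromℤ (+ 2) * α * β) ≡ x₁ (α * β) ℚ.+ x₁ (α * β)
        eq = ≡.trans (proj₁ c) (proj₁ d) , ≡.trans (proj₂ c) (proj₂ d)
          where
          c = coordinates-cong (solve 2 (λ α β → con (+ 2) :* α :* β := α :* β :+ α :* β) refl α β)
          d = coordinates-+ (α * β) (α * β)
      entry₀ : ∀ β → Lattice N (fromℤ (+ 2) * α * β) → IsInteger (int M ℚ.* x₀ (α * β))
      entry₀ β (lattice l _) = ≡.subst IsInteger (scale (x₀ (α * β)) (proj₁ (double β))) l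
      entry₁ : ∀ β → Lattice N (fromℤ (+ 2) * α * β) → IsInteger (int M ℚ.* x₁ (α * β))
      entry₁ β (lattice _ l) = ≡.subst IsInteger (scale (x₁ (α * β)) (proj₂ (double β))) l

    -- One N serves for all powers of α, so that (2N)² clears the denominators of all powers of the
    -- rational number `norm α`.
    norm-integer : ∀ α → (∀ {N} k → Stable N 1# → Stable N (α ^ k)) → IsInteger (norm α)
    norm-integer α powers = let N , N≢0 , s = stable-1; M≢0 = nonzero-* {N} {+ 2} N≢0 (λ ()) in
      bounded-denominators⇒integer (norm α) ((N ℤ.* + 2) ℤ.* (N ℤ.* + 2)) (nonzero-* M≢0 M≢0) λ k →
        ≡.subst (λ q → IsInteger (int ((N ℤ.* + 2) ℤ.* (N ℤ.* + 2)) ℚ.* q)) (norm-^ α k) (stable-norm (powers k s))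

    integral-equation : ∃₂ λ a b → e * e ≈ fromℤ a * e - fromℤ b
    -- The trace of e is N(1 + e) - 1 - N(e), with c and b the two integral norms.
    integral-equation = c ℤ.- + 1 ℤ.- b , b , (begin
      e * e
        ≈⟨ cayley-hamilton e ⟩
      ι (trace e) * e - ι (norm e)
        ≈⟨ +-cong (*-congʳ (trans (≡⇒ι trace≡) (ι-int (c ℤ.- + 1 ℤ.- b)))) (-‿cong (trans (≡⇒ι (proj₂ norm-e)) (ι-int b))) ⟩
      fromℤ (c ℤ.- + 1 ℤ.- b) * e - fromℤ b ∎)
      where
      powers : ∀ {N} k → Stable N 1# → Stable N (e ^ k)
      powers zero    s = s
      powers (suc k) s = stable-* (powers k s)
      powers′ : ∀ {N} k → Stable N 1# → Stable N ((1# + e) ^ k)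
      powers′ zero    s = s
      powers′ (suc k) s = stable-cong
        (solve 2 (λ e α → α :+ e :* α := (con (+ 1) :+ e) :* α) refl _ _)
        (stable-+ (powers′ k s) (stable-* (powers′ k s)))
      norm-e : IsInteger (norm e)
      norm-e = norm-integer e powers
      norm-1+e : IsInteger (norm (1# + e))
      norm-1+e = norm-integer (1# + e) powers′
      b = proj₁ norm-e
      c = proj₁ norm-1+e
      trace≡ : trace e ≡ int (c ℤ.- + 1 ℤ.- b)
      trace≡ = ≡.trans (ℚ-Matrix.trace-from-norms (trace e) (norm e))
        (≡.trans (≡.cong₂ (λ p q → p ℚ.- 1ℚ ℚ.- q) (≡.trans (≡.sym (norm-1+ e)) (proj₂ norm-1+e)) (proj₂ norm-e))
        (≡.sym (≡.trans (int-+ (c ℤ.- + 1) (ℤ.- b)) (≡.cong₂ ℚ._+_ (int-+ c (ℤ.- + 1)) (int-neg b)))))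

-- Torsion modulo 8: D m e = 2 with m = 8, 10 or 12.

even⊎odd : ∀ n → ∃ λ h → n ≡ h ℕ.* 2 ⊎ n ≡ suc (h ℕ.* 2)
even⊎odd zero    = 0 , inj₁ ≡.refl
even⊎odd (suc n) with even⊎odd n
... | h , inj₁ eq = h , inj₂ (≡.cong suc eq)
... | h , inj₂ eq = suc h , inj₁ (≡.cong suc eq)

1≢2* : ∀ i → + 1 ≢ + 2 ℤ.* i
1≢2* i eq with ℕ.m*n≡1⇒m≡1 2 ℤ.∣ i ∣ (≡.sym (≡.trans (≡.cong ℤ.∣_∣ eq) (ℤ.abs-* (+ 2) i)))
... | ()

infix 4 _≡₈_
-- The equation is solved for i, so that matching on it replaces i by j + 8k and leaves a polynomial
-- identity to the solver.
record _≡₈_ (i j : ℤ) : Set where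
  constructor mod₈
  field
    quotient : ℤ
    equation : i ≡ j ℤ.+ + 8 ℤ.* quotient

module Dickson₈ where
  open ℤSolver.+-*-Solver

  ≡₈-refl : ∀ i → i ≡₈ i
  ≡₈-refl i = mod₈ (+ 0) (solve 1 (λ i → i := i :+ con (+ 8) :* con (+ 0)) ≡.refl i)

  -- If D k e = u₀ + v₀ e and D (k + 1) e = u₁ + v₁ e with e² = a e - b,
  -- the coefficients of D (k + n) e.
  dickson : ℤ → ℤ → ℕ → ℤ → ℤ → ℤ → ℤ → ℤ × ℤ
  dickson a b zero    u₀ v₀ u₁ v₁ = u₀ , v₀
  dickson a b (suc n) u₀ v₀ u₁ v₁ =
    dickson a b n u₁ v₁ (ℤ.- (b ℤ.* v₁) ℤ.- u₀) (u₁ ℤ.+ a ℤ.* v₁ ℤ.- v₀)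

  dickson-cong : ∀ {a a′ b b′} → a ≡₈ a′ → b ≡₈ b′ → ∀ n {u₀ u₀′ v₀ v₀′ u₁ u₁′ v₁ v₁′} →
    u₀ ≡₈ u₀′ → v₀ ≡₈ v₀′ → u₁ ≡₈ u₁′ → v₁ ≡₈ v₁′ →
    proj₁ (dickson a b n u₀ v₀ u₁ v₁) ≡₈ proj₁ (dickson a′ b′ n u₀′ v₀′ u₁′ v₁′) ×
    proj₂ (dickson a b n u₀ v₀ u₁ v₁) ≡₈ proj₂ (dickson a′ b′ n u₀′ v₀′ u₁′ v₁′)
  dickson-cong a≡ b≡ zero u₀≡ v₀≡ u₁≡ v₁≡ = u₀≡ , v₀≡
  dickson-cong {a′ = a} {b′ = b} a≡@(mod₈ k ≡.refl) b≡@(mod₈ l ≡.refl) (suc n) {u₀′ = u₀} {v₀′ = v₀} {u₁′ = u₁} {v₁′ = v₁} 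
    (mod₈ p ≡.refl) (mod₈ q ≡.refl) u₁≡@(mod₈ r ≡.refl) v₁≡@(mod₈ s ≡.refl) =
    dickson-cong a≡ b≡ n u₁≡ v₁≡
      (mod₈ (ℤ.- (b ℤ.* s ℤ.+ l ℤ.* v₁ ℤ.+ + 8 ℤ.* l ℤ.* s) ℤ.- p)
       (solve 6 (λ b l v s u p →
         :- ((b :+ con (+ 8) :* l) :* (v :+ con (+ 8) :* s)) :- (u :+ con (+ 8) :* p) :=
         :- (b :* v) :- u :+ con (+ 8) :* (:- (b :* s :+ l :* v :+ con (+ 8) :* l :* s) :- p)) ≡.refl b l v₁ s u₀ p))
      (mod₈ (r ℤ.+ (a ℤ.* s ℤ.+ k ℤ.* v₁ ℤ.+ + 8 ℤ.* k ℤ.* s) ℤ.- q)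
       (solve 8 (λ a k v s u r w q →
         u :+ con (+ 8) :* r :+ (a :+ con (+ 8) :* k) :* (v :+ con (+ 8) :* s) :- (w :+ con (+ 8) :* q) :=
         u :+ a :* v :- w :+ con (+ 8) :* (r :+ (a :* s :+ k :* v :+ con (+ 8) :* k :* s) :- q)) ≡.refl a k v₁ s u₁ r v₀ q))

  -- States D n e ≡ 2 modulo 8 in ℤ[e]; the initial coefficients are those of D 0 e = 2 + 0 e and D
  -- 1 e = 0 + 1 e.
  Trivial : ℤ → ℤ → ℕ → Set
  Trivial a b n = (proj₁ (dickson a b n (+ 2) (+ 0) (+ 0) (+ 1)) ℤ.- + 2) ℤ.%ℕ 8 ≡ 0
                × proj₂ (dickson a b n (+ 2) (+ 0) (+ 0) (+ 1)) ℤ.%ℕ 8 ≡ 0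

  orders : List ℕ
  orders = 8 ∷ 10 ∷ 12 ∷ []

  abstract
    -- Settled by evaluating all 64 pairs; `abstract` keeps the resulting witnesses from being
    -- unfolded.
    residues : ∀ (a b : Fin 8) → Any (Trivial (+ toℕ a) (+ toℕ b)) orders
    residues = toWitness {a? = Fin.all? λ a → Fin.all? λ b →
      any? (λ n → (_ ℕ.≟ 0) ×-dec (_ ℕ.≟ 0)) orders} _

  residue : ∀ i → ∃ λ (r : Fin 8) → i ≡₈ + toℕ r
  residue i = fromℕ< r<8 , mod₈ (i ℤ./ℕ 8) (begin
    i                                              ≡⟨ ℤ.a≡a%ℕn+[a/ℕn]*n i 8 ⟩
    + (i ℤ.%ℕ 8) ℤ.+ (i ℤ./ℕ 8) ℤ.* + 8            ≡⟨ ≡.cong₂ (λ m j → + m ℤ.+ j) (≡.sym (Fin.toℕ-fromℕ< r<8)) (ℤ.*-comm (i ℤ./ℕ 8) (+ 8)) ⟩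
    + toℕ (fromℕ< r<8) ℤ.+ + 8 ℤ.* (i ℤ./ℕ 8)      ∎)
    where
    open ≡.≡-Reasoning
    r<8 = ℤ.n%ℕd<d i 8

  residue-0 : ∀ i → i ℤ.%ℕ 8 ≡ 0 → i ≡₈ + 0
  residue-0 i eq = mod₈ (i ℤ./ℕ 8) (≡.trans (ℤ.a≡a%ℕn+[a/ℕn]*n i 8)
    (≡.cong₂ (λ m j → + m ℤ.+ j) eq (ℤ.*-comm (i ℤ./ℕ 8) (+ 8))))

  ≡₈-trans : ∀ {i j k} → i ≡₈ j → j ≡₈ k → i ≡₈ k
  ≡₈-trans {k = k} (mod₈ m ≡.refl) (mod₈ n ≡.refl) =
    mod₈ (n ℤ.+ m) (solve 3 (λ k n m → k :+ con (+ 8) :* n :+ con (+ 8) :* m := k :+ con (+ 8) :* (n :+ m)) ≡.refl k n m)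

  trivial-order : ∀ a b → ∃ λ n → n ∈ orders ×
    proj₁ (dickson a b n (+ 2) (+ 0) (+ 0) (+ 1)) ≡₈ + 2 ×
    proj₂ (dickson a b n (+ 2) (+ 0) (+ 0) (+ 1)) ≡₈ + 0
  trivial-order a b =
    let n , n∈ , trivial = find (residues (proj₁ (residue a)) (proj₁ (residue b)))
    in n , n∈ , reduce n trivial
    where
    shift-2 : ∀ {i} → i ℤ.- + 2 ≡₈ + 0 → i ≡₈ + 2
    shift-2 {i} (mod₈ k eq) = mod₈ k (≡.trans (solve 1 (λ i → i := con (+ 2) :+ (i :- con (+ 2))) ≡.refl i)
      (≡.trans (≡.cong (ℤ._+_ (+ 2)) eq) (≡.cong (ℤ._+_ (+ 2)) (ℤ.+-identityˡ (+ 8 ℤ.* k)))))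
    reduce : ∀ n → Trivial (+ toℕ (proj₁ (residue a))) (+ toℕ (proj₁ (residue b))) n →
      proj₁ (dickson a b n (+ 2) (+ 0) (+ 0) (+ 1)) ≡₈ + 2 ×
      proj₂ (dickson a b n (+ 2) (+ 0) (+ 0) (+ 1)) ≡₈ + 0
    reduce n (p , q) = ≡₈-trans (proj₁ reduced) (shift-2 (residue-0 _ p)) , ≡₈-trans (proj₂ reduced) (residue-0 _ q)
      where
      reduced = dickson-cong (proj₂ (residue a)) (proj₂ (residue b)) n
        (≡₈-refl (+ 2)) (≡₈-refl (+ 0)) (≡₈-refl (+ 0)) (≡₈-refl (+ 1))

module Mod64 where
  open ℤSolver.+-*-Solver
  open ≡.≡-Reasoning

  -- The left-hand side is 16, while the right-hand side is divisible by 32.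
  -4² : ∀ τ ν → (ℤ.- + 4) ℤ.* (ℤ.- + 4) ≢ + 8 ℤ.* (τ ℤ.* ℤ.- + 4) ℤ.- + 64 ℤ.* ν
  -4² τ ν eq = 1≢2* (ℤ.- τ ℤ.- + 2 ℤ.* ν) (ℤ.*-cancelˡ-≡ (+ 16) (+ 1) (+ 2 ℤ.* (ℤ.- τ ℤ.- + 2 ℤ.* ν)) (≡.trans eq
    (solve 2 (λ τ ν → con (+ 8) :* (τ :* con (ℤ.- + 4)) :- con (+ 64) :* ν :=
      con (+ 16) :* (con (+ 2) :* (:- τ :- con (+ 2) :* ν))) ≡.refl τ ν)))

  -- The left-hand side is odd, the right-hand side even.
  odd² : ∀ k τ ν → let m = + 1 ℤ.+ + 2 ℤ.* k in m ℤ.* m ≢ + 8 ℤ.* (τ ℤ.* m) ℤ.- + 64 ℤ.* ν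
  odd² k τ ν eq = 1≢2* (+ 4 ℤ.* (τ ℤ.* m) ℤ.- + 32 ℤ.* ν ℤ.- + 2 ℤ.* k ℤ.- + 2 ℤ.* (k ℤ.* k)) (begin
    + 1
      ≡⟨ solve 1 (λ k → con (+ 1) := (con (+ 1) :+ con (+ 2) :* k) :* (con (+ 1) :+ con (+ 2) :* k)
           :- con (+ 4) :* k :- con (+ 4) :* (k :* k)) ≡.refl k ⟩
    m ℤ.* m ℤ.- + 4 ℤ.* k ℤ.- + 4 ℤ.* (k ℤ.* k)
      ≡⟨ ≡.cong (λ i → i ℤ.- + 4 ℤ.* k ℤ.- + 4 ℤ.* (k ℤ.* k)) eq ⟩
    + 8 ℤ.* (τ ℤ.* m) ℤ.- + 64 ℤ.* ν ℤ.- + 4 ℤ.* k ℤ.- + 4 ℤ.* (k ℤ.* k)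
      ≡⟨ solve 3 (λ p ν k → con (+ 8) :* p :- con (+ 64) :* ν :- con (+ 4) :* k :- con (+ 4) :* (k :* k) :=
           con (+ 2) :* (con (+ 4) :* p :- con (+ 32) :* ν :- con (+ 2) :* k :- con (+ 2) :* (k :* k)))
           ≡.refl (τ ℤ.* m) ν k ⟩
    + 2 ℤ.* (+ 4 ℤ.* (τ ℤ.* m) ℤ.- + 32 ℤ.* ν ℤ.- + 2 ℤ.* k ℤ.- + 2 ℤ.* (k ℤ.* k)) ∎)
    where m = + 1 ℤ.+ + 2 ℤ.* k

module TorsionBound (K : Extension) (quadratic : HasDegree K 2) where
  open CommutativeRing (commutativeRing K) hiding (zero)
  open IntegerCoefficients (commutativeRing K) using (fromℤ; fromℤ-+; fromℤ-*; fromℤ-neg)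
  open IntegerCoefficients.Solver (commutativeRing K)
  open QuadraticExtension K quadratic using (integral-domain; fromℤ-injective)
  open Dickson (commutativeRing K)
  open Dickson₈ using (dickson; orders; trivial-order)
  open Integrality K quadratic using (integral-equation)
  open SetoidReasoning setoid

  fromℤ-- : ∀ i j → fromℤ (i ℤ.- j) ≈ fromℤ i - fromℤ j
  fromℤ-- i j = trans (fromℤ-+ i (ℤ.- j)) (+-congˡ (fromℤ-neg j))

  module _ {e a b} (e²≈ : e * e ≈ fromℤ a * e - fromℤ b) where

    -- Membership in ℤ[e] = ℤ + ℤ e, the ring in which divisibility by 8 is measured. The equation
    -- for e makes it closed under multiplication.
    record Order (y : Carrier) : Set where
      constructor order
      field
        u v        : ℤ
        expression : y ≈ fromℤ u + fromℤ v * e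

    order-ℤ : ∀ i → Order (fromℤ i)
    order-ℤ i = order i (+ 0) (solve 2 (λ i e → i := i :+ con (+ 0) :* e) refl (fromℤ i) e)

    order-+ : ∀ {x y} → Order x → Order y → Order (x + y)
    order-+ {x} {y} (order u v x≈) (order u′ v′ y≈) = order (u ℤ.+ u′) (v ℤ.+ v′) (begin
      x + y
        ≈⟨ +-cong x≈ y≈ ⟩
      (fromℤ u + fromℤ v * e) + (fromℤ u′ + fromℤ v′ * e)
        ≈⟨ solve 5 (λ u v u′ v′ e → (u :+ v :* e) :+ (u′ :+ v′ :* e) := (u :+ u′) :+ (v :+ v′) :* e) refl _ _ _ _ _ ⟩
      (fromℤ u + fromℤ u′) + (fromℤ v + fromℤ v′) * e
        ≈⟨ +-cong (fromℤ-+ u u′) (*-congʳ (fromℤ-+ v v′)) ⟨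
      fromℤ (u ℤ.+ u′) + fromℤ (v ℤ.+ v′) * e ∎)

    order-neg : ∀ {x} → Order x → Order (- x)
    order-neg {x} (order u v x≈) = order (ℤ.- u) (ℤ.- v) (begin
      - x                                ≈⟨ -‿cong x≈ ⟩
      - (fromℤ u + fromℤ v * e)          ≈⟨ solve 3 (λ u v e → :- (u :+ v :* e) := (:- u) :+ (:- v) :* e) refl _ _ _ ⟩
      - fromℤ u + - fromℤ v * e          ≈⟨ +-cong (fromℤ-neg u) (*-congʳ (fromℤ-neg v)) ⟨
      fromℤ (ℤ.- u) + fromℤ (ℤ.- v) * e  ∎)

    order-* : ∀ {x y} → Order x → Order y → Order (x * y)
    order-* {x} {y} (order u v x≈) (order u′ v′ y≈) =
      order (u ℤ.* u′ ℤ.- v ℤ.* v′ ℤ.* b) (u ℤ.* v′ ℤ.+ v ℤ.* u′ ℤ.+ v ℤ.* v′ ℤ.* a) (begin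
      x * y
        ≈⟨ *-cong x≈ y≈ ⟩
      (fromℤ u + fromℤ v * e) * (fromℤ u′ + fromℤ v′ * e)
        ≈⟨ solve 5 (λ u v u′ v′ e → (u :+ v :* e) :* (u′ :+ v′ :* e) :=
             u :* u′ :+ (u :* v′ :+ v :* u′) :* e :+ v :* v′ :* (e :* e)) refl _ _ _ _ _ ⟩
      fromℤ u * fromℤ u′ + (fromℤ u * fromℤ v′ + fromℤ v * fromℤ u′) * e + fromℤ v * fromℤ v′ * (e * e)
        ≈⟨ +-congˡ (*-congˡ e²≈) ⟩
      fromℤ u * fromℤ u′ + (fromℤ u * fromℤ v′ + fromℤ v * fromℤ u′) * e + fromℤ v * fromℤ v′ * (fromℤ a * e - fromℤ b)
        ≈⟨ solve 7 (λ u v u′ v′ e a b →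
             u :* u′ :+ (u :* v′ :+ v :* u′) :* e :+ v :* v′ :* (a :* e :- b) :=
             (u :* u′ :- v :* v′ :* b) :+ (u :* v′ :+ v :* u′ :+ v :* v′ :* a) :* e) refl _ _ _ _ _ _ _ ⟩
      (fromℤ u * fromℤ u′ - fromℤ v * fromℤ v′ * fromℤ b) +
      (fromℤ u * fromℤ v′ + fromℤ v * fromℤ u′ + fromℤ v * fromℤ v′ * fromℤ a) * e
        ≈⟨ +-cong
             (trans (fromℤ-- (u ℤ.* u′) (v ℤ.* v′ ℤ.* b)) (+-cong (fromℤ-* u u′) (-‿cong (product v v′ b))))
             (*-congʳ (trans (fromℤ-+ (u ℤ.* v′ ℤ.+ v ℤ.* u′) (v ℤ.* v′ ℤ.* a))
               (+-cong (trans (fromℤ-+ (u ℤ.* v′) (v ℤ.* u′)) (+-cong (fromℤ-* u v′) (fromℤ-* v u′))) (product v v′ a)))) ⟨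
      fromℤ (u ℤ.* u′ ℤ.- v ℤ.* v′ ℤ.* b) + fromℤ (u ℤ.* v′ ℤ.+ v ℤ.* u′ ℤ.+ v ℤ.* v′ ℤ.* a) * e ∎)
      where
      product : ∀ i j k → fromℤ (i ℤ.* j ℤ.* k) ≈ fromℤ i * fromℤ j * fromℤ k
      product i j k = trans (fromℤ-* (i ℤ.* j) k) (*-congʳ (fromℤ-* i j))

    order-remainder : ∀ n {w} → Order w → Order (D-remainder n w)
    order-remainder zero          w∈ = order-ℤ (+ 0)
    order-remainder (suc zero)    w∈ = order-ℤ (+ 0)
    order-remainder (suc (suc n)) w∈ = order-+ (order-+
      (order-* (order-+ (order-ℤ (+ 2)) w∈) (order-remainder (suc n) w∈)) (order-ℤ (+ suc n ℤ.* + suc n)))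
      (order-neg (order-remainder n w∈))

    -- β satisfies β² = τβ - ν with integral τ and ν.
    integer-multiple-of-8 : ∀ m {β} → Order β → fromℤ m ≈ fromℤ (+ 8) * β →
      ∃₂ λ τ ν → m ℤ.* m ≡ + 8 ℤ.* (τ ℤ.* m) ℤ.- + 64 ℤ.* ν
    integer-multiple-of-8 m {β} (order u v β≈) m≈8β = τ , ν , fromℤ-injective (begin
      fromℤ (m ℤ.* m)
        ≈⟨ trans (fromℤ-* m m) (*-cong m≈8β m≈8β) ⟩
      (fromℤ (+ 8) * β) * (fromℤ (+ 8) * β)
        ≈⟨ solve 1 (λ β → (con (+ 8) :* β) :* (con (+ 8) :* β) := con (+ 64) :* (β :* β)) refl β ⟩
      fromℤ (+ 64) * (β * β)
        ≈⟨ *-congˡ β² ⟩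
      fromℤ (+ 64) * (fromℤ τ * β - fromℤ ν)
        ≈⟨ solve 3 (λ β τ ν → con (+ 64) :* (τ :* β :- ν) := con (+ 8) :* (τ :* (con (+ 8) :* β)) :- con (+ 64) :* ν) refl _ _ _ ⟩
      fromℤ (+ 8) * (fromℤ τ * (fromℤ (+ 8) * β)) - fromℤ (+ 64) * fromℤ ν
        ≈⟨ +-congʳ (*-congˡ (*-congˡ m≈8β)) ⟨
      fromℤ (+ 8) * (fromℤ τ * fromℤ m) - fromℤ (+ 64) * fromℤ ν
        ≈⟨ trans (fromℤ-- (+ 8 ℤ.* (τ ℤ.* m)) (+ 64 ℤ.* ν)) (+-cong
             (trans (fromℤ-* (+ 8) (τ ℤ.* m)) (*-congˡ (fromℤ-* τ m))) (-‿cong (fromℤ-* (+ 64) ν))) ⟨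
      fromℤ (+ 8 ℤ.* (τ ℤ.* m) ℤ.- + 64 ℤ.* ν) ∎)
      where
      τ = + 2 ℤ.* u ℤ.+ v ℤ.* a
      ν = u ℤ.* u ℤ.+ u ℤ.* v ℤ.* a ℤ.+ v ℤ.* v ℤ.* b
      τ≈ : fromℤ τ ≈ fromℤ (+ 2) * fromℤ u + fromℤ v * fromℤ a
      τ≈ = trans (fromℤ-+ (+ 2 ℤ.* u) (v ℤ.* a)) (+-cong (fromℤ-* (+ 2) u) (fromℤ-* v a))
      ν≈ : fromℤ ν ≈ fromℤ u * fromℤ u + fromℤ u * fromℤ v * fromℤ a + fromℤ v * fromℤ v * fromℤ b
      ν≈ = trans (fromℤ-+ (u ℤ.* u ℤ.+ u ℤ.* v ℤ.* a) (v ℤ.* v ℤ.* b)) (+-cong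
        (trans (fromℤ-+ (u ℤ.* u) (u ℤ.* v ℤ.* a))
          (+-cong (fromℤ-* u u) (trans (fromℤ-* (u ℤ.* v) a) (*-congʳ (fromℤ-* u v)))))
        (trans (fromℤ-* (v ℤ.* v) b) (*-congʳ (fromℤ-* v v))))
      β² : β * β ≈ fromℤ τ * β - fromℤ ν
      β² = begin
        β * β
          ≈⟨ *-cong β≈ β≈ ⟩
        (fromℤ u + fromℤ v * e) * (fromℤ u + fromℤ v * e)
          ≈⟨ solve 3 (λ u v e → (u :+ v :* e) :* (u :+ v :* e) := u :* u :+ con (+ 2) :* u :* v :* e :+ v :* v :* (e :* e)) refl _ _ _ ⟩
        fromℤ u * fromℤ u + fromℤ (+ 2) * fromℤ u * fromℤ v * e + fromℤ v * fromℤ v * (e * e)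
          ≈⟨ +-congˡ (*-congˡ e²≈) ⟩
        fromℤ u * fromℤ u + fromℤ (+ 2) * fromℤ u * fromℤ v * e + fromℤ v * fromℤ v * (fromℤ a * e - fromℤ b)
          ≈⟨ solve 5 (λ u v e a b →
               u :* u :+ con (+ 2) :* u :* v :* e :+ v :* v :* (a :* e :- b) :=
               (con (+ 2) :* u :+ v :* a) :* (u :+ v :* e) :- (u :* u :+ u :* v :* a :+ v :* v :* b)) refl _ _ _ _ _ ⟩
        (fromℤ (+ 2) * fromℤ u + fromℤ v * fromℤ a) * (fromℤ u + fromℤ v * e) -
          (fromℤ u * fromℤ u + fromℤ u * fromℤ v * fromℤ a + fromℤ v * fromℤ v * fromℤ b)
          ≈⟨ +-cong (*-cong τ≈ β≈) (-‿cong ν≈) ⟨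
        fromℤ τ * β - fromℤ ν ∎

    -4-not-multiple-of-8 : ∀ {β} → Order β → ¬ fromℤ (ℤ.- + 4) ≈ fromℤ (+ 8) * β
    -4-not-multiple-of-8 β∈ eq = let τ , ν , eq′ = integer-multiple-of-8 (ℤ.- + 4) β∈ eq in Mod64.-4² τ ν eq′

    odd-not-multiple-of-8 : ∀ k {β} → Order β → ¬ fromℤ (+ 1 ℤ.+ + 2 ℤ.* k) ≈ fromℤ (+ 8) * β
    odd-not-multiple-of-8 k β∈ eq =
      let τ , ν , eq′ = integer-multiple-of-8 (+ 1 ℤ.+ + 2 ℤ.* k) β∈ eq in Mod64.odd² k τ ν eq′

    -- For n = 2h, D n = D h ∘ D 2 and D 2 (2 + w) = 2 + w (w + 4);
    -- for odd n, D n (2 + w) = 2 + w (n² + w g), where n² + w g is odd.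
    near-2⇒2 : ∀ n {α} → Order α → n ≢ 0 →
      D n (fromℤ (+ 2) + fromℤ (+ 8) * α) ≈ fromℤ (+ 2) → fromℤ (+ 8) * α ≈ 0#
    near-2⇒2 = ℕ.<-rec _ descent
      where
      descent : ∀ n → (∀ {h} → h ℕ.< n → ∀ {α} → Order α → h ≢ 0 →
          D h (fromℤ (+ 2) + fromℤ (+ 8) * α) ≈ fromℤ (+ 2) → fromℤ (+ 8) * α ≈ 0#) →
        ∀ {α} → Order α → n ≢ 0 →
        D n (fromℤ (+ 2) + fromℤ (+ 8) * α) ≈ fromℤ (+ 2) → fromℤ (+ 8) * α ≈ 0#
      descent n rec {α} α∈ n≢0 Dn≈2 with even⊎odd n
      ... | zero , inj₁ n≡0 = contradiction n≡0 n≢0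
      ... | suc h , inj₁ ≡.refl = Sum.[ (λ w≈0 → w≈0) , (λ w+4≈0 → contradiction (begin
              fromℤ (ℤ.- + 4)            ≈⟨ solve 1 (λ w → con (ℤ.- + 4) := w :- (w :+ con (+ 4))) refl w ⟩
              w - (w + fromℤ (+ 4))      ≈⟨ +-congˡ (-‿cong w+4≈0) ⟩
              w - 0#                     ≈⟨ solve 1 (λ w → w :- con (+ 0) := w) refl w ⟩
              fromℤ (+ 8) * α            ∎) (-4-not-multiple-of-8 α∈)) ]
            (integral-domain (trans (solve 1 (λ α → con (+ 8) :* α :* (con (+ 8) :* α :+ con (+ 4)) :=
               con (+ 8) :* (α :* (con (+ 8) :* α :+ con (+ 4)))) refl α)
              -- D 2 (2 + w) = 2 + w (w + 4) is again 2 plus a multiple of 8, with α (w + 4) in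
              -- place of α, so the induction hypothesis gives w (w + 4) = 0.
              (rec {suc h} h<n {α * (w + fromℤ (+ 4))} (order-* α∈ (order-+ (order-* (order-ℤ (+ 8)) α∈) (order-ℤ (+ 4)))) (λ ()) (begin
                D (suc h) (fromℤ (+ 2) + fromℤ (+ 8) * (α * (w + fromℤ (+ 4))))
                  ≈⟨ D-cong (suc h) (solve 1 (λ α → con (+ 2) :+ con (+ 8) :* (α :* (con (+ 8) :* α :+ con (+ 4))) :=
                       (con (+ 2) :+ con (+ 8) :* α) :* (con (+ 2) :+ con (+ 8) :* α) :- con (+ 2)) refl α) ⟩
                D (suc h) (D 2 (fromℤ (+ 2) + w))
                  ≈⟨ D-∘ (suc h) 2 _ ⟩
                D (suc h ℕ.* 2) (fromℤ (+ 2) + w)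
                  ≈⟨ Dn≈2 ⟩
                fromℤ (+ 2) ∎))))
        where
        w = fromℤ (+ 8) * α
        h<n : suc h ℕ.< suc h ℕ.* 2
        h<n = s≤s (s≤s (ℕ.m≤m*n h 2))
      ... | h , inj₂ ≡.refl = Sum.[ (λ w≈0 → w≈0) , (λ odd≈0 → contradiction (begin
              fromℤ (+ 1 ℤ.+ + 2 ℤ.* k)
                ≡⟨ ≡.cong fromℤ n²≡ ⟨
              fromℤ n²
                ≈⟨ solve 3 (λ s α g → s := (s :+ (con (+ 8) :* α) :* g) :+ con (+ 8) :* (:- (α :* g))) refl _ α g ⟩
              (fromℤ n² + w * g) + fromℤ (+ 8) * (- (α * g))
                ≈⟨ trans (+-congʳ odd≈0) (+-identityˡ _) ⟩
              fromℤ (+ 8) * (- (α * g)) ∎)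
              (odd-not-multiple-of-8 k (order-neg (order-* α∈ (order-remainder n (order-* (order-ℤ (+ 8)) α∈)))))) ]
            (integral-domain (begin
              w * (fromℤ n² + w * g)
                ≈⟨ solve 3 (λ w s g → w :* (s :+ w :* g) := (con (+ 2) :+ s :* w :+ w :* w :* g) :- con (+ 2)) refl w _ g ⟩
              (fromℤ (+ 2) + fromℤ n² * w + w * w * g) - fromℤ (+ 2)
                ≈⟨ +-congʳ (trans (sym (D-near-2 n w)) Dn≈2) ⟩
              fromℤ (+ 2) - fromℤ (+ 2)
                ≈⟨ -‿inverseʳ _ ⟩
              0# ∎))
        where
        w = fromℤ (+ 8) * α
        g = D-remainder n w
        n² = + n ℤ.* + n
        k = + 2 ℤ.* + h ℤ.+ + 2 ℤ.* (+ h ℤ.* + h)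
        n²≡ : n² ≡ + 1 ℤ.+ + 2 ℤ.* k
        n²≡ = ≡.trans (≡.cong (λ i → i ℤ.* i) (≡.cong (ℤ._+_ (+ 1)) (ℤ.pos-* h 2)))
          (Z.solve 1 (λ h → (Z.con (+ 1) Z.:+ h Z.:* Z.con (+ 2)) Z.:* (Z.con (+ 1) Z.:+ h Z.:* Z.con (+ 2)) Z.:=
             Z.con (+ 1) Z.:+ Z.con (+ 2) Z.:* (Z.con (+ 2) Z.:* h Z.:+ Z.con (+ 2) Z.:* (h Z.:* h))) ≡.refl (+ h))
          where module Z = ℤSolver.+-*-Solver

    D-coefficients : ∀ n k {u₀ v₀ u₁ v₁} →
      D k e ≈ fromℤ u₀ + fromℤ v₀ * e → D (suc k) e ≈ fromℤ u₁ + fromℤ v₁ * e →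
      let u , v = dickson a b n u₀ v₀ u₁ v₁ in D (n ℕ.+ k) e ≈ fromℤ u + fromℤ v * e
    D-coefficients zero    k p q = p
    D-coefficients (suc n) k {u₀} {v₀} {u₁} {v₁} p q = trans
      (reflexive (≡.cong (λ m → D m e) (≡.sym (ℕ.+-suc n k))))
      (D-coefficients n (suc k) q (begin
        e * D (suc k) e - D k e
          ≈⟨ +-cong (*-congˡ q) (-‿cong p) ⟩
        e * (fromℤ u₁ + fromℤ v₁ * e) - (fromℤ u₀ + fromℤ v₀ * e)
          ≈⟨ solve 5 (λ e u₁ v₁ u₀ v₀ → e :* (u₁ :+ v₁ :* e) :- (u₀ :+ v₀ :* e) :=
               u₁ :* e :+ v₁ :* (e :* e) :- (u₀ :+ v₀ :* e)) refl _ _ _ _ _ ⟩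
        fromℤ u₁ * e + fromℤ v₁ * (e * e) - (fromℤ u₀ + fromℤ v₀ * e)
          ≈⟨ +-congʳ (+-congˡ (*-congˡ e²≈)) ⟩
        fromℤ u₁ * e + fromℤ v₁ * (fromℤ a * e - fromℤ b) - (fromℤ u₀ + fromℤ v₀ * e)
          ≈⟨ solve 7 (λ e u₁ v₁ u₀ v₀ a b → u₁ :* e :+ v₁ :* (a :* e :- b) :- (u₀ :+ v₀ :* e) :=
               (:- (b :* v₁) :- u₀) :+ (u₁ :+ a :* v₁ :- v₀) :* e) refl _ _ _ _ _ _ _ ⟩
        (- (fromℤ b * fromℤ v₁) - fromℤ u₀) + (fromℤ u₁ + fromℤ a * fromℤ v₁ - fromℤ v₀) * e
          ≈⟨ +-cong
               (trans (fromℤ-- (ℤ.- (b ℤ.* v₁)) u₀) (+-congʳ (trans (fromℤ-neg (b ℤ.* v₁)) (-‿cong (fromℤ-* b v₁)))))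
               (*-congʳ (trans (fromℤ-- (u₁ ℤ.+ a ℤ.* v₁) v₀) (+-congʳ (trans (fromℤ-+ u₁ (a ℤ.* v₁)) (+-congˡ (fromℤ-* a v₁)))))) ⟨
        fromℤ (ℤ.- (b ℤ.* v₁) ℤ.- u₀) + fromℤ (u₁ ℤ.+ a ℤ.* v₁ ℤ.- v₀) * e ∎))

    near-2 : ∀ n {u v} → D n e ≈ fromℤ u + fromℤ v * e → u ≡₈ + 2 → v ≡₈ + 0 →
      ∃ λ α → Order α × D n e ≈ fromℤ (+ 2) + fromℤ (+ 8) * α
    near-2 n eq (mod₈ p ≡.refl) (mod₈ q ≡.refl) = fromℤ p + fromℤ q * e , order p q refl , (begin
      D n e
        ≈⟨ eq ⟩
      fromℤ (+ 2 ℤ.+ + 8 ℤ.* p) + fromℤ (+ 0 ℤ.+ + 8 ℤ.* q) * e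
        ≈⟨ +-cong (trans (fromℤ-+ (+ 2) (+ 8 ℤ.* p)) (+-congˡ (fromℤ-* (+ 8) p)))
             (*-congʳ (trans (fromℤ-+ (+ 0) (+ 8 ℤ.* q)) (trans (+-identityˡ _) (fromℤ-* (+ 8) q)))) ⟩
      (fromℤ (+ 2) + fromℤ (+ 8) * fromℤ p) + fromℤ (+ 8) * fromℤ q * e
        ≈⟨ solve 3 (λ p q e → (con (+ 2) :+ con (+ 8) :* p) :+ con (+ 8) :* q :* e :=
             con (+ 2) :+ con (+ 8) :* (p :+ q :* e)) refl _ _ _ ⟩
      fromℤ (+ 2) + fromℤ (+ 8) * (fromℤ p + fromℤ q * e) ∎)

    -- The congruence supplies m with D m e close to 2. Since D (n + 1) and D m commute under
    -- composition, D (n + 1) (D m e) = D m 2 = 2, and `near-2⇒2` turns the congruence into an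
    -- equality.
    torsion : ∀ {n} → D (suc n) e ≈ fromℤ (+ 2) → ∃ λ m → m ∈ orders × D m e ≈ fromℤ (+ 2)
    torsion {n} De≈2 =
      let m , m∈ , u≡ , v≡ = trivial-order a b
          De = D-coefficients m 0
            (solve 1 (λ e → con (+ 2) := con (+ 2) :+ con (+ 0) :* e) refl e)
            (solve 1 (λ e → e := con (+ 0) :+ con (+ 1) :* e) refl e)
          α , α∈ , eq = near-2 m (trans (reflexive (≡.cong (λ k → D k e) (≡.sym (ℕ.+-identityʳ m)))) De) u≡ v≡
      in m , m∈ , (begin
        D m e                          ≈⟨ eq ⟩
        fromℤ (+ 2) + fromℤ (+ 8) * α  ≈⟨ +-congˡ (near-2⇒2 (suc n) α∈ (λ ()) (begin
          D (suc n) (fromℤ (+ 2) + fromℤ (+ 8) * α)  ≈⟨ D-cong (suc n) eq ⟨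
          D (suc n) (D m e)                          ≈⟨ D-∘ (suc n) m e ⟩
          D (suc n ℕ.* m) e                          ≡⟨ ≡.cong (λ k → D k e) (ℕ.*-comm (suc n) m) ⟩
          D (m ℕ.* suc n) e                          ≈⟨ D-∘ m (suc n) e ⟨
          D m (D (suc n) e)                          ≈⟨ D-cong m De≈2 ⟩
          D m (fromℤ (+ 2))                          ≈⟨ D-2 m ⟩
          fromℤ (+ 2)                                ∎)) ⟩
        fromℤ (+ 2) + 0#               ≈⟨ +-identityʳ _ ⟩
        fromℤ (+ 2)                    ∎)

  torsion-bound : ∀ e n → D (suc n) e ≈ fromℤ (+ 2) → ∃ λ m → m ∈ orders × D m e ≈ fromℤ (+ 2)
  torsion-bound e n De≈2 = from-equation (integral-equation {e} {n} De≈2)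
    where
    from-equation : (∃₂ λ a b → e * e ≈ fromℤ a * e - fromℤ b) → ∃ λ m → m ∈ orders × D m e ≈ fromℤ (+ 2)
    from-equation (a , b , e²≈) = torsion {e} {a} {b} e²≈ {n} De≈2

-- From the splitting to power sums: Newton's identities.

-- Substitutes a/b for the variable without dividing. The case of interest is b = z and a = 1 + z²,
-- that is X = z + 1/z: a linear factor X - e becomes 1 - e z + z², the denominator of the
-- generating series of the D k e.
module Homogenization {r ρ s σ} (R : CommutativeRing r ρ) (S : CommutativeRing s σ)
  (φ : CommutativeRing.Carrier R → CommutativeRing.Carrier S)
  (φ-homomorphism : RingMorphisms.IsRingHomomorphism (CommutativeRing.rawRing R) (CommutativeRing.rawRing S) φ)
  (a b : CommutativeRing.Carrier S)
  where
  private
    module R = CommutativeRing R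
    module φ = RingMorphisms.IsRingHomomorphism φ-homomorphism
    module Rₛ = IntegerCoefficients R
    module Dₚ = Dickson (PolynomialRing.polynomialRing R)
    module Zₚ = IntegerCoefficients (PolynomialRing.polynomialRing R)
    module R[X] = CommutativeRing (PolynomialRing.polynomialRing R)
  open CommutativeRing S hiding (zero)
  open IntegerCoefficients S using (fromℤ; module Solver)
  open Solver using (solve; _:+_; _:*_; _:-_; _:=_; :-_; con)
  open PolynomialRing R using (Sequence; _≋_; shift; shift-cong; ▷-const; coeff-+; coeff-*; coeff-neg)
  open Polynomial R.rawRing using (Poly; coeff; X; const)
  open import Algebra.Properties.Semiring.Exp semiring using (_^_)
  open RawMonoidDefs *-rawMonoid using () renaming (sum to product)
  open RawMonoidDefs R[X].*-rawMonoid using () renaming (sum to productₚ)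
  open SetoidReasoning setoid

  -- bⁿ p(a/b) for a polynomial p of degree at most n with coefficients c.
  homogenize : ℕ → Sequence → Carrier
  homogenize zero    c = φ (c zero)
  homogenize (suc n) c = φ (c zero) * b ^ suc n + a * homogenize n (c ∘ suc)

  homogenize-cong : ∀ n {c d} → c ≋ d → homogenize n c ≈ homogenize n d
  homogenize-cong zero    c≋d = φ.⟦⟧-cong (c≋d zero)
  homogenize-cong (suc n) c≋d =
    +-cong (*-congʳ (φ.⟦⟧-cong (c≋d zero))) (*-congˡ (homogenize-cong n (c≋d ∘ suc)))

  homogenize-linear : ∀ n x c d →
    homogenize n (λ k → c k R.+ x R.* d k) ≈ homogenize n c + φ x * homogenize n d
  homogenize-linear zero    x c d = trans (φ.+-homo _ _) (+-congˡ (φ.*-homo _ _))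
  homogenize-linear (suc n) x c d = begin
    φ (c zero R.+ x R.* d zero) * b ^ suc n + a * homogenize n (λ k → c (suc k) R.+ x R.* d (suc k))
      ≈⟨ +-cong (*-congʳ (trans (φ.+-homo _ _) (+-congˡ (φ.*-homo _ _)))) (*-congˡ (homogenize-linear n x (c ∘ suc) (d ∘ suc))) ⟩
    (φ (c zero) + φ x * φ (d zero)) * b ^ suc n + a * (homogenize n (c ∘ suc) + φ x * homogenize n (d ∘ suc))
      ≈⟨ solve 7 (λ c x d p a u v → (c :+ x :* d) :* p :+ a :* (u :+ x :* v) :=
           (c :* p :+ a :* u) :+ x :* (d :* p :+ a :* v)) refl _ _ _ (b ^ suc n) _ _ _ ⟩
    homogenize (suc n) c + φ x * homogenize (suc n) d ∎

  homogenize-shift : ∀ n c → homogenize (suc n) (shift c) ≈ a * homogenize n c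
  homogenize-shift n c = trans (+-congʳ (trans (*-congʳ φ.0#-homo) (zeroˡ _))) (+-identityˡ _)

  -- Raising the formal degree above the true degree multiplies by b. Lists carry no degree, hence
  -- the hypothesis on the top coefficient.
  homogenize-suc : ∀ n c → c (suc n) R.≈ R.0# → homogenize (suc n) c ≈ b * homogenize n c
  homogenize-suc zero    c c≈0 = begin
    φ (c 0) * (b * 1#) + a * φ (c 1)
      ≈⟨ +-congˡ (*-congˡ (trans (φ.⟦⟧-cong c≈0) φ.0#-homo)) ⟩
    φ (c 0) * (b * 1#) + a * 0#
      ≈⟨ solve 3 (λ c b a → c :* (b :* con (+ 1)) :+ a :* con (+ 0) := b :* c) refl _ _ _ ⟩
    b * φ (c 0) ∎
  homogenize-suc (suc n) c c≈0 = begin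
    φ (c 0) * (b * b ^ suc n) + a * homogenize (suc n) (c ∘ suc)
      ≈⟨ +-congˡ (*-congˡ (homogenize-suc n (c ∘ suc) c≈0)) ⟩
    φ (c 0) * (b * b ^ suc n) + a * (b * homogenize n (c ∘ suc))
      ≈⟨ solve 5 (λ c b p a h → c :* (b :* p) :+ a :* (b :* h) := b :* (c :* p :+ a :* h)) refl _ _ (b ^ suc n) _ _ ⟩
    b * (φ (c 0) * b ^ suc n + a * homogenize n (c ∘ suc)) ∎

  Degree≤ : ℕ → Poly → Set _
  Degree≤ n p = ∀ k → n ℕ.< k → coeff p k R.≈ R.0#

  coeff-X* : ∀ p → coeff (X R[X].* p) ≋ shift (coeff p)
  coeff-X* p k = R.trans (coeff-* X p k) (R.trans (R.+-congʳ (R.zeroˡ _)) (R.trans (R.+-identityˡ _)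
    (shift-cong (λ j → R.trans (▷-const R.1# (coeff p) j) (R.*-identityˡ _)) k)))

  coeff-linear : ∀ e p →
    coeff ((X R[X].+ R[X].- const e) R[X].* p) ≋ λ k → shift (coeff p) k R.+ R.- e R.* coeff p k
  coeff-linear e p k =
    R.trans (R[X].distribʳ p X (R[X].- const e) k)
    (R.trans (coeff-+ (X R[X].* p) (const (R.- e) R[X].* p) k)
    (R.+-cong (coeff-X* p k) (R.trans (coeff-* (const (R.- e)) p k) (▷-const (R.- e) (coeff p) k))))

  coeff-- : ∀ p q → coeff (p R[X].- q) ≋ λ k → coeff p k R.+ R.- R.1# R.* coeff q k
  coeff-- p q k = R.trans (coeff-+ p (R[X].- q) k) (R.+-congˡ (R.trans (coeff-neg q k) (R.sym (-1*x≈-x _))))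
    where open RingProperties R.ring using (-1*x≈-x)

  φ-1 : φ (R.- R.1#) ≈ - 1#
  φ-1 = trans (φ.-‿homo R.1#) (-‿cong φ.1#-homo)

  degree-product : ∀ {n} (e : Vector R.Carrier n) →
    Degree≤ n (productₚ λ i → X R[X].+ R[X].- const (e i))
  degree-product {zero}  e (suc k) _         = R.refl
  degree-product {suc n} e (suc k) (s≤s n<k) = R.trans (coeff-linear (e zero) p (suc k)) (R.trans
    (R.+-cong (degree-product (e ∘ suc) k n<k) (R.trans (R.*-congˡ (degree-product (e ∘ suc) (suc k) (ℕ.m≤n⇒m≤1+n n<k))) (R.zeroʳ _)))
    (R.+-identityˡ _))
    where p = productₚ λ i → X R[X].+ R[X].- const (e (suc i))

  homogenize-product : ∀ {n} (e : Vector R.Carrier n) →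
    homogenize n (coeff (productₚ λ i → X R[X].+ R[X].- const (e i))) ≈ product (λ i → a - φ (e i) * b)
  homogenize-product {zero}  e = φ.1#-homo
  homogenize-product {suc n} e = begin
    homogenize (suc n) (coeff ((X R[X].+ R[X].- const (e zero)) R[X].* p))
      ≈⟨ homogenize-cong (suc n) (coeff-linear (e zero) p) ⟩
    homogenize (suc n) (λ k → shift (coeff p) k R.+ R.- e zero R.* coeff p k)
      ≈⟨ homogenize-linear (suc n) (R.- e zero) (shift (coeff p)) (coeff p) ⟩
    homogenize (suc n) (shift (coeff p)) + φ (R.- e zero) * homogenize (suc n) (coeff p)
      ≈⟨ +-cong (homogenize-shift n (coeff p))
           (*-cong (φ.-‿homo (e zero)) (homogenize-suc n (coeff p) (degree-product (e ∘ suc) (suc n) ℕ.≤-refl))) ⟩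
    a * homogenize n (coeff p) + - φ (e zero) * (b * homogenize n (coeff p))
      ≈⟨ solve 4 (λ a h e b → a :* h :+ (:- e) :* (b :* h) := (a :- e :* b) :* h) refl _ _ _ _ ⟩
    (a - φ (e zero) * b) * homogenize n (coeff p)
      ≈⟨ *-congˡ (homogenize-product (e ∘ suc)) ⟩
    (a - φ (e zero) * b) * product (λ i → a - φ (e (suc i)) * b) ∎
    where p = productₚ λ i → X R[X].+ R[X].- const (e (suc i))

  degree-D : ∀ n → Degree≤ n (Dₚ.D n X)
  degree-D zero          (suc k)       _         = R.refl
  degree-D (suc zero)    (suc (suc k)) _         = R.refl
  degree-D (suc zero)    (suc zero)    (s≤s ())
  degree-D (suc (suc n)) (suc k)       (s≤s n<k) = R.trans (coeff-- (X R[X].* Dₚ.D (suc n) X) (Dₚ.D n X) (suc k)) (R.trans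
    (R.+-cong (R.trans (coeff-X* (Dₚ.D (suc n) X) (suc k)) (degree-D (suc n) k n<k))
      (R.trans (R.*-congˡ (degree-D n (suc k) (ℕ.≤-trans (ℕ.n≤1+n _) (ℕ.m≤n⇒m≤1+n n<k)))) (R.zeroʳ _)))
    (R.+-identityˡ _))

  -- This is bⁿ D n (a/b); clearing denominators in the recursion produces the factor b².
  homogeneousD : ℕ → Carrier
  homogeneousD zero          = fromℤ (+ 2)
  homogeneousD (suc zero)    = a
  homogeneousD (suc (suc n)) = a * homogeneousD (suc n) - b * b * homogeneousD n

  φ-2 : φ (Rₛ.fromℤ (+ 2)) ≈ fromℤ (+ 2)
  φ-2 = trans (φ.+-homo R.1# R.1#) (+-cong φ.1#-homo φ.1#-homo)

  homogenize-D : ∀ n → homogenize n (coeff (Dₚ.D n X)) ≈ homogeneousD n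
  homogenize-D zero          = φ-2
  homogenize-D (suc zero)    = begin
    φ R.0# * (b * 1#) + a * φ R.1#   ≈⟨ +-cong (*-congʳ φ.0#-homo) (*-congˡ φ.1#-homo) ⟩
    0# * (b * 1#) + a * 1#           ≈⟨ solve 2 (λ a b → con (+ 0) :* (b :* con (+ 1)) :+ a :* con (+ 1) := a) refl a b ⟩
    a                                ∎
  homogenize-D (suc (suc n)) = begin
    homogenize (2 ℕ.+ n) (coeff (X R[X].* p₁ R[X].- p₀))
      ≈⟨ homogenize-cong (2 ℕ.+ n) (λ k → R.trans (coeff-- (X R[X].* p₁) p₀ k) (R.+-congʳ (coeff-X* p₁ k))) ⟩
    homogenize (2 ℕ.+ n) (λ k → shift (coeff p₁) k R.+ R.- R.1# R.* coeff p₀ k)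
      ≈⟨ homogenize-linear (2 ℕ.+ n) (R.- R.1#) (shift (coeff p₁)) (coeff p₀) ⟩
    homogenize (2 ℕ.+ n) (shift (coeff p₁)) + φ (R.- R.1#) * homogenize (2 ℕ.+ n) (coeff p₀)
      ≈⟨ +-cong (homogenize-shift (suc n) (coeff p₁)) (*-cong φ-1
           (trans (homogenize-suc (suc n) (coeff p₀) (degree-D n (2 ℕ.+ n) (ℕ.n≤1+n (suc n))))
             (*-congˡ (homogenize-suc n (coeff p₀) (degree-D n (suc n) ℕ.≤-refl))))) ⟩
    a * homogenize (suc n) (coeff p₁) + - 1# * (b * (b * homogenize n (coeff p₀)))
      ≈⟨ +-cong (*-congˡ (homogenize-D (suc n))) (*-congˡ (*-congˡ (*-congˡ (homogenize-D n)))) ⟩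
    a * homogeneousD (suc n) + - 1# * (b * (b * homogeneousD n))
      ≈⟨ solve 4 (λ a u b v → a :* u :+ (:- con (+ 1)) :* (b :* (b :* v)) := a :* u :- b :* b :* v) refl _ _ _ _ ⟩
    homogeneousD (2 ℕ.+ n) ∎
    where
    p₁ = Dₚ.D (suc n) X
    p₀ = Dₚ.D n X

  homogenize-const : ∀ n p → Degree≤ 0 p → homogenize n (coeff p) ≈ φ (coeff p 0) * b ^ n
  homogenize-const zero    p deg = sym (*-identityʳ _)
  homogenize-const (suc n) p deg = begin
    homogenize (suc n) (coeff p)      ≈⟨ homogenize-suc n (coeff p) (deg (suc n) (s≤s z≤n)) ⟩
    b * homogenize n (coeff p)        ≈⟨ *-congˡ (homogenize-const n p deg) ⟩
    b * (φ (coeff p 0) * b ^ n)       ≈⟨ solve 3 (λ b c p → b :* (c :* p) := c :* (b :* p)) refl _ _ _ ⟩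
    φ (coeff p 0) * (b * b ^ n)       ∎

  homogeneous-splitting : ∀ {n} (e : Vector R.Carrier n) →
    (Dₚ.D n X R[X].- Zₚ.fromℤ (+ 2)) R[X].≈ (productₚ λ i → X R[X].+ R[X].- const (e i)) →
    product (λ i → a - φ (e i) * b) ≈ homogeneousD n - fromℤ (+ 2) * b ^ n
  homogeneous-splitting {n} e splits = begin
    product (λ i → a - φ (e i) * b)
      ≈⟨ homogenize-product e ⟨
    homogenize n (coeff (productₚ λ i → X R[X].+ R[X].- const (e i)))
      ≈⟨ homogenize-cong n splits ⟨
    homogenize n (coeff (Dₚ.D n X R[X].- Zₚ.fromℤ (+ 2)))
      ≈⟨ homogenize-cong n (coeff-- (Dₚ.D n X) (Zₚ.fromℤ (+ 2))) ⟩
    homogenize n (λ k → coeff (Dₚ.D n X) k R.+ R.- R.1# R.* coeff (Zₚ.fromℤ (+ 2)) k)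
      ≈⟨ homogenize-linear n (R.- R.1#) (coeff (Dₚ.D n X)) (coeff (Zₚ.fromℤ (+ 2))) ⟩
    homogenize n (coeff (Dₚ.D n X)) + φ (R.- R.1#) * homogenize n (coeff (Zₚ.fromℤ (+ 2)))
      ≈⟨ +-cong (homogenize-D n) (*-cong φ-1
           (trans (homogenize-const n (Zₚ.fromℤ (+ 2)) λ { (suc k) _ → R.refl }) (*-congʳ φ-2))) ⟩
    homogeneousD n + - 1# * (fromℤ (+ 2) * b ^ n)
      ≈⟨ solve 2 (λ d p → d :+ (:- con (+ 1)) :* (con (+ 2) :* p) := d :- con (+ 2) :* p) refl _ _ ⟩
    homogeneousD n - fromℤ (+ 2) * b ^ n ∎
  -- With a/b = b + 1/b, this is bⁿ (bⁿ + 1/bⁿ).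
  homogeneousD-1+b² : a ≈ 1# + b * b → ∀ n → homogeneousD n ≈ 1# + b ^ n * b ^ n
  homogeneousD-1+b² a≈ zero          = solve 0 (con (+ 2) := con (+ 1) :+ con (+ 1) :* con (+ 1)) refl
  homogeneousD-1+b² a≈ (suc zero)    =
    trans a≈ (solve 1 (λ b → con (+ 1) :+ b :* b := con (+ 1) :+ b :* con (+ 1) :* (b :* con (+ 1))) refl b)
  homogeneousD-1+b² a≈ (suc (suc n)) = begin
    a * homogeneousD (suc n) - b * b * homogeneousD n
      ≈⟨ +-cong (*-cong a≈ (homogeneousD-1+b² a≈ (suc n))) (-‿cong (*-congˡ (homogeneousD-1+b² a≈ n))) ⟩
    (1# + b * b) * (1# + b * b ^ n * (b * b ^ n)) - b * b * (1# + b ^ n * b ^ n)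
      ≈⟨ solve 2 (λ b p → (con (+ 1) :+ b :* b) :* (con (+ 1) :+ b :* p :* (b :* p)) :- b :* b :* (con (+ 1) :+ p :* p) :=
           con (+ 1) :+ b :* (b :* p) :* (b :* (b :* p))) refl b (b ^ n) ⟩
    1# + b ^ suc (suc n) * b ^ suc (suc n) ∎

  -- Written as 1 plus a multiple of bⁿ: for b = z the product of the factors 1 - e z + z² agrees
  -- with 1 below degree n, and this is how the length of the cycle enters Newton's identities.
  product≈1+bⁿ : a ≈ 1# + b * b → ∀ {n} (e : Vector R.Carrier n) →
    (Dₚ.D n X R[X].- Zₚ.fromℤ (+ 2)) R[X].≈ (productₚ λ i → X R[X].+ R[X].- const (e i)) →
    product (λ i → a - φ (e i) * b) ≈ 1# + b ^ n * (b ^ n - fromℤ (+ 2))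
  product≈1+bⁿ a≈ {n} e splits = begin
    product (λ i → a - φ (e i) * b)          ≈⟨ homogeneous-splitting e splits ⟩
    homogeneousD n - fromℤ (+ 2) * b ^ n     ≈⟨ +-congʳ (homogeneousD-1+b² a≈ n) ⟩
    1# + b ^ n * b ^ n - fromℤ (+ 2) * b ^ n ≈⟨ solve 1 (λ p → con (+ 1) :+ p :* p :- con (+ 2) :* p := con (+ 1) :+ p :* (p :- con (+ 2))) refl (b ^ n) ⟩
    1# + b ^ n * (b ^ n - fromℤ (+ 2))       ∎

module Newton {r ρ} (R : CommutativeRing r ρ) where
  open CommutativeRing R hiding (zero; _-_)
  open IntegerCoefficients R using (fromℤ; fromℕ; module Solver)
  open Solver using (solve; _:+_; _:*_; _:-_; _:=_; :-_; con)
  open PolynomialRing R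
  open Dickson R using (D)
  open Polynomial (CommutativeRing.rawRing R) using (Poly; coeff; X; const)
  private module R[X] = CommutativeRing polynomialRing
  open import Algebra.Properties.Semiring.Mult.TCOptimised semiring using (1+×)
  open import Algebra.Properties.Semiring.Exp R[X].semiring using (_^_)
  open RawMonoidDefs +-rawMonoid using (sum)
  open RawMonoidDefs R[X].*-rawMonoid using () renaming (sum to product)
  open IntegerCoefficients polynomialRing using () renaming (fromℤ to fromℤₚ)
  open Dickson polynomialRing using () renaming (D to Dₚ)
  open SetoidReasoning setoid

  const-homomorphism : RingMorphisms.IsRingHomomorphism
    (CommutativeRing.rawRing R) (CommutativeRing.rawRing polynomialRing) const
  const-homomorphism = record
    { isSemiringHomomorphism = record
      { isNearSemiringHomomorphism = record
        { +-isMonoidHomomorphism = record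
          { isMagmaHomomorphism = record
            { isRelHomomorphism = record { cong = λ { x≈y zero → x≈y ; x≈y (suc k) → refl } }
            ; homo = λ x y k → refl
            }
          ; ε-homo = λ { zero → refl ; (suc k) → refl }
          }
        ; *-homo = λ { x y zero → sym (+-identityʳ _) ; x y (suc k) → refl }
        }
      ; 1#-homo = λ k → refl
      }
    ; -‿homo = λ x k → refl
    }

  factor : Carrier → Poly
  factor e = R[X].1# R[X].+ X R[X].* X R[X].- const e R[X].* X

  factor≈ : ∀ e → factor e ≈ₚ 1# ∷ - e ∷ 1# ∷ []
  factor≈ e zero                = solve 1 (λ e → (con (+ 1) :+ (con (+ 0) :* con (+ 0) :+ con (+ 0))) :+ :- (e :* con (+ 0) :+ con (+ 0)) := con (+ 1)) refl e
  factor≈ e (suc zero)          = solve 1 (λ e → (con (+ 0) :* con (+ 1) :+ (con (+ 1) :* con (+ 0) :+ con (+ 0))) :+ :- (e :* con (+ 1)) := :- e) refl e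
  factor≈ e (suc (suc zero))    = solve 0 (con (+ 1) :* con (+ 1) := con (+ 1)) refl
  factor≈ e (suc (suc (suc k))) = refl

  shift-zero : shift (λ _ → 0#) ≋ λ _ → 0#
  shift-zero zero    = refl
  shift-zero (suc k) = refl

  factor-▷ : ∀ e s → factor e ▷ s ≋ λ k → s k + - e * shift s k + shift (shift s) k
  factor-▷ e s k = trans (▷-congˡ (factor e) (1# ∷ - e ∷ 1# ∷ []) s (factor≈ e) k) (list k)
    where
    list : (1# ∷ - e ∷ 1# ∷ []) ▷ s ≋ λ k → s k + - e * shift s k + shift (shift s) k
    list zero          = solve 2 (λ s e → con (+ 1) :* s :+ con (+ 0) := s :+ (:- e) :* con (+ 0) :+ con (+ 0)) refl _ e
    list (suc zero)    = solve 3 (λ s t e → con (+ 1) :* s :+ ((:- e) :* t :+ con (+ 0)) := s :+ (:- e) :* t :+ con (+ 0)) refl _ _ e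
    list (suc (suc k)) = trans (+-congˡ (+-congˡ (+-congˡ (shift-zero k))))
      (solve 4 (λ s t u e → con (+ 1) :* s :+ ((:- e) :* t :+ (con (+ 1) :* u :+ con (+ 0))) := s :+ (:- e) :* t :+ u) refl _ _ _ e)

  numerator : Carrier → Poly
  numerator e = fromℤ (+ 2) ∷ - e ∷ []

  numerator-▷ : ∀ e s → numerator e ▷ s ≋ λ k → fromℤ (+ 2) * s k + - e * shift s k
  numerator-▷ e s zero    = solve 2 (λ s e → con (+ 2) :* s :+ con (+ 0) := con (+ 2) :* s :+ (:- e) :* con (+ 0)) refl _ e
  numerator-▷ e s (suc k) = +-congˡ (trans (+-congˡ (shift-zero k)) (+-identityʳ _))

  -- (1 - e z + z²) Σₖ D k e zᵏ = 2 - e z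
  factor-▷-D : ∀ e → factor e ▷ (λ k → D k e) ≋ coeff (numerator e)
  factor-▷-D e k = trans (factor-▷ e (λ k → D k e) k) (terms k)
    where
    terms : ∀ k → D k e + - e * shift (λ k → D k e) k + shift (shift (λ k → D k e)) k ≈ coeff (numerator e) k
    terms zero          = solve 1 (λ e → con (+ 2) :+ (:- e) :* con (+ 0) :+ con (+ 0) := con (+ 2)) refl e
    terms (suc zero)    = solve 1 (λ e → e :+ (:- e) :* con (+ 2) :+ con (+ 0) := :- e) refl e
    terms (suc (suc k)) = solve 3 (λ e d₁ d₀ → (e :* d₁ :- d₀) :+ (:- e) :* d₁ :+ d₀ := con (+ 0)) refl e (D (suc k) e) (D k e)

  -- The operator N - z d/dz on power series.
  weighted : Carrier → Sequence → Sequence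
  weighted N s k = (N + - fromℕ k) * s k

  -- The product rule. For q = 1 - e z + z² one has 2 q - z q′ = 2 - e z, the numerator, so (N + 2)
  -- q s - z (q s)′ = (2 - e z) s + q (N s - z s′).
  weighted-factor : ∀ e N s →
    (λ k → (numerator e ▷ s) k + (factor e ▷ weighted N s) k) ≋ weighted (N + fromℤ (+ 2)) (factor e ▷ s)
  weighted-factor e N s k = trans
    (+-cong (numerator-▷ e s k) (factor-▷ e (weighted N s) k))
    (trans (terms k) (*-congˡ (sym (factor-▷ e s k))))
    where
    terms : ∀ k →
      (fromℤ (+ 2) * s k + - e * shift s k) +
      (weighted N s k + - e * shift (weighted N s) k + shift (shift (weighted N s)) k) ≈
      (N + fromℤ (+ 2) + - fromℕ k) * (s k + - e * shift s k + shift (shift s) k)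
    terms zero          = solve 3 (λ e n s →
      (con (+ 2) :* s :+ (:- e) :* con (+ 0)) :+ ((n :+ :- con (+ 0)) :* s :+ (:- e) :* con (+ 0) :+ con (+ 0)) :=
      (n :+ con (+ 2) :+ :- con (+ 0)) :* (s :+ (:- e) :* con (+ 0) :+ con (+ 0))) refl e N (s 0)
    terms (suc zero)    = solve 4 (λ e n s t →
      (con (+ 2) :* s :+ (:- e) :* t) :+ ((n :+ :- con (+ 1)) :* s :+ (:- e) :* ((n :+ :- con (+ 0)) :* t) :+ con (+ 0)) :=
      (n :+ con (+ 2) :+ :- con (+ 1)) :* (s :+ (:- e) :* t :+ con (+ 0))) refl e N (s 1) (s 0)
    terms (suc (suc k)) = begin
      (fromℤ (+ 2) * s₂ + - e * s₁) + ((N + - fromℕ (suc (suc k))) * s₂ + - e * ((N + - fromℕ (suc k)) * s₁) + (N + - fromℕ k) * s₀)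
        ≈⟨ +-congˡ (+-congʳ (+-cong (*-congʳ (+-congˡ (-‿cong k+2))) (*-congˡ (*-congʳ (+-congˡ (-‿cong k+1)))))) ⟩
      (fromℤ (+ 2) * s₂ + - e * s₁) + ((N + - (1# + (1# + fromℕ k))) * s₂ + - e * ((N + - (1# + fromℕ k)) * s₁) + (N + - fromℕ k) * s₀)
        ≈⟨ solve 6 (λ e n k s₂ s₁ s₀ →
             (con (+ 2) :* s₂ :+ (:- e) :* s₁) :+ ((n :+ :- (con (+ 1) :+ (con (+ 1) :+ k))) :* s₂ :+
               (:- e) :* ((n :+ :- (con (+ 1) :+ k)) :* s₁) :+ (n :+ :- k) :* s₀) :=
             (n :+ con (+ 2) :+ :- (con (+ 1) :+ (con (+ 1) :+ k))) :* (s₂ :+ (:- e) :* s₁ :+ s₀)) refl e N (fromℕ k) s₂ s₁ s₀ ⟩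
      (N + fromℤ (+ 2) + - (1# + (1# + fromℕ k))) * (s₂ + - e * s₁ + s₀)
        ≈⟨ *-congʳ (+-congˡ (-‿cong k+2)) ⟨
      (N + fromℤ (+ 2) + - fromℕ (suc (suc k))) * (s₂ + - e * s₁ + s₀) ∎
      where
      s₂ = s (suc (suc k))
      s₁ = s (suc k)
      s₀ = s k
      k+1 : fromℕ (suc k) ≈ 1# + fromℕ k
      k+1 = 1+× k 1#
      k+2 : fromℕ (suc (suc k)) ≈ 1# + (1# + fromℕ k)
      k+2 = trans (1+× (suc k) 1#) (+-congˡ k+1)

  powerSum : ∀ {n} → Vector Carrier n → Sequence
  powerSum e k = sum λ i → D k (e i)

  -- With P = Π (1 - eᵢ z + z²), logarithmic differentiation gives P Σₖ Sₖ zᵏ = 2n P - z P′.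
  newton : ∀ {n} (e : Vector Carrier n) → ∃ λ N →
    product (factor ∘ e) ▷ powerSum e ≋ weighted N (coeff (product (factor ∘ e)))
  newton {zero} e = 0# , λ k → trans (▷-zero R[X].1# k) (terms k)
    where
    terms : ∀ k → 0# ≈ weighted 0# (coeff R[X].1#) k
    terms zero    = solve 0 (con (+ 0) := (con (+ 0) :+ :- con (+ 0)) :* con (+ 1)) refl
    terms (suc k) = sym (zeroʳ _)
  newton {suc n} e = N + fromℤ (+ 2) , λ k → begin
    ((q R[X].* p) ▷ powerSum e) k
      ≈⟨ ▷-+ʳ (q R[X].* p) (λ k → D k (e zero)) (powerSum (e ∘ suc)) k ⟩
    ((q R[X].* p) ▷ (λ k → D k (e zero))) k + ((q R[X].* p) ▷ powerSum (e ∘ suc)) k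
      ≈⟨ +-cong (first k) (second k) ⟩
    (numerator (e zero) ▷ coeff p) k + (q ▷ weighted N (coeff p)) k
      ≈⟨ weighted-factor (e zero) N (coeff p) k ⟩
    weighted (N + fromℤ (+ 2)) (q ▷ coeff p) k
      ≈⟨ *-congˡ (coeff-* q p k) ⟨
    weighted (N + fromℤ (+ 2)) (coeff (q R[X].* p)) k ∎
    where
    q = factor (e zero)
    p = product (factor ∘ e ∘ suc)
    N = proj₁ (newton (e ∘ suc))
    first : (q R[X].* p) ▷ (λ k → D k (e zero)) ≋ numerator (e zero) ▷ coeff p
    first k = begin
      ((q R[X].* p) ▷ (λ k → D k (e zero))) k   ≈⟨ ▷-congˡ (q R[X].* p) (p R[X].* q) _ (R[X].*-comm q p) k ⟩
      ((p R[X].* q) ▷ (λ k → D k (e zero))) k   ≈⟨ ▷-assoc p q _ k ⟩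
      (p ▷ q ▷ (λ k → D k (e zero))) k          ≈⟨ ▷-congʳ p (factor-▷-D (e zero)) k ⟩
      (p ▷ coeff (numerator (e zero))) k        ≈⟨ ▷-comm p (numerator (e zero)) k ⟩
      (numerator (e zero) ▷ coeff p) k          ∎
    second : (q R[X].* p) ▷ powerSum (e ∘ suc) ≋ q ▷ weighted N (coeff p)
    second k = trans (▷-assoc q p _ k) (▷-congʳ q (proj₂ (newton (e ∘ suc))) k)

  X^-▷ : ∀ n s k → k ℕ.< n → (X ^ n ▷ s) k ≈ 0#
  X^-▷ (suc n) s k k<n = trans (▷-assoc X (X ^ n) s k) (trans (X-▷ (X ^ n ▷ s) k) (shifted k k<n))
    where
    X-▷ : ∀ s → X ▷ s ≋ shift s
    X-▷ s k = trans (+-congʳ (zeroˡ _)) (trans (+-identityˡ _)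
      (shift-cong (λ j → trans (▷-const 1# s j) (*-identityˡ _)) k))
    shifted : ∀ k → k ℕ.< suc n → shift (X ^ n ▷ s) k ≈ 0#
    shifted zero    _         = refl
    shifted (suc k) (s≤s k<n) = X^-▷ n s k k<n

  module _ {n} (e : Vector Carrier n)
    (splits : (Dₚ n X R[X].- fromℤₚ (+ 2)) ≈ₚ product λ i → X R[X].+ R[X].- const (e i))
    where
    private P = product (factor ∘ e)

    -- P is 1 plus a multiple of zⁿ, so it acts as the identity on the terms below n.
    P-▷ : ∀ s k → k ℕ.< n → (P ▷ s) k ≈ s k
    P-▷ s k k<n = begin
      (P ▷ s) k
        ≈⟨ ▷-congˡ P (R[X].1# R[X].+ X ^ n R[X].* Y) s (product≈1+bⁿ (λ _ → refl) e splits) k ⟩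
      ((R[X].1# R[X].+ X ^ n R[X].* Y) ▷ s) k
        ≈⟨ ▷-+ˡ R[X].1# (X ^ n R[X].* Y) s k ⟩
      (R[X].1# ▷ s) k + ((X ^ n R[X].* Y) ▷ s) k
        ≈⟨ +-cong (trans (▷-const 1# s k) (*-identityˡ _)) (trans (▷-assoc (X ^ n) Y s k) (X^-▷ n (Y ▷ s) k k<n)) ⟩
      s k + 0#
        ≈⟨ +-identityʳ _ ⟩
      s k ∎
      where
      open Homogenization R polynomialRing const const-homomorphism (R[X].1# R[X].+ X R[X].* X) X
      Y = X ^ n R[X].- fromℤₚ (+ 2)

    -- Below degree n, P acts as 1 on the left of Newton's identity, and on the right its own
    -- coefficients of positive degree are 0.
    powerSum-vanishes : ∀ k → suc k ℕ.< n → powerSum e (suc k) ≈ 0#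
    powerSum-vanishes k k<n = begin
      powerSum e (suc k)                        ≈⟨ P-▷ (powerSum e) (suc k) k<n ⟨
      (P ▷ powerSum e) (suc k)                  ≈⟨ proj₂ (newton e) (suc k) ⟩
      (N + - fromℕ (suc k)) * coeff P (suc k)   ≈⟨ *-congˡ (trans (sym (▷-coeff-1 P (suc k))) (P-▷ (coeff R[X].1#) (suc k) k<n)) ⟩
      (N + - fromℕ (suc k)) * 0#                ≈⟨ zeroʳ _ ⟩
      0#                                        ∎
      where N = proj₁ (newton e)

-- The linear factors give roots of D n = 2.

module _ {r ρ} (R : CommutativeRing r ρ) where
  open CommutativeRing R hiding (zero; _-_)
  open IntegerCoefficients R using (fromℤ; module Solver)
  open Solver using (solve; _:+_; _:*_; _:=_; :-_; con)
  open PolynomialRing R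
  open Dickson R using (D)
  open Polynomial (CommutativeRing.rawRing R) using (X; const)
  private module R[X] = CommutativeRing polynomialRing
  open Dickson polynomialRing using () renaming (D to Dₚ)
  open IntegerCoefficients polynomialRing using () renaming (fromℤ to fromℤₚ)
  open RawMonoidDefs R[X].*-rawMonoid using () renaming (sum to product)
  open RingProperties ring using (-0#≈0#)
  open SetoidReasoning setoid

  evaluate-- : ∀ x p q → evaluate x (p R[X].- q) ≈ evaluate x p + - evaluate x q
  evaluate-- x p q = trans (evaluate-+ x p (R[X].- q)) (+-congˡ (evaluate-neg q))
    where
    evaluate-neg : ∀ p → evaluate x (R[X].- p) ≈ - evaluate x p
    evaluate-neg []      = sym -0#≈0#
    evaluate-neg (a ∷ p) = trans (+-congˡ (*-congˡ (evaluate-neg p)))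
      (solve 3 (λ a x p → (:- a) :+ x :* (:- p) := :- (a :+ x :* p)) refl a x _)

  evaluate-X : ∀ x → evaluate x X ≈ x
  evaluate-X x = solve 1 (λ x → con (+ 0) :+ x :* (con (+ 1) :+ x :* con (+ 0)) := x) refl x

  evaluate-const : ∀ x a → evaluate x (const a) ≈ a
  evaluate-const x a = trans (+-congˡ (zeroʳ x)) (+-identityʳ a)

  evaluate-D : ∀ x n → evaluate x (Dₚ n X) ≈ D n x
  evaluate-D x zero          = evaluate-const x (fromℤ (+ 2))
  evaluate-D x (suc zero)    = evaluate-X x
  evaluate-D x (suc (suc n)) = begin
    evaluate x (X R[X].* Dₚ (suc n) X R[X].- Dₚ n X)
      ≈⟨ evaluate-- x (X R[X].* Dₚ (suc n) X) (Dₚ n X) ⟩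
    evaluate x (X R[X].* Dₚ (suc n) X) + - evaluate x (Dₚ n X)
      ≈⟨ +-cong (evaluate-* x X (Dₚ (suc n) X)) (-‿cong (evaluate-D x n)) ⟩
    evaluate x X * evaluate x (Dₚ (suc n) X) + - D n x
      ≈⟨ +-congʳ (*-cong (evaluate-X x) (evaluate-D x (suc n))) ⟩
    x * D (suc n) x + - D n x ∎

  evaluate-product : ∀ {n} (e : Vector Carrier n) i →
    evaluate (e i) (product λ j → X R[X].+ R[X].- const (e j)) ≈ 0#
  evaluate-product e zero = begin
    evaluate x ((X R[X].+ R[X].- const x) R[X].* p)           ≈⟨ evaluate-* x (X R[X].+ R[X].- const x) p ⟩
    evaluate x (X R[X].+ R[X].- const x) * evaluate x p       ≈⟨ *-congʳ (evaluate-- x X (const x)) ⟩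
    (evaluate x X + - evaluate x (const x)) * evaluate x p    ≈⟨ *-congʳ (+-cong (evaluate-X x) (-‿cong (evaluate-const x x))) ⟩
    (x + - x) * evaluate x p                                  ≈⟨ *-congʳ (-‿inverseʳ x) ⟩
    0# * evaluate x p                                         ≈⟨ zeroˡ _ ⟩
    0#                                                        ∎
    where
    x = e zero
    p = product λ j → X R[X].+ R[X].- const (e (suc j))
  evaluate-product e (suc i) = begin
    evaluate x ((X R[X].+ R[X].- const (e zero)) R[X].* p)    ≈⟨ evaluate-* x (X R[X].+ R[X].- const (e zero)) p ⟩
    evaluate x (X R[X].+ R[X].- const (e zero)) * evaluate x p ≈⟨ *-congˡ (evaluate-product (e ∘ suc) i) ⟩
    evaluate x (X R[X].+ R[X].- const (e zero)) * 0#          ≈⟨ zeroʳ _ ⟩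
    0#                                                        ∎
    where
    x = e (suc i)
    p = product λ j → X R[X].+ R[X].- const (e (suc j))

  splitting-roots : ∀ {n} (e : Vector Carrier n) →
    (Dₚ n X R[X].- fromℤₚ (+ 2)) ≈ₚ (product λ i → X R[X].+ R[X].- const (e i)) →
    ∀ i → D n (e i) ≈ fromℤ (+ 2)
  splitting-roots {n} e splits i = begin
    D n x                                             ≈⟨ solve 1 (λ d → d := (d :+ :- con (+ 2)) :+ con (+ 2)) refl _ ⟩
    (D n x + - fromℤ (+ 2)) + fromℤ (+ 2)             ≈⟨ +-congʳ (+-cong (evaluate-D x n) (-‿cong (evaluate-const x (fromℤ (+ 2))))) ⟨
    (evaluate x (Dₚ n X) + - evaluate x (fromℤₚ (+ 2))) + fromℤ (+ 2)
      ≈⟨ +-congʳ (evaluate-- x (Dₚ n X) (fromℤₚ (+ 2))) ⟨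
    evaluate x (Dₚ n X R[X].- fromℤₚ (+ 2)) + fromℤ (+ 2)
      ≈⟨ +-congʳ (evaluate-cong x (Dₚ n X R[X].- fromℤₚ (+ 2)) (product λ i → X R[X].+ R[X].- const (e i)) splits) ⟩
    evaluate x (product λ i → X R[X].+ R[X].- const (e i)) + fromℤ (+ 2)
      ≈⟨ +-congʳ (evaluate-product e i) ⟩
    0# + fromℤ (+ 2)                                  ≈⟨ +-identityˡ _ ⟩
    fromℤ (+ 2)                                       ∎
    where x = e i

-- The condition that the annihilator imposes on the length of the cycle.

-- The coefficients of (D₈ - 2) (D₁₀ - 2) (D₁₂ - 2), by D j D k = D (j + k) + D (k - j).
annihilator : List (ℤ × ℕ)
annihilator =
  (+ 1 , 30) ∷ (ℤ.- + 2 , 22) ∷ (ℤ.- + 2 , 20) ∷ (ℤ.- + 2 , 18) ∷ (+ 1 , 14) ∷ (+ 4 , 12) ∷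
  (+ 5 , 10) ∷ (+ 4 , 8) ∷ (+ 1 , 6) ∷ (ℤ.- + 2 , 4) ∷ (ℤ.- + 4 , 2) ∷ (ℤ.- + 4 , 0) ∷ []

combination : List (ℤ × ℕ) → (ℕ → ℤ) → ℤ
combination []            s = + 0
combination ((c , k) ∷ l) s = c ℤ.* s k ℤ.+ combination l s

combination-cong : ∀ {l s t} → All (λ ck → s (proj₂ ck) ≡ t (proj₂ ck)) l → combination l s ≡ combination l t
combination-cong []                        = ≡.refl
combination-cong (_∷_ {c , k} s≡t all) = ≡.cong₂ (λ i j → c ℤ.* i ℤ.+ j) s≡t (combination-cong all)

-- The sum of D k over the eigenvalues of the cycle of length n.
cycleSum-residue : ℕ → ℕ → ℤ
cycleSum-residue n zero    = + (n ℕ.+ n)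
cycleSum-residue n (suc r) = + 0

cycleSum : ∀ n → .{{ℕ.NonZero n}} → ℕ → ℤ
cycleSum n k = cycleSum-residue n (k ℕ.% n)

-- The lengths 3, 4 and 6 pass as well: their eigenvalues are rational and satisfy the three-fold
-- equation too. They are excluded later by the degree of K.
admissible : List ℕ
admissible = 3 ∷ 4 ∷ 5 ∷ 6 ∷ 8 ∷ 10 ∷ 12 ∷ []

abstract
  -- Covers the lengths 3 to 30, those that do not exceed the top index 30 of the annihilator.
  admissible-small : ∀ (i : Fin 28) →
    combination annihilator (cycleSum (3 ℕ.+ toℕ i)) ≡ + 0 → 3 ℕ.+ toℕ i ∈ admissible
  admissible-small = toWitness {a? = Fin.all? λ i → (_ ℤ.≟ + 0) →-dec any? (_ ℕ.≟_) admissible} _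
-- Beyond length 30 the only index of the annihilator divisible by n is 0, and its term - 4 · 2n is
-- not zero.
admissible-large : ∀ m → 28 ℕ.≤ m → combination annihilator (cycleSum (3 ℕ.+ m)) ≢ + 0
admissible-large m 28≤m eq = nonzero (≡.trans (≡.sym (combination-cong (All.map (λ {ck} → small (proj₂ ck)) bounded))) eq)
  where
  first : ℕ → ℤ
  first zero    = + (3 ℕ.+ m ℕ.+ (3 ℕ.+ m))
  first (suc k) = + 0
  nonzero : combination annihilator first ≢ + 0
  nonzero ()
  bounded : All (λ ck → proj₂ ck ℕ.≤ 30) annihilator
  bounded = toWitness {a? = All.all? (λ ck → proj₂ ck ℕ.≤? 30) annihilator} _
  small : ∀ k → k ℕ.≤ 30 → cycleSum (3 ℕ.+ m) k ≡ first k
  small zero    _    = ≡.refl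
  small (suc k) k<30 rewrite ℕ.m<n⇒m%n≡m {n = 3 ℕ.+ m} {m = suc k} (s≤s (ℕ.≤-trans k<30 (s≤s (s≤s 28≤m)))) = ≡.refl

admissible-order : ∀ m → combination annihilator (cycleSum (3 ℕ.+ m)) ≡ + 0 → 3 ℕ.+ m ∈ admissible
admissible-order m eq with m ℕ.<? 28
... | yes m<28 = ≡.subst (λ k → 3 ℕ.+ k ∈ admissible) (Fin.toℕ-fromℕ< m<28) (admissible-small (fromℕ< m<28)
  (≡.subst (λ k → combination annihilator (cycleSum (3 ℕ.+ k)) ≡ + 0) (≡.sym (Fin.toℕ-fromℕ< m<28)) eq))
... | no m≮28  = contradiction eq (admissible-large m (ℕ.≮⇒≥ m≮28))

module CycleField (K : Extension) (quadratic : HasDegree K 2) where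
  open CommutativeRing (commutativeRing K) hiding (zero; _-_)
  open IntegerCoefficients (commutativeRing K) using (fromℤ; fromℤ-+; fromℤ-*; module Solver)
  open Solver using (solve; _:+_; _:*_; _:-_; _:=_; :-_; con)
  open QuadraticExtension K quadratic
  open TorsionBound K quadratic using (torsion-bound)
  open PolynomialRing (commutativeRing K)
  open Newton (commutativeRing K) using (powerSum; powerSum-vanishes)
  open Dickson (commutativeRing K)
  open Polynomial (CommutativeRing.rawRing (commutativeRing K)) using (X; const)
  private module R[X] = CommutativeRing polynomialRing
  open Dickson polynomialRing using () renaming (D to Dₚ)
  open IntegerCoefficients polynomialRing using () renaming (fromℤ to fromℤₚ)
  open RawMonoidDefs R[X].*-rawMonoid using () renaming (sum to product)
  open SetoidReasoning setoid

  combine-at : List (ℤ × ℕ) → Sequence → Carrier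
  combine-at []            s = 0#
  combine-at ((c , k) ∷ l) s = fromℤ c * s k + combine-at l s

  combine-at-+ : ∀ l s t → combine-at l (λ k → s k + t k) ≈ combine-at l s + combine-at l t
  combine-at-+ []            s t = sym (+-identityˡ 0#)
  combine-at-+ ((c , k) ∷ l) s t = trans (+-congˡ (combine-at-+ l s t))
    (solve 5 (λ c a b p q → c :* (a :+ b) :+ (p :+ q) := (c :* a :+ p) :+ (c :* b :+ q)) refl _ _ _ _ _)

  combine-at-cong : ∀ l {s t} → s ≋ t → combine-at l s ≈ combine-at l t
  combine-at-cong []            s≋t = refl
  combine-at-cong ((c , k) ∷ l) s≋t = +-cong (*-congˡ (s≋t k)) (combine-at-cong l s≋t)

  combine-at-fromℤ : ∀ l s → fromℤ (combination l s) ≈ combine-at l (fromℤ ∘ s)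
  combine-at-fromℤ []            s = refl
  combine-at-fromℤ ((c , k) ∷ l) s =
    trans (fromℤ-+ (c ℤ.* s k) (combination l s)) (+-cong (fromℤ-* c (s k)) (combine-at-fromℤ l s))

  combine-at-powerSum : ∀ l {n} (e : Vector Carrier n) →
    (∀ i → combine-at l (λ k → D k (e i)) ≈ 0#) → combine-at l (powerSum e) ≈ 0#
  combine-at-powerSum l {zero}  e _     = null l
    where
    null : ∀ l → combine-at l (λ _ → 0#) ≈ 0#
    null []            = refl
    null ((c , k) ∷ l) = trans (+-cong (zeroʳ _) (null l)) (+-identityˡ 0#)
  combine-at-powerSum l {suc n} e roots = begin
    combine-at l (λ k → D k (e zero) + powerSum (e ∘ suc) k)
      ≈⟨ combine-at-+ l (λ k → D k (e zero)) (powerSum (e ∘ suc)) ⟩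
    combine-at l (λ k → D k (e zero)) + combine-at l (powerSum (e ∘ suc))
      ≈⟨ +-cong (roots zero) (combine-at-powerSum l (e ∘ suc) (roots ∘ suc)) ⟩
    0# + 0#
      ≈⟨ +-identityˡ 0# ⟩
    0# ∎

  -- Stated for an abstract sequence that satisfies the five product formulas, so that the solver
  -- works with twelve unknowns and not with polynomials of degree 30 in x. The triple product is
  -- expanded as D 12 (D 18 + D 2).
  annihilator-product : ∀ s → s 0 ≈ fromℤ (+ 2) →
    s 8 * s 10 ≈ s 18 + s 2 → s 8 * s 12 ≈ s 20 + s 4 → s 10 * s 12 ≈ s 22 + s 2 →
    s 12 * s 18 ≈ s 30 + s 6 → s 2 * s 12 ≈ s 14 + s 10 →
    combine-at annihilator s ≈
      (s 8 + - fromℤ (+ 2)) * ((s 10 + - fromℤ (+ 2)) * (s 12 + - fromℤ (+ 2)))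
  annihilator-product s s₀ s₈s₁₀ s₈s₁₂ s₁₀s₁₂ s₁₂s₁₈ s₂s₁₂ = sym (begin
    (s 8 + - t) * ((s 10 + - t) * (s 12 + - t))
      ≈⟨ solve 3 (λ a b c → (a :+ :- con (+ 2)) :* ((b :+ :- con (+ 2)) :* (c :+ :- con (+ 2))) :=
           c :* (a :* b) :+ (con (ℤ.- + 2) :* (a :* b) :+ con (ℤ.- + 2) :* (a :* c) :+ con (ℤ.- + 2) :* (b :* c) :+
             con (+ 4) :* a :+ con (+ 4) :* b :+ con (+ 4) :* c :+ con (ℤ.- + 4) :* con (+ 2))) refl (s 8) (s 10) (s 12) ⟩
    s 12 * (s 8 * s 10) + (fromℤ (ℤ.- + 2) * (s 8 * s 10) + fromℤ (ℤ.- + 2) * (s 8 * s 12) +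
      fromℤ (ℤ.- + 2) * (s 10 * s 12) + fromℤ (+ 4) * s 8 + fromℤ (+ 4) * s 10 + fromℤ (+ 4) * s 12 + fromℤ (ℤ.- + 4) * t)
      ≈⟨ +-cong (trans (*-congˡ s₈s₁₀) (trans (distribˡ _ _ _) (+-cong s₁₂s₁₈ (trans (*-comm _ _) s₂s₁₂))))
           (+-cong (+-congʳ (+-congʳ (+-congʳ (+-cong (+-cong (*-congˡ s₈s₁₀) (*-congˡ s₈s₁₂)) (*-congˡ s₁₀s₁₂))))) (*-congˡ (sym s₀))) ⟩
    ((s 30 + s 6) + (s 14 + s 10)) + (fromℤ (ℤ.- + 2) * (s 18 + s 2) + fromℤ (ℤ.- + 2) * (s 20 + s 4) +
      fromℤ (ℤ.- + 2) * (s 22 + s 2) + fromℤ (+ 4) * s 8 + fromℤ (+ 4) * s 10 + fromℤ (+ 4) * s 12 + fromℤ (ℤ.- + 4) * s 0)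
      ≈⟨ solve 12 (λ d₃₀ d₂₂ d₂₀ d₁₈ d₁₄ d₁₂ d₁₀ d₈ d₆ d₄ d₂ d₀ →
           ((d₃₀ :+ d₆) :+ (d₁₄ :+ d₁₀)) :+ (con (ℤ.- + 2) :* (d₁₈ :+ d₂) :+ con (ℤ.- + 2) :* (d₂₀ :+ d₄) :+
             con (ℤ.- + 2) :* (d₂₂ :+ d₂) :+ con (+ 4) :* d₈ :+ con (+ 4) :* d₁₀ :+ con (+ 4) :* d₁₂ :+ con (ℤ.- + 4) :* d₀) :=
           con (+ 1) :* d₃₀ :+ (con (ℤ.- + 2) :* d₂₂ :+ (con (ℤ.- + 2) :* d₂₀ :+ (con (ℤ.- + 2) :* d₁₈ :+ (con (+ 1) :* d₁₄ :+
             (con (+ 4) :* d₁₂ :+ (con (+ 5) :* d₁₀ :+ (con (+ 4) :* d₈ :+ (con (+ 1) :* d₆ :+ (con (ℤ.- + 2) :* d₄ :+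
             (con (ℤ.- + 4) :* d₂ :+ (con (ℤ.- + 4) :* d₀ :+ con (+ 0)))))))))))))
           refl (s 30) (s 22) (s 20) (s 18) (s 14) (s 12) (s 10) (s 8) (s 6) (s 4) (s 2) (s 0) ⟩
    combine-at annihilator s ∎)
    where t = fromℤ (+ 2)

  annihilator-D : ∀ x → combine-at annihilator (λ k → D k x) ≈
    (D 8 x + - fromℤ (+ 2)) * ((D 10 x + - fromℤ (+ 2)) * (D 12 x + - fromℤ (+ 2)))
  annihilator-D x = annihilator-product (λ k → D k x) refl
    (D-* 8 2 x) (D-* 8 4 x) (D-* 10 2 x) (D-* 12 6 x) (D-* 2 10 x)

  annihilator-root : ∀ x {m} → m ∈ Dickson₈.orders → D m x ≈ fromℤ (+ 2) →
    combine-at annihilator (λ k → D k x) ≈ 0#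
  annihilator-root x m∈ Dm≈2 = trans (annihilator-D x) (vanish m∈ (trans (+-congʳ Dm≈2) (-‿inverseʳ _)))
    where
    vanish : ∀ {m} → m ∈ Dickson₈.orders → D m x + - fromℤ (+ 2) ≈ 0# →
      (D 8 x + - fromℤ (+ 2)) * ((D 10 x + - fromℤ (+ 2)) * (D 12 x + - fromℤ (+ 2))) ≈ 0#
    vanish (here ≡.refl)                 eq = trans (*-congʳ eq) (zeroˡ _)
    vanish (there (here ≡.refl))         eq = trans (*-congˡ (trans (*-congʳ eq) (zeroˡ _))) (zeroʳ _)
    vanish (there (there (here ≡.refl))) eq = trans (*-congˡ (trans (*-congˡ eq) (zeroʳ _))) (zeroʳ _)

  powerSum-period : ∀ {l} n (e : Vector Carrier l) → (∀ i → D n (e i) ≈ fromℤ (+ 2)) →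
    ∀ k → powerSum e (k ℕ.+ n) ≈ powerSum e k
  powerSum-period {zero}  n e roots k = refl
  powerSum-period {suc l} n e roots k =
    +-cong (D-period reduced {e zero} {n} (roots zero) k) (powerSum-period n (e ∘ suc) (roots ∘ suc) k)

  powerSum-0 : ∀ {l} (e : Vector Carrier l) → powerSum e 0 ≈ fromℤ (+ (l ℕ.+ l))
  powerSum-0 {zero}  e = refl
  powerSum-0 {suc l} e = begin
    fromℤ (+ 2) + powerSum (e ∘ suc) 0   ≈⟨ +-congˡ (powerSum-0 (e ∘ suc)) ⟩
    fromℤ (+ 2) + fromℤ (+ (l ℕ.+ l))    ≈⟨ fromℤ-+ (+ 2) (+ (l ℕ.+ l)) ⟨
    fromℤ (+ (2 ℕ.+ (l ℕ.+ l)))          ≡⟨ ≡.cong (λ k → fromℤ (+ suc k)) (ℕ.+-suc l l) ⟨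
    fromℤ (+ (suc l ℕ.+ suc l))          ∎

  module _ {m} (e : Vector Carrier (3 ℕ.+ m))
    (splits : (Dₚ (3 ℕ.+ m) X R[X].- fromℤₚ (+ 2)) ≈ₚ (product λ i → X R[X].+ R[X].- const (e i)))
    where
    private
      n = 3 ℕ.+ m
      roots = splitting-roots (commutativeRing K) e splits

    powerSum-cycleSum : powerSum e ≋ λ k → fromℤ (cycleSum n k)
    powerSum-cycleSum k = begin
      powerSum e k                                    ≡⟨ ≡.cong (powerSum e) (ℕ.m≡m%n+[m/n]*n k n) ⟩
      powerSum e (k ℕ.% n ℕ.+ k ℕ./ n ℕ.* n)          ≈⟨ multiples (k ℕ.% n) (k ℕ./ n) ⟩
      powerSum e (k ℕ.% n)                            ≈⟨ residues (k ℕ.% n) (ℕ.m%n<n k n) ⟩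
      fromℤ (cycleSum-residue n (k ℕ.% n))            ∎
      where
      multiples : ∀ r q → powerSum e (r ℕ.+ q ℕ.* n) ≈ powerSum e r
      multiples r zero    = reflexive (≡.cong (powerSum e) (ℕ.+-identityʳ r))
      multiples r (suc q) = begin
        powerSum e (r ℕ.+ (n ℕ.+ q ℕ.* n))   ≡⟨ ≡.cong (powerSum e) index ⟩
        powerSum e (r ℕ.+ q ℕ.* n ℕ.+ n)     ≈⟨ powerSum-period n e roots (r ℕ.+ q ℕ.* n) ⟩
        powerSum e (r ℕ.+ q ℕ.* n)           ≈⟨ multiples r q ⟩
        powerSum e r                         ∎
        where
        index : r ℕ.+ (n ℕ.+ q ℕ.* n) ≡ r ℕ.+ q ℕ.* n ℕ.+ n
        index = ≡.trans (≡.cong (r ℕ.+_) (ℕ.+-comm n _)) (≡.sym (ℕ.+-assoc r _ _))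
      residues : ∀ r → r ℕ.< n → powerSum e r ≈ fromℤ (cycleSum-residue n r)
      residues zero    _   = powerSum-0 e
      residues (suc r) r<n = powerSum-vanishes e splits r r<n

    splitting-admissible : n ∈ admissible
    splitting-admissible = admissible-order m (fromℤ-injective (begin
      fromℤ (combination annihilator (cycleSum n))
        ≈⟨ combine-at-fromℤ annihilator (cycleSum n) ⟩
      combine-at annihilator (fromℤ ∘ cycleSum n)
        ≈⟨ combine-at-cong annihilator powerSum-cycleSum ⟨
      combine-at annihilator (powerSum e)
        ≈⟨ combine-at-powerSum annihilator e (λ i →
             let k , k∈ , Dk≈2 = torsion-bound (e i) (2 ℕ.+ m) (roots i) in annihilator-root (e i) k∈ Dk≈2) ⟩
      0# ∎))

-- Lengths 3, 4 and 6: rational eigenvalues.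

module RationalElements (K : Extension) (quadratic : HasDegree K 2) where
  open Extension K using (ι)
  open CommutativeRing (commutativeRing K) hiding (zero)
  open IntegerCoefficients (commutativeRing K) using (fromℤ; module Solver)
  open Solver using (solve; _:+_; _:*_; _:-_; _:=_; :-_; con)
  open QuadraticExtension K quadratic
  open Dickson (commutativeRing K)
  open SetoidReasoning setoid

  Rational : Carrier → Set
  Rational x = ∃ λ q → x ≈ ι q

  -- Serves to contradict the minimality of the splitting field: were all eigenvalues rational,
  -- every element of K would be.
  rationals : Subfield K
  rationals = record
    { Member     = Rational
    ; resp       = λ { x≈y (q , x≈q) → q , trans (sym x≈y) x≈q }
    ; 0-closed   = 0ℚ , sym ι-0
    ; 1-closed   = 1ℚ , sym ι-1
    ; +-closed   = λ { (p , x≈p) (q , y≈q) → p ℚ.+ q , trans (+-cong x≈p y≈q) (sym (ι-+ p q)) }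
    ; *-closed   = λ { (p , x≈p) (q , y≈q) → p ℚ.* q , trans (*-cong x≈p y≈q) (sym (ι-* p q)) }
    ; neg-closed = λ { (q , x≈q) → ℚ.- q , trans (-‿cong x≈q) (sym (ι-neg q)) }
    ; inv-closed = λ { xy≈1 (q , x≈q) → inverse q (trans (*-congʳ (sym x≈q)) xy≈1) (q ℚ.≟ 0ℚ) }
    }
    where
    inverse : ∀ q {y} → ι q * y ≈ 1# → Dec (q ≡ 0ℚ) → Rational y
    inverse q {y} qy≈1 (yes ≡.refl) = contradiction (begin
      1#         ≈⟨ qy≈1 ⟨
      ι 0ℚ * y   ≈⟨ *-congʳ ι-0 ⟩
      0# * y     ≈⟨ zeroˡ y ⟩
      0#         ∎) 1≉0
    inverse q {y} qy≈1 (no q≢0) = q⁻¹ , (begin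
      y                    ≈⟨ *-identityˡ y ⟨
      1# * y               ≈⟨ *-congʳ ι-1 ⟨
      ι 1ℚ * y             ≈⟨ *-congʳ (≡⇒ι (ℚ.*-inverseˡ q)) ⟨
      ι (q⁻¹ ℚ.* q) * y    ≈⟨ trans (*-congʳ (ι-* q⁻¹ q)) (*-assoc _ _ _) ⟩
      ι q⁻¹ * (ι q * y)    ≈⟨ trans (*-congˡ qy≈1) (*-identityʳ _) ⟩
      ι q⁻¹                ∎)
      where
      instance
        q-nonZero : ℚ.NonZero q
        q-nonZero = ℚ.≢-nonZero q≢0
      q⁻¹ = ℚ.1/ q

  -- If b₀ = p and b₁ = q are rational, then q b₀ - p b₁ = 0 forces p = 0, so b₀ itself would
  -- vanish.
  not-all-rational : ¬ (∀ x → Rational x)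
  not-all-rational all = 1≢0 (proj₁ (combine-null 1ℚ 0ℚ (begin
      ι 1ℚ * b₀ + ι 0ℚ * b₁   ≈⟨ +-cong (*-congˡ (trans b₀≈p (trans (≡⇒ι p≡0) ι-0))) (*-congʳ ι-0) ⟩
      ι 1ℚ * 0# + 0# * b₁     ≈⟨ +-cong (zeroʳ _) (zeroˡ _) ⟩
      0# + 0#                 ≈⟨ +-identityˡ 0# ⟩
      0#                      ∎)))
    where
    b₀ = proj₁ quadratic zero
    b₁ = proj₁ quadratic (suc zero)
    p = proj₁ (all b₀)
    q = proj₁ (all b₁)
    b₀≈p = proj₂ (all b₀)
    b₁≈q = proj₂ (all b₁)
    1≢0 : 1ℚ ≢ 0ℚ
    1≢0 ()
    dependence : combine q (ℚ.- p) ≈ 0#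
    dependence = begin
      ι q * b₀ + ι (ℚ.- p) * b₁    ≈⟨ +-cong (*-congˡ b₀≈p) (*-cong (ι-neg p) b₁≈q) ⟩
      ι q * ι p + - ι p * ι q      ≈⟨ solve 2 (λ p q → q :* p :+ (:- p) :* q := con (+ 0)) refl (ι p) (ι q) ⟩
      0#                           ∎
    p≡0 : p ≡ 0ℚ
    p≡0 = ℚ.neg-injective {p} {0ℚ} (proj₂ (combine-null q (ℚ.- p) dependence))

  rational-fromℤ : ∀ {x} i → x - fromℤ i ≈ 0# → Rational x
  rational-fromℤ {x} i eq = _ , (begin
    x                        ≈⟨ solve 2 (λ x i → x := (x :- i) :+ i) refl x (fromℤ i) ⟩
    (x - fromℤ i) + fromℤ i  ≈⟨ trans (+-congʳ eq) (+-identityˡ _) ⟩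
    fromℤ i                  ≈⟨ ι-int i ⟨
    ι _                      ∎)

  linear-factor : ∀ {x y} i → (x - fromℤ i) * y ≈ 0# → Rational x ⊎ y ≈ 0#
  linear-factor {x} {y} i eq = Sum.map₁ (rational-fromℤ i) (integral-domain {x - fromℤ i} {y} eq)

  square-factor : ∀ {x y} i → ((x - fromℤ i) * (x - fromℤ i)) * y ≈ 0# → Rational x ⊎ y ≈ 0#
  square-factor {x} {y} i eq =
    Sum.map₁ (rational-fromℤ i ∘ reduced (x - fromℤ i)) (integral-domain {(x - fromℤ i) * (x - fromℤ i)} {y} eq)

  _or_ : ∀ {x y} → Rational x ⊎ y ≈ 0# → (y ≈ 0# → Rational x) → Rational x
  inj₁ x∈ℚ or _ = x∈ℚ
  inj₂ y≈0 or f = f y≈0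

  infixr 2 _or_

  contradictory : ∀ {x} → 1# ≈ 0# → Rational x
  contradictory 1≈0 = contradiction 1≈0 1≉0

  D₄-factors : ∀ x → D 4 x - fromℤ (+ 2) ≈
    (x - fromℤ (+ 2)) * ((x - fromℤ (ℤ.- + 2)) * (((x - fromℤ (+ 0)) * (x - fromℤ (+ 0))) * 1#))
  D₄-factors = solve 1 (λ x →
    (x :* (x :* (x :* x :- con (+ 2)) :- x) :- (x :* x :- con (+ 2))) :- con (+ 2) :=
    (x :- con (+ 2)) :* ((x :- con (ℤ.- + 2)) :* (((x :- con (+ 0)) :* (x :- con (+ 0))) :* con (+ 1)))) refl

  D₆-factors : ∀ x → D 6 x - fromℤ (+ 2) ≈
    (x - fromℤ (+ 2)) * ((x - fromℤ (ℤ.- + 2)) *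
      (((x - fromℤ (+ 1)) * (x - fromℤ (+ 1))) * (((x - fromℤ (ℤ.- + 1)) * (x - fromℤ (ℤ.- + 1))) * 1#)))
  D₆-factors = solve 1 (λ x →
    let d₂ = x :* x :- con (+ 2); d₃ = x :* d₂ :- x; d₄ = x :* d₃ :- d₂; d₅ = x :* d₄ :- d₃; d₆ = x :* d₅ :- d₄ in
    d₆ :- con (+ 2) :=
    (x :- con (+ 2)) :* ((x :- con (ℤ.- + 2)) :*
      (((x :- con (+ 1)) :* (x :- con (+ 1))) :* (((x :- con (ℤ.- + 1)) :* (x :- con (ℤ.- + 1))) :* con (+ 1))))) refl

  D₄-roots : ∀ x → D 4 x ≈ fromℤ (+ 2) → Rational x
  D₄-roots x D₄≈2 =
    linear-factor (+ 2) (trans (sym (D₄-factors x)) (trans (+-congʳ D₄≈2) (-‿inverseʳ _))) or λ eq →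
    linear-factor (ℤ.- + 2) eq or λ eq →
    square-factor (+ 0) eq or contradictory

  D₆-roots : ∀ x → D 6 x ≈ fromℤ (+ 2) → Rational x
  D₆-roots x D₆≈2 =
    linear-factor (+ 2) (trans (sym (D₆-factors x)) (trans (+-congʳ D₆≈2) (-‿inverseʳ _))) or λ eq →
    linear-factor (ℤ.- + 2) eq or λ eq →
    square-factor (+ 1) eq or λ eq →
    square-factor (ℤ.- + 1) eq or contradictory

twoIntegralOrders : List ℕ
twoIntegralOrders = 5 ∷ 8 ∷ 10 ∷ 12 ∷ []

cycle⇒order : ∀ n (3≤n : 3 ℕ.≤ n) → TwoIntegral (Cycle n 3≤n) → n ∈ twoIntegralOrders
cycle⇒order (suc (suc (suc m))) 3≤n@(s≤s (s≤s (s≤s _))) (K , splitting , quadratic) = exclude (splitting-admissible eigenvalue splits)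
  where
  open CommutativeRing (commutativeRing K) using (_≈_; trans; sym)
  open IntegerCoefficients (commutativeRing K) using (fromℤ)
  open Dickson (commutativeRing K)
  open IsSplittingField splitting using (eigenvalue; smallest)
  open CycleField K quadratic
  open RationalElements K quadratic
  splits = λ k → trans (sym (charPoly-Cycle (commutativeRing K) (3 ℕ.+ m) 3≤n k)) (IsSplittingField.splits splitting k)
  roots : ∀ i → D (3 ℕ.+ m) (eigenvalue i) ≈ fromℤ (+ 2)
  roots = splitting-roots (commutativeRing K) eigenvalue splits
  irrational : ∀ {A : Set} → (∀ x → D (3 ℕ.+ m) x ≈ fromℤ (+ 2) → Rational x) → A
  irrational rational = contradiction (smallest rationals λ i → rational (eigenvalue i) (roots i)) not-all-rational
  exclude : 3 ℕ.+ m ∈ admissible → 3 ℕ.+ m ∈ twoIntegralOrders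
  -- D 6 = D 2 ∘ D 3 and D 2 2 = 2, so the roots for length 3 are among those for length 6.
  exclude (here ≡.refl)                                 = irrational λ x D₃≈2 →
    D₆-roots x (trans (sym (D-∘ 2 3 x)) (trans (D-cong 2 D₃≈2) (D-2 2)))
  exclude (there (here ≡.refl))                         = irrational D₄-roots
  exclude (there (there (here eq)))                     = here eq
  exclude (there (there (there (here ≡.refl))))         = irrational D₆-roots
  exclude (there (there (there (there n∈))))            = there n∈

-- Explicit splittings over ℚ(√5), ℚ(√2) and ℚ(√3).

module _ {r ρ s σ} (R : CommutativeRing r ρ) (S : CommutativeRing s σ)
  {φ : CommutativeRing.Carrier R → CommutativeRing.Carrier S}
  (φ-homomorphism : RingMorphisms.IsRingHomomorphism (CommutativeRing.rawRing R) (CommutativeRing.rawRing S) φ)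
  where
  private
    module R = IntegerCoefficients R
    module S = IntegerCoefficients S
    module φ = RingMorphisms.IsRingHomomorphism φ-homomorphism
    module R× = Multiples (CommutativeRing.semiring R)
    module S× = Multiples (CommutativeRing.semiring S)
  open CommutativeRing S hiding (zero)

  fromℕ-homo : ∀ n → φ (R.fromℕ n) ≈ S.fromℕ n
  fromℕ-homo zero    = φ.0#-homo
  fromℕ-homo (suc n) = trans (φ.⟦⟧-cong (R×.1+× n (CommutativeRing.1# R)))
    (trans (φ.+-homo _ _) (trans (+-cong φ.1#-homo (fromℕ-homo n)) (sym (S×.1+× n 1#))))

  fromℤ-homo : ∀ i → φ (R.fromℤ i) ≈ S.fromℤ i
  fromℤ-homo (+ n)    = fromℕ-homo n
  fromℤ-homo -[1+ n ] = trans (φ.-‿homo _) (-‿cong (fromℕ-homo (suc n)))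

-- A general quadratic relation takes the place of a square root: for the golden ratio, with s = t =
-- 1, the eigenvalues of the cycles of length 5 and 10 have integer coordinates.
module QuadraticRing {r ρ} (R : CommutativeRing r ρ) (s t : CommutativeRing.Carrier R) where
  open CommutativeRing R
  open IntegerCoefficients R using (fromℤ; module Solver)
  open Solver using (solve; _:+_; _:*_; _:-_; _:=_; :-_; con)

  -- (a , b) stands for a + b θ, where θ² = s θ + t.
  quadraticRing : CommutativeRing r ρ
  quadraticRing = record
    { Carrier = Carrier × Carrier
    ; _≈_     = λ { (a , b) (c , d) → a ≈ c × b ≈ d }
    ; _+_     = λ { (a , b) (c , d) → a + c , b + d }
    ; _*_     = λ { (a , b) (c , d) → a * c + t * (b * d) , a * d + b * c + s * (b * d) }
    ; -_      = λ { (a , b) → - a , - b }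
    ; 0#      = 0# , 0#
    ; 1#      = 1# , 0#
    ; isCommutativeRing = record
      { isRing = record
        { +-isAbelianGroup = record
          { isGroup = record
            { isMonoid = record
              { isSemigroup = record
                { isMagma = record
                  { isEquivalence = record
                    { refl  = refl , refl
                    ; sym   = λ { (p , q) → sym p , sym q }
                    ; trans = λ { (p , q) (p′ , q′) → trans p p′ , trans q q′ }
                    }
                  ; ∙-cong = λ { (p , q) (p′ , q′) → +-cong p p′ , +-cong q q′ }
                  }
                ; assoc = λ x y z → +-assoc _ _ _ , +-assoc _ _ _
                }
              ; identity = (λ x → +-identityˡ _ , +-identityˡ _) , (λ x → +-identityʳ _ , +-identityʳ _)
              }
            ; inverse = (λ x → -‿inverseˡ _ , -‿inverseˡ _) , (λ x → -‿inverseʳ _ , -‿inverseʳ _)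
            ; ⁻¹-cong = λ { (p , q) → -‿cong p , -‿cong q }
            }
          ; comm = λ x y → +-comm _ _ , +-comm _ _
          }
        ; *-cong = λ { (p , q) (p′ , q′) →
            +-cong (*-cong p p′) (*-congˡ (*-cong q q′)) ,
            +-cong (+-cong (*-cong p q′) (*-cong q p′)) (*-congˡ (*-cong q q′)) }
        ; *-assoc = λ { (a , b) (c , d) (e , f) →
            solve 8 (λ a b c d e f s t →
              (a :* c :+ t :* (b :* d)) :* e :+ t :* ((a :* d :+ b :* c :+ s :* (b :* d)) :* f) :=
              a :* (c :* e :+ t :* (d :* f)) :+ t :* (b :* (c :* f :+ d :* e :+ s :* (d :* f)))) refl a b c d e f s t ,
            solve 8 (λ a b c d e f s t →
              (a :* c :+ t :* (b :* d)) :* f :+ (a :* d :+ b :* c :+ s :* (b :* d)) :* e :+ s :* ((a :* d :+ b :* c :+ s :* (b :* d)) :* f) :=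
              a :* (c :* f :+ d :* e :+ s :* (d :* f)) :+ b :* (c :* e :+ t :* (d :* f)) :+ s :* (b :* (c :* f :+ d :* e :+ s :* (d :* f))))
              refl a b c d e f s t }
        ; *-identity =
            (λ { (a , b) →
              solve 3 (λ a b t → con (+ 1) :* a :+ t :* (con (+ 0) :* b) := a) refl a b t ,
              solve 3 (λ a b s → con (+ 1) :* b :+ con (+ 0) :* a :+ s :* (con (+ 0) :* b) := b) refl a b s }) ,
            (λ { (a , b) →
              solve 3 (λ a b t → a :* con (+ 1) :+ t :* (b :* con (+ 0)) := a) refl a b t ,
              solve 3 (λ a b s → a :* con (+ 0) :+ b :* con (+ 1) :+ s :* (b :* con (+ 0)) := b) refl a b s })
        ; distrib =
            (λ { (a , b) (c , d) (e , f) →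
              solve 7 (λ a b c d e f t → a :* (c :+ e) :+ t :* (b :* (d :+ f)) :=
                (a :* c :+ t :* (b :* d)) :+ (a :* e :+ t :* (b :* f))) refl a b c d e f t ,
              solve 7 (λ a b c d e f s → a :* (d :+ f) :+ b :* (c :+ e) :+ s :* (b :* (d :+ f)) :=
                (a :* d :+ b :* c :+ s :* (b :* d)) :+ (a :* f :+ b :* e :+ s :* (b :* f))) refl a b c d e f s }) ,
            (λ { (a , b) (c , d) (e , f) →
              solve 7 (λ a b c d e f t → (c :+ e) :* a :+ t :* ((d :+ f) :* b) :=
                (c :* a :+ t :* (d :* b)) :+ (e :* a :+ t :* (f :* b))) refl a b c d e f t ,
              solve 7 (λ a b c d e f s → (c :+ e) :* b :+ (d :+ f) :* a :+ s :* ((d :+ f) :* b) :=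
                (c :* b :+ d :* a :+ s :* (d :* b)) :+ (e :* b :+ f :* a :+ s :* (f :* b))) refl a b c d e f s })
        }
      ; *-comm = λ { (a , b) (c , d) →
          solve 5 (λ a b c d t → a :* c :+ t :* (b :* d) := c :* a :+ t :* (d :* b)) refl a b c d t ,
          solve 5 (λ a b c d s → a :* d :+ b :* c :+ s :* (b :* d) := c :* b :+ d :* a :+ s :* (d :* b)) refl a b c d s }
      }
    }

  private module Q = CommutativeRing quadraticRing

  embed : Carrier → Carrier × Carrier
  embed a = a , 0#

  θ : Carrier × Carrier
  θ = 0# , 1#

  embed-homomorphism : RingMorphisms.IsRingHomomorphism rawRing Q.rawRing embed
  embed-homomorphism = record
    { isSemiringHomomorphism = record
      { isNearSemiringHomomorphism = record
        { +-isMonoidHomomorphism = record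
          { isMagmaHomomorphism = record
            { isRelHomomorphism = record { cong = λ a≈b → a≈b , refl }
            ; homo = λ a b → refl , sym (+-identityˡ 0#)
            }
          ; ε-homo = refl , refl
          }
        ; *-homo = λ a b →
            solve 3 (λ a b t → a :* b := a :* b :+ t :* (con (+ 0) :* con (+ 0))) refl a b t ,
            solve 3 (λ a b s → con (+ 0) := a :* con (+ 0) :+ con (+ 0) :* b :+ s :* (con (+ 0) :* con (+ 0))) refl a b s
        }
      ; 1#-homo = refl , refl
      }
    ; -‿homo = λ a → refl , solve 0 (con (+ 0) := :- con (+ 0)) refl
    }

  -- The shape of a linear combination of the basis (1 , θ).
  combination≈ : ∀ a b → embed a Q.* Q.1# Q.+ (embed b Q.* θ Q.+ Q.0#) Q.≈ (a , b)
  combination≈ a b =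
    solve 3 (λ a b t → (a :* con (+ 1) :+ t :* (con (+ 0) :* con (+ 0))) :+
      ((b :* con (+ 0) :+ t :* (con (+ 0) :* con (+ 1))) :+ con (+ 0)) := a) refl a b t ,
    solve 3 (λ a b s → (a :* con (+ 0) :+ con (+ 0) :* con (+ 1) :+ s :* (con (+ 0) :* con (+ 0))) :+
      ((b :* con (+ 1) :+ con (+ 0) :* con (+ 0) :+ s :* (con (+ 0) :* con (+ 1))) :+ con (+ 0)) := b) refl a b s

  θ² : θ Q.* θ Q.≈ (t , s)
  θ² = solve 1 (λ t → con (+ 0) :* con (+ 0) :+ t :* (con (+ 1) :* con (+ 1)) := t) refl t ,
       solve 1 (λ s → con (+ 0) :* con (+ 1) :+ con (+ 1) :* con (+ 0) :+ s :* (con (+ 1) :* con (+ 1)) := s) refl s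

  norm : Carrier × Carrier → Carrier
  norm (a , b) = a * a + s * (a * b) - t * (b * b)

  conjugate : Carrier × Carrier → Carrier × Carrier
  conjugate (a , b) = a + s * b , - b

  *-conjugate : ∀ x → x Q.* conjugate x Q.≈ embed (norm x)
  *-conjugate (a , b) =
    solve 4 (λ a b s t → a :* (a :+ s :* b) :+ t :* (b :* :- b) := a :* a :+ s :* (a :* b) :- t :* (b :* b)) refl a b s t ,
    solve 3 (λ a b s → a :* :- b :+ b :* (a :+ s :* b) :+ s :* (b :* :- b) := con (+ 0)) refl a b s

  -- Completing the square in the norm form: 4 N(a + b θ) = (2 a + s b)² - Δ b² with the
  -- discriminant Δ = s² + 4 t.
  complete-square : ∀ a b → let u = a + (a + s * b) in
    u * u ≈ (s * s + fromℤ (+ 4) * t) * (b * b) + fromℤ (+ 4) * norm (a , b)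
  complete-square a b = solve 4 (λ a b s t →
    (a :+ (a :+ s :* b)) :* (a :+ (a :+ s :* b)) :=
    (s :* s :+ con (+ 4) :* t) :* (b :* b) :+ con (+ 4) :* (a :* a :+ s :* (a :* b) :- t :* (b :* b))) refl a b s t

-- (a , b) stands for a + b θ, where θ is the golden ratio for n = 5 and n = 10, √2 for n = 8 and √3 for n = 12.
eigenvalues₅ : Vec (ℤ × ℤ) 5
eigenvalues₅ = (+ 2 , + 0) ∷ (ℤ.- + 1 , + 1) ∷ (+ 0 , ℤ.- + 1) ∷ (ℤ.- + 1 , + 1) ∷ (+ 0 , ℤ.- + 1) ∷ []

eigenvalues₈ : Vec (ℤ × ℤ) 8
eigenvalues₈ = (+ 2 , + 0) ∷ (ℤ.- + 2 , + 0) ∷ (+ 0 , + 0) ∷ (+ 0 , + 0) ∷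
  (+ 0 , + 1) ∷ (+ 0 , ℤ.- + 1) ∷ (+ 0 , + 1) ∷ (+ 0 , ℤ.- + 1) ∷ []

eigenvalues₁₀ : Vec (ℤ × ℤ) 10
eigenvalues₁₀ = (+ 2 , + 0) ∷ (ℤ.- + 2 , + 0) ∷
  (ℤ.- + 1 , + 1) ∷ (+ 0 , ℤ.- + 1) ∷ (ℤ.- + 1 , + 1) ∷ (+ 0 , ℤ.- + 1) ∷
  (+ 0 , + 1) ∷ (+ 1 , ℤ.- + 1) ∷ (+ 0 , + 1) ∷ (+ 1 , ℤ.- + 1) ∷ []

eigenvalues₁₂ : Vec (ℤ × ℤ) 12
eigenvalues₁₂ = (+ 2 , + 0) ∷ (ℤ.- + 2 , + 0) ∷ (+ 1 , + 0) ∷ (+ 1 , + 0) ∷ (ℤ.- + 1 , + 0) ∷ (ℤ.- + 1 , + 0) ∷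
  (+ 0 , + 0) ∷ (+ 0 , + 0) ∷ (+ 0 , + 1) ∷ (+ 0 , ℤ.- + 1) ∷ (+ 0 , + 1) ∷ (+ 0 , ℤ.- + 1) ∷ []

module Factorizations {r ρ} (P : CommutativeRing r ρ) (x θ : CommutativeRing.Carrier P) where
  open CommutativeRing P hiding (zero)
  open IntegerCoefficients P using (fromℤ; module Solver)
  open Solver using (solve; _:+_; _:*_; _:-_; _:=_; :-_; con)
  open Dickson P
  open RawMonoidDefs *-rawMonoid using () renaming (sum to product)
  open SetoidReasoning setoid

  linear : ℤ × ℤ → Carrier
  linear (a , b) = x - (fromℤ a + fromℤ b * θ)

  linears : ∀ {n} → Vec (ℤ × ℤ) n → Carrier
  linears []      = 1#
  linears (e ∷ v) = linear e * linears v

  linears-product : ∀ (f : ℤ × ℤ → Carrier) → (∀ a b → f (a , b) ≈ fromℤ a + fromℤ b * θ) →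
    ∀ {n} (v : Vec (ℤ × ℤ) n) → product (λ i → x + - f (lookup v i)) ≈ linears v
  linears-product f f≈ []            = refl
  linears-product f f≈ ((a , b) ∷ v) = *-cong (+-congˡ (-‿cong (f≈ a b))) (linears-product f f≈ v)

  integer-factor : ∀ a {p q} → p ≈ q → linear (a , + 0) * p ≈ (x - fromℤ a) * q
  integer-factor a p≈q = *-cong (solve 3 (λ x a θ → x :- (a :+ con (+ 0) :* θ) := x :- a) refl x (fromℤ a) θ) p≈q

  module _ (θ²≈ : θ * θ ≈ fromℤ (+ 1) + fromℤ (+ 1) * θ) where

    -- For θ the golden ratio, θ - 1 = 2 cos (2π/5) and - θ = 2 cos (4π/5) are the eigenvalues from
    -- the primitive fifth roots of unity.
    pair₁ : ∀ {p q} → p ≈ q → linear (ℤ.- + 1 , + 1) * (linear (+ 0 , ℤ.- + 1) * p) ≈ (x * x + x - 1#) * q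
    pair₁ {p} {q} p≈q = begin
      linear (ℤ.- + 1 , + 1) * (linear (+ 0 , ℤ.- + 1) * p)
        ≈⟨ solve 3 (λ x θ p →
             (x :- (con (ℤ.- + 1) :+ con (+ 1) :* θ)) :* ((x :- (con (+ 0) :+ con (ℤ.- + 1) :* θ)) :* p) :=
             (x :* x :+ x :- (θ :* θ :- θ)) :* p) refl x θ p ⟩
      (x * x + x - (θ * θ - θ)) * p
        ≈⟨ *-cong (+-congˡ (-‿cong (trans (+-congʳ θ²≈) (solve 1 (λ θ → (con (+ 1) :+ con (+ 1) :* θ) :- θ := con (+ 1)) refl θ)))) p≈q ⟩
      (x * x + x - 1#) * q ∎

    -- For θ the golden ratio, θ = 2 cos (π/5) and 1 - θ = 2 cos (3π/5) are the eigenvalues from the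
    -- primitive tenth roots of unity.
    pair₂ : ∀ {p q} → p ≈ q → linear (+ 0 , + 1) * (linear (+ 1 , ℤ.- + 1) * p) ≈ (x * x - x - 1#) * q
    pair₂ {p} {q} p≈q = begin
      linear (+ 0 , + 1) * (linear (+ 1 , ℤ.- + 1) * p)
        ≈⟨ solve 3 (λ x θ p →
             (x :- (con (+ 0) :+ con (+ 1) :* θ)) :* ((x :- (con (+ 1) :+ con (ℤ.- + 1) :* θ)) :* p) :=
             (x :* x :- x :- (θ :* θ :- θ)) :* p) refl x θ p ⟩
      (x * x - x - (θ * θ - θ)) * p
        ≈⟨ *-cong (+-congˡ (-‿cong (trans (+-congʳ θ²≈) (solve 1 (λ θ → (con (+ 1) :+ con (+ 1) :* θ) :- θ := con (+ 1)) refl θ)))) p≈q ⟩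
      (x * x - x - 1#) * q ∎

  conjugate-pair : ∀ {d} → θ * θ ≈ fromℤ d + fromℤ (+ 0) * θ → ∀ {p q} → p ≈ q →
    linear (+ 0 , + 1) * (linear (+ 0 , ℤ.- + 1) * p) ≈ (x * x - fromℤ d) * q
  conjugate-pair {d} θ²≈ {p} {q} p≈q = begin
    linear (+ 0 , + 1) * (linear (+ 0 , ℤ.- + 1) * p)
      ≈⟨ solve 3 (λ x θ p →
           (x :- (con (+ 0) :+ con (+ 1) :* θ)) :* ((x :- (con (+ 0) :+ con (ℤ.- + 1) :* θ)) :* p) :=
           (x :* x :- θ :* θ) :* p) refl x θ p ⟩
    (x * x - θ * θ) * p
      ≈⟨ *-cong (+-congˡ (-‿cong (trans θ²≈ (solve 2 (λ d θ → d :+ con (+ 0) :* θ := d) refl (fromℤ d) θ)))) p≈q ⟩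
    (x * x - fromℤ d) * q ∎

  splits₅ : θ * θ ≈ fromℤ (+ 1) + fromℤ (+ 1) * θ → D 5 x - fromℤ (+ 2) ≈ linears eigenvalues₅
  splits₅ θ²≈ = sym (trans (integer-factor (+ 2) (pair₁ θ²≈ (pair₁ θ²≈ refl)))
    (solve 1 (λ x →
      let d₂ = x :* x :- con (+ 2); d₃ = x :* d₂ :- x; d₄ = x :* d₃ :- d₂; q = x :* x :+ x :- con (+ 1) in
      (x :- con (+ 2)) :* (q :* (q :* con (+ 1))) := x :* d₄ :- d₃ :- con (+ 2)) refl x))

  -- The solver sees D 8 as D 2 ∘ D 4, that is as the square of D 4 minus 2; `D-∘` translates back.
  -- The lengths 10 and 12 are halved in the same way.
  splits₈ : θ * θ ≈ fromℤ (+ 2) + fromℤ (+ 0) * θ → D 8 x - fromℤ (+ 2) ≈ linears eigenvalues₈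
  splits₈ θ²≈ = sym (trans
    (integer-factor (+ 2) (integer-factor (ℤ.- + 2) (integer-factor (+ 0) (integer-factor (+ 0)
      (conjugate-pair {+ 2} θ²≈ (conjugate-pair {+ 2} θ²≈ refl))))))
    (trans (solve 1 (λ x →
      let d₂ = x :* x :- con (+ 2); d₃ = x :* d₂ :- x; d₄ = x :* d₃ :- d₂ in
      (x :- con (+ 2)) :* ((x :- con (ℤ.- + 2)) :* ((x :- con (+ 0)) :* ((x :- con (+ 0)) :* (d₂ :* (d₂ :* con (+ 1)))))) :=
      d₄ :* d₄ :- con (+ 2) :- con (+ 2)) refl x) (+-congʳ (D-∘ 2 4 x))))

  splits₁₀ : θ * θ ≈ fromℤ (+ 1) + fromℤ (+ 1) * θ → D 10 x - fromℤ (+ 2) ≈ linears eigenvalues₁₀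
  splits₁₀ θ²≈ = sym (trans
    (integer-factor (+ 2) (integer-factor (ℤ.- + 2) (pair₁ θ²≈ (pair₁ θ²≈ (pair₂ θ²≈ (pair₂ θ²≈ refl))))))
    (trans (solve 1 (λ x →
      let d₂ = x :* x :- con (+ 2); d₃ = x :* d₂ :- x; d₄ = x :* d₃ :- d₂; d₅ = x :* d₄ :- d₃
          p = x :* x :+ x :- con (+ 1); q = x :* x :- x :- con (+ 1) in
      (x :- con (+ 2)) :* ((x :- con (ℤ.- + 2)) :* (p :* (p :* (q :* (q :* con (+ 1)))))) :=
      d₅ :* d₅ :- con (+ 2) :- con (+ 2)) refl x) (+-congʳ (D-∘ 2 5 x))))

  splits₁₂ : θ * θ ≈ fromℤ (+ 3) + fromℤ (+ 0) * θ → D 12 x - fromℤ (+ 2) ≈ linears eigenvalues₁₂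
  splits₁₂ θ²≈ = sym (trans
    (integer-factor (+ 2) (integer-factor (ℤ.- + 2) (integer-factor (+ 1) (integer-factor (+ 1)
      (integer-factor (ℤ.- + 1) (integer-factor (ℤ.- + 1) (integer-factor (+ 0) (integer-factor (+ 0)
      (conjugate-pair {+ 3} θ²≈ (conjugate-pair {+ 3} θ²≈ refl))))))))))
    (trans (solve 1 (λ x →
      let d₂ = x :* x :- con (+ 2); d₃ = x :* d₂ :- x; d₄ = x :* d₃ :- d₂; d₅ = x :* d₄ :- d₃; d₆ = x :* d₅ :- d₄
          q = x :* x :- con (+ 3) in
      (x :- con (+ 2)) :* ((x :- con (ℤ.- + 2)) :* ((x :- con (+ 1)) :* ((x :- con (+ 1)) :*
        ((x :- con (ℤ.- + 1)) :* ((x :- con (ℤ.- + 1)) :* ((x :- con (+ 0)) :* ((x :- con (+ 0)) :* (q :* (q :* con (+ 1)))))))))) :=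
      d₆ :* d₆ :- con (+ 2) :- con (+ 2)) refl x) (+-congʳ (D-∘ 2 6 x))))

-- A decidable form: a square below 16 is the square of one of 0, 1, 2, 3. It suffices for the
-- discriminants 5, 8 and 12.
Nonsquare : ℕ → Set
Nonsquare d = d ℕ.< 16 × (∀ (i : Fin 4) → toℕ i ℕ.* toℕ i ≢ d)

nonsquare? : ∀ d → Dec (Nonsquare d)
nonsquare? d = (d ℕ.<? 16) ×-dec Fin.all? (λ i → ¬? (toℕ i ℕ.* toℕ i ℕ.≟ d))

nonsquare : ∀ {d} → Nonsquare d → ∀ i → i ℤ.* i ≢ + d
nonsquare {d} (d<16 , small) i eq with ℤ.∣ i ∣ ℕ.<? 4
... | yes i<4 = small (fromℕ< i<4) (≡.trans (≡.cong (λ k → k ℕ.* k) (Fin.toℕ-fromℕ< i<4))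
                  (≡.trans (≡.sym (ℤ.abs-* i i)) (≡.cong ℤ.∣_∣ eq)))
... | no i≮4  = ℕ.<⇒≱ d<16 (≡.subst (16 ℕ.≤_) (≡.trans (≡.sym (ℤ.abs-* i i)) (≡.cong ℤ.∣_∣ eq))
                  (ℕ.*-mono-≤ (ℕ.≮⇒≥ i≮4) (ℕ.≮⇒≥ i≮4)))

module _ where
  open Exp (CommutativeRing.semiring ℚ.+-*-commutativeRing) using (_^_)

  -- The denominator of q clears q^k for all k, because q^(k + 2) = d q^k.
  nonsquare-ℚ : ∀ {d} → Nonsquare d → ∀ q → q ℚ.* q ≢ int (+ d)
  nonsquare-ℚ {d} d-nonsquare q q²≡d =
    let i , q≡i = bounded-denominators⇒integer q (ℚ.↧ q) (λ ()) cleared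
    in nonsquare d-nonsquare i (int-injective (≡.trans (int-* i i) (≡.trans (≡.sym (≡.cong₂ ℚ._*_ q≡i q≡i)) q²≡d)))
    where
    cleared : ∀ k → IsInteger (int (ℚ.↧ q) ℚ.* q ^ k)
    cleared zero          = ℚ.↧ q , ℚ.*-identityʳ (int (ℚ.↧ q))
    cleared (suc zero)    = ℚ.↥ q , ≡.trans (≡.cong (int (ℚ.↧ q) ℚ.*_) (ℚ.*-identityʳ q))
      (≡.trans (ℚ.*-comm (int (ℚ.↧ q)) q) (q*↧≡↥ q))
    cleared (suc (suc k)) = ≡.subst IsInteger (begin
      int (+ d) ℚ.* (c ℚ.* p)     ≡⟨ ≡.cong (ℚ._* (c ℚ.* p)) q²≡d ⟨
      q ℚ.* q ℚ.* (c ℚ.* p)       ≡⟨ ℚ.*-assoc q q (c ℚ.* p) ⟩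
      q ℚ.* (q ℚ.* (c ℚ.* p))     ≡⟨ ≡.cong (q ℚ.*_) (left-comm q c p) ⟩
      q ℚ.* (c ℚ.* (q ℚ.* p))     ≡⟨ left-comm q c (q ℚ.* p) ⟩
      c ℚ.* (q ℚ.* (q ℚ.* p))     ∎) (integer-* (+ d , ≡.refl) (cleared k))
      where
      open ≡.≡-Reasoning
      c = int (ℚ.↧ q)
      p = q ^ k
      left-comm : ∀ x y z → x ℚ.* (y ℚ.* z) ≡ y ℚ.* (x ℚ.* z)
      left-comm x y z = ≡.trans (≡.sym (ℚ.*-assoc x y z)) (≡.trans (≡.cong (ℚ._* z) (ℚ.*-comm x y)) (ℚ.*-assoc y x z))

square-null : ∀ a → a ℚ.* a ≡ 0ℚ → a ≡ 0ℚ
square-null a eq with a ℚ.≟ 0ℚ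
... | yes a≡0 = a≡0
... | no a≢0  = ≡.trans (≡.sym (ℚ.*-identityˡ a)) (≡.trans (≡.cong (ℚ._* a) (≡.sym (ℚ.*-inverseˡ a)))
                  (≡.trans (ℚ.*-assoc (ℚ.1/ a) a a) (≡.trans (≡.cong (ℚ.1/ a ℚ.*_) eq) (ℚ.*-zeroʳ (ℚ.1/ a)))))
  where
  instance
    a-nonZero : ℚ.NonZero a
    a-nonZero = ℚ.≢-nonZero a≢0

module Anisotropic (s t : ℚ) {d} (d-nonsquare : Nonsquare d)
  (discriminant : s ℚ.* s ℚ.+ IntegerCoefficients.fromℤ ℚ.+-*-commutativeRing (+ 4) ℚ.* t ≡ int (+ d)) where
  open QuadraticRing ℚ.+-*-commutativeRing s t using (norm; complete-square)
  open IntegerCoefficients ℚ.+-*-commutativeRing using (fromℤ)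

  -- If the norm vanishes, then u² = d b² for u = 2 a + s b, and a nonzero b would make u / b a
  -- rational square root of d. With b = 0 the norm is a².
  anisotropic : ∀ a b → norm (a , b) ≡ 0ℚ → a ≡ 0ℚ × b ≡ 0ℚ
  anisotropic a b norm≡0 = a≡0 (b ℚ.≟ 0ℚ) , b≡0
    where
    open ≡.≡-Reasoning
    u = a ℚ.+ (a ℚ.+ s ℚ.* b)
    u²≡db² : u ℚ.* u ≡ int (+ d) ℚ.* (b ℚ.* b)
    u²≡db² = begin
      u ℚ.* u
        ≡⟨ complete-square a b ⟩
      (s ℚ.* s ℚ.+ fromℤ (+ 4) ℚ.* t) ℚ.* (b ℚ.* b) ℚ.+ fromℤ (+ 4) ℚ.* norm (a , b)
        ≡⟨ ≡.cong₂ (λ p q → p ℚ.* (b ℚ.* b) ℚ.+ fromℤ (+ 4) ℚ.* q) discriminant norm≡0 ⟩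
      int (+ d) ℚ.* (b ℚ.* b) ℚ.+ fromℤ (+ 4) ℚ.* 0ℚ
        ≡⟨ ≡.cong (int (+ d) ℚ.* (b ℚ.* b) ℚ.+_) (ℚ.*-zeroʳ (fromℤ (+ 4))) ⟩
      int (+ d) ℚ.* (b ℚ.* b) ℚ.+ 0ℚ
        ≡⟨ ℚ.+-identityʳ _ ⟩
      int (+ d) ℚ.* (b ℚ.* b) ∎
    quotient : b ≢ 0ℚ → ∃ λ q → q ℚ.* q ≡ int (+ d)
    quotient b≢0 = u ℚ.* b⁻¹ , (begin
      u ℚ.* b⁻¹ ℚ.* (u ℚ.* b⁻¹)                        ≡⟨ interchange u b⁻¹ u b⁻¹ ⟩
      u ℚ.* u ℚ.* (b⁻¹ ℚ.* b⁻¹)                        ≡⟨ ≡.cong (ℚ._* (b⁻¹ ℚ.* b⁻¹)) u²≡db² ⟩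
      int (+ d) ℚ.* (b ℚ.* b) ℚ.* (b⁻¹ ℚ.* b⁻¹)        ≡⟨ ℚ.*-assoc (int (+ d)) (b ℚ.* b) (b⁻¹ ℚ.* b⁻¹) ⟩
      int (+ d) ℚ.* (b ℚ.* b ℚ.* (b⁻¹ ℚ.* b⁻¹))        ≡⟨ ≡.cong (int (+ d) ℚ.*_) (interchange b b b⁻¹ b⁻¹) ⟩
      int (+ d) ℚ.* (b ℚ.* b⁻¹ ℚ.* (b ℚ.* b⁻¹))        ≡⟨ ≡.cong (λ q → int (+ d) ℚ.* (q ℚ.* q)) (ℚ.*-inverseʳ b) ⟩
      int (+ d) ℚ.* (1ℚ ℚ.* 1ℚ)                        ≡⟨ ℚ.*-identityʳ (int (+ d)) ⟩
      int (+ d)                                        ∎)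
      where
      open import Algebra.Properties.CommutativeSemigroup
        (CommutativeRing.*-commutativeSemigroup ℚ.+-*-commutativeRing) using (interchange)
      instance
        b-nonZero : ℚ.NonZero b
        b-nonZero = ℚ.≢-nonZero b≢0
      b⁻¹ = ℚ.1/ b
    b≡0 : b ≡ 0ℚ
    b≡0 = decidable-stable (b ℚ.≟ 0ℚ) λ b≢0 →
      let q , q²≡d = quotient b≢0 in nonsquare-ℚ d-nonsquare q q²≡d
    a≡0 : Dec (b ≡ 0ℚ) → a ≡ 0ℚ
    a≡0 (no b≢0) = contradiction b≡0 b≢0
    a≡0 (yes eq) = square-null a (begin
      a ℚ.* a
        ≡⟨ ≡.trans (ℚ.+-identityʳ _) (ℚ.+-identityʳ _) ⟨
      a ℚ.* a ℚ.+ 0ℚ ℚ.- 0ℚ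
        ≡⟨ ≡.cong₂ (λ p q → a ℚ.* a ℚ.+ p ℚ.- q)
             (≡.trans (≡.cong (s ℚ.*_) (≡.trans (≡.cong (a ℚ.*_) eq) (ℚ.*-zeroʳ a))) (ℚ.*-zeroʳ s))
             (≡.trans (≡.cong (λ q → t ℚ.* (q ℚ.* q)) eq) (ℚ.*-zeroʳ t)) ⟨
      norm (a , b)
        ≡⟨ norm≡0 ⟩
      0ℚ ∎)

module QuadraticField (s t : ℚ)
  (anisotropic : ∀ a b → QuadraticRing.norm ℚ.+-*-commutativeRing s t (a , b) ≡ 0ℚ → a ≡ 0ℚ × b ≡ 0ℚ) where
  open QuadraticRing ℚ.+-*-commutativeRing s t
  open CommutativeRing quadraticRing hiding (zero)
  open SetoidReasoning setoid

  infix 4 _≟_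
  _≟_ : Rel₂.Decidable _≈_
  (a , b) ≟ (c , d) = (a ℚ.≟ c) ×-dec (b ℚ.≟ d)

  -- The conjugate divided by the norm, which is nonzero by anisotropy.
  inverse : ∀ x → ¬ x ≈ 0# → ∃ λ y → x * y ≈ 1#
  inverse x@(a , b) x≉0 = conjugate x * embed n⁻¹ , (begin
    x * (conjugate x * embed n⁻¹)      ≈⟨ *-assoc x (conjugate x) (embed n⁻¹) ⟨
    x * conjugate x * embed n⁻¹        ≈⟨ *-congʳ {embed n⁻¹} {x * conjugate x} {embed (norm x)} (*-conjugate x) ⟩
    embed (norm x) * embed n⁻¹         ≈⟨ embed.*-homo (norm x) n⁻¹ ⟨
    embed (norm x ℚ.* n⁻¹)             ≈⟨ ℚ.*-inverseʳ (norm x) , ≡.refl ⟩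
    1#                                 ∎)
    where
    module embed = RingMorphisms.IsRingHomomorphism embed-homomorphism
    instance
      norm-nonZero : ℚ.NonZero (norm x)
      norm-nonZero = ℚ.≢-nonZero (x≉0 ∘ anisotropic a b)
    n⁻¹ = ℚ.1/ norm x

  open GroupProperties +-group using (x∙y⁻¹≈ε⇒x≈y; x≈y⇒x∙y⁻¹≈ε)

  1≉0 : ¬ 1# ≈ 0#
  1≉0 (() , _)

  invertible⇒≉ : ∀ {x y} → (∃ λ z → z * (x - y) ≈ 1# × (x - y) * z ≈ 1#) → ¬ x ≈ y
  invertible⇒≉ {x} {y} (z , zd≈1 , _) x≈y = 1≉0 (begin
    1#            ≈⟨ zd≈1 ⟨
    z * (x - y)   ≈⟨ *-congˡ {z} {x - y} {0#} (x≈y⇒x∙y⁻¹≈ε {x} {y} x≈y) ⟩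
    z * 0#        ≈⟨ zeroʳ z ⟩
    0#            ∎)

  heytingField : HeytingField _ _ _
  heytingField = record
    -- Equality of pairs of rationals is decidable, so its negation is a tight apartness.
    { _#_            = λ x y → ¬ x ≈ y
    ; isHeytingField = record
      { isHeytingCommutativeRing = record
        { isCommutativeRing   = isCommutativeRing
        ; isApartnessRelation = record
          { irrefl  = λ x≈y x#y → x#y x≈y
          ; sym     = λ {x} {y} x#y y≈x → x#y (sym {y} {x} y≈x)
          ; cotrans = λ {x} {y} x#y z → cotransitive x#y z (x ≟ z)
          }
        ; #⇒invertible = λ {x} {y} x#y →
            let z , dz≈1 = inverse (x - y) (x#y ∘ x∙y⁻¹≈ε⇒x≈y x y)
            in z , trans {z * (x - y)} {(x - y) * z} {1#} (*-comm z (x - y)) dz≈1 , dz≈1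
        ; invertible⇒# = λ {x} {y} → invertible⇒≉ {x} {y}
        }
      ; tight = λ x y → decidable-stable (x ≟ y) , λ x≈y x#y → x#y x≈y
      }
    }
    where
    cotransitive : ∀ {x y} → ¬ x ≈ y → ∀ z → Dec (x ≈ z) → ¬ x ≈ z ⊎ ¬ z ≈ y
    cotransitive {x} {y} x#y z (yes x≈z) = inj₂ λ z≈y → x#y (trans {x} {z} {y} x≈z z≈y)
    cotransitive x#y z (no x#z)          = inj₁ x#z

  extension : Extension
  extension = record
    { heytingField   = heytingField
    ; ι              = embed
    ; ι-homomorphism = embed-homomorphism
    }

  degree-2 : HasDegree extension 2
  degree-2 = (λ { zero → 1# ; (suc zero) → θ }) , record
    { spanning    = λ x → coordinates x , sym {span (coordinates x)} {x} (combination≈ (proj₁ x) (proj₂ x))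
    ; independent = λ q eq → λ
        { zero       → proj₁ (unique q eq)
        ; (suc zero) → proj₂ (unique q eq) }
    }
    where
    coordinates : ℚ × ℚ → Vector ℚ 2
    coordinates x zero       = proj₁ x
    coordinates x (suc zero) = proj₂ x
    span : Vector ℚ 2 → ℚ × ℚ
    span q = embed (q zero) * 1# + (embed (q (suc zero)) * θ + 0#)
    unique : ∀ q → span q ≈ 0# → (q zero , q (suc zero)) ≈ 0#
    unique q eq = trans {q zero , q (suc zero)} {span q} {0#}
      (sym {span q} {q zero , q (suc zero)} (combination≈ (q zero) (q (suc zero)))) eq

module _ (K : Extension) (F : Subfield K) where
  open Extension K using (ι)
  open CommutativeRing (commutativeRing K) hiding (zero)
  open Subfield F
  open FieldProperties K

  ι-ℕ-member : ∀ n → Member (ι (int (+ n)))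
  ι-ℕ-member zero    = resp (sym ι-0) 0-closed
  ι-ℕ-member (suc n) = resp (sym (trans (≡⇒ι (int-+ (+ 1) (+ n))) (trans (ι-+ 1ℚ (int (+ n))) (+-congʳ ι-1))))
    (+-closed 1-closed (ι-ℕ-member n))

  ι-int-member : ∀ i → Member (ι (int i))
  ι-int-member (+ n)    = ι-ℕ-member n
  ι-int-member -[1+ n ] = resp (sym (ι-neg (int (+ suc n)))) (neg-closed (ι-ℕ-member (suc n)))

  ι-member : ∀ q → Member (ι q)
  ι-member q@(mkℚ p d-1 _) = resp (sym (trans (≡⇒ι q≡) (ι-* (int p) (ℚ.1/ d))))
    (*-closed (ι-int-member p) (inv-closed (trans (sym (ι-* d (ℚ.1/ d))) (trans (≡⇒ι (ℚ.*-inverseʳ d)) ι-1)) (ι-int-member (+ suc d-1))))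
    where
    d = int (+ suc d-1)
    q≡ : q ≡ int p ℚ.* ℚ.1/ d
    q≡ = begin
      q                        ≡⟨ ℚ.*-identityʳ q ⟨
      q ℚ.* 1ℚ                 ≡⟨ ≡.cong (q ℚ.*_) (ℚ.*-inverseʳ d) ⟨
      q ℚ.* (d ℚ.* ℚ.1/ d)     ≡⟨ ℚ.*-assoc q d (ℚ.1/ d) ⟨
      q ℚ.* d ℚ.* ℚ.1/ d       ≡⟨ ≡.cong (ℚ._* ℚ.1/ d) (q*↧≡↥ q) ⟩
      int p ℚ.* ℚ.1/ d         ∎
      where open ≡.≡-Reasoning

module QuadraticCycle (s t : ℤ) {d} (d-nonsquare : Nonsquare d)
  (discriminant : int s ℚ.* int s ℚ.+ IntegerCoefficients.fromℤ ℚ.+-*-commutativeRing (+ 4) ℚ.* int t ≡ int (+ d)) where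
  open Anisotropic (int s) (int t) d-nonsquare discriminant using (anisotropic)
  open QuadraticRing ℚ.+-*-commutativeRing (int s) (int t) using (quadraticRing; θ; θ²; combination≈)
  open QuadraticField (int s) (int t) anisotropic using (extension; degree-2)
  open FieldProperties extension using (ι-int)
  open Polynomial (CommutativeRing.rawRing quadraticRing) using (X; const)
  open Newton quadraticRing using (const-homomorphism)
  private
    K[X] = PolynomialRing.polynomialRing quadraticRing
    module K = CommutativeRing quadraticRing
    module K[X] = CommutativeRing K[X]
    module Zᴷ = IntegerCoefficients quadraticRing
    module Z = IntegerCoefficients K[X]
    module const = RingMorphisms.IsRingHomomorphism const-homomorphism
  open Dickson K[X] using (D)
  open Factorizations K[X] X (const θ) public

  embed-ℤ : ℤ × ℤ → ℚ × ℚ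
  embed-ℤ (a , b) = int a , int b

  embed-ℤ≈ : ∀ a b → embed-ℤ (a , b) K.≈ Zᴷ.fromℤ a K.+ Zᴷ.fromℤ b K.* θ
  embed-ℤ≈ a b = begin
    (int a , int b)                                              ≈⟨ combination≈ (int a) (int b) ⟨
    (int a , 0ℚ) K.* K.1# K.+ ((int b , 0ℚ) K.* θ K.+ K.0#)
      ≈⟨ K.+-cong {(int a , 0ℚ) K.* K.1#} {Zᴷ.fromℤ a} {(int b , 0ℚ) K.* θ K.+ K.0#} {Zᴷ.fromℤ b K.* θ}
           (K.trans {(int a , 0ℚ) K.* K.1#} {int a , 0ℚ} {Zᴷ.fromℤ a} (K.*-identityʳ (int a , 0ℚ)) (ι-int a))
           (K.trans {(int b , 0ℚ) K.* θ K.+ K.0#} {(int b , 0ℚ) K.* θ} {Zᴷ.fromℤ b K.* θ} (K.+-identityʳ ((int b , 0ℚ) K.* θ))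
             (K.*-congʳ {θ} {int b , 0ℚ} {Zᴷ.fromℤ b} (ι-int b))) ⟩
    Zᴷ.fromℤ a K.+ Zᴷ.fromℤ b K.* θ                             ∎
    where open SetoidReasoning K.setoid

  const-embed-ℤ : ∀ a b → const (embed-ℤ (a , b)) K[X].≈ Z.fromℤ a K[X].+ Z.fromℤ b K[X].* const θ
  const-embed-ℤ a b = begin
    const (embed-ℤ (a , b))                                   ≈⟨ const.⟦⟧-cong {embed-ℤ (a , b)} {Zᴷ.fromℤ a K.+ Zᴷ.fromℤ b K.* θ} (embed-ℤ≈ a b) ⟩
    const (Zᴷ.fromℤ a K.+ Zᴷ.fromℤ b K.* θ)                   ≈⟨ const.+-homo (Zᴷ.fromℤ a) (Zᴷ.fromℤ b K.* θ) ⟩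
    const (Zᴷ.fromℤ a) K[X].+ const (Zᴷ.fromℤ b K.* θ)
      ≈⟨ K[X].+-cong {const (Zᴷ.fromℤ a)} {Z.fromℤ a} {const (Zᴷ.fromℤ b K.* θ)} {Z.fromℤ b K[X].* const θ}
           (fromℤ-homo quadraticRing K[X] const-homomorphism a)
           (K[X].trans {const (Zᴷ.fromℤ b K.* θ)} {const (Zᴷ.fromℤ b) K[X].* const θ} {Z.fromℤ b K[X].* const θ}
             (const.*-homo (Zᴷ.fromℤ b) θ)
             (K[X].*-congʳ {const θ} {const (Zᴷ.fromℤ b)} {Z.fromℤ b} (fromℤ-homo quadraticRing K[X] const-homomorphism b))) ⟩
    Z.fromℤ a K[X].+ Z.fromℤ b K[X].* const θ                 ∎
    where open SetoidReasoning K[X].setoid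

  const-θ² : const θ K[X].* const θ K[X].≈ Z.fromℤ t K[X].+ Z.fromℤ s K[X].* const θ
  const-θ² = begin
    const θ K[X].* const θ                       ≈⟨ const.*-homo θ θ ⟨
    const (θ K.* θ)                              ≈⟨ const.⟦⟧-cong {θ K.* θ} {embed-ℤ (t , s)} θ² ⟩
    const (embed-ℤ (t , s))                      ≈⟨ const-embed-ℤ t s ⟩
    Z.fromℤ t K[X].+ Z.fromℤ s K[X].* const θ    ∎
    where open SetoidReasoning K[X].setoid

  -- A single eigenvalue - θ secures minimality: a subfield that contains it contains θ and all a +
  -- b θ.
  twoIntegral : ∀ {n} (3≤n : 3 ℕ.≤ n) (v : Vec (ℤ × ℤ) n) → ∃ (λ i → lookup v i ≡ (+ 0 , ℤ.- + 1)) →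
    D n X K[X].- Z.fromℤ (+ 2) K[X].≈ linears v → TwoIntegral (Cycle n 3≤n)
  twoIntegral {n} 3≤n v (i , vᵢ≡-θ) splits = extension , record
    { eigenvalue = λ i → embed-ℤ (lookup v i)
    ; splits     = λ k → K.trans (charPoly-Cycle quadraticRing n 3≤n k)
        (K.trans (splits k) (K.sym (linears-product (λ p → const (embed-ℤ p)) const-embed-ℤ v k)))
    ; smallest   = λ F eigenvalues∈F x →
        let open Subfield F
            -θ∈F = ≡.subst (λ p → Member (embed-ℤ p)) vᵢ≡-θ (eigenvalues∈F i)
        in resp (combination≈ (proj₁ x) (proj₂ x)) (+-closed
             (*-closed (ι-member extension F (proj₁ x)) 1-closed)
             (+-closed (*-closed (ι-member extension F (proj₂ x)) (neg-closed -θ∈F)) 0-closed))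
    } , degree-2

order⇒cycle : ∀ {n} (3≤n : 3 ℕ.≤ n) → n ∈ twoIntegralOrders → TwoIntegral (Cycle n 3≤n)
order⇒cycle 3≤n = λ
  -- The index given with each list is the position of an eigenvalue - θ.
  { (here ≡.refl)                         → Golden.twoIntegral 3≤n eigenvalues₅ (# 2 , ≡.refl) (Golden.splits₅ Golden.const-θ²)
  ; (there (here ≡.refl))                 → Root2.twoIntegral 3≤n eigenvalues₈ (# 5 , ≡.refl) (Root2.splits₈ Root2.const-θ²)
  ; (there (there (here ≡.refl)))         → Golden.twoIntegral 3≤n eigenvalues₁₀ (# 3 , ≡.refl) (Golden.splits₁₀ Golden.const-θ²)
  ; (there (there (there (here ≡.refl)))) → Root3.twoIntegral 3≤n eigenvalues₁₂ (# 9 , ≡.refl) (Root3.splits₁₂ Root3.const-θ²)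
  }
  where
  -- The numbers 5, 8 and 12 are the discriminants s² + 4 t of θ² = θ + 1, θ² = 2 and θ² = 3.
  module Golden = QuadraticCycle (+ 1) (+ 1) {5} (from-yes (nonsquare? 5)) ≡.refl
  module Root2  = QuadraticCycle (+ 0) (+ 2) {8} (from-yes (nonsquare? 8)) ≡.refl
  module Root3  = QuadraticCycle (+ 0) (+ 3) {12} (from-yes (nonsquare? 12)) ≡.refl

-- Relabelling vertices: Cayley graphs of valency 2 as cycles.

module _ {r ρ} (R : CommutativeRing r ρ) where
  open Polynomial (CommutativeRing.rawRing R) using (X; const)
  open Matrix (CommutativeRing.rawRing R) using (SquareMatrix)
  open PolynomialRing R using (polynomialRing; _≈ₚ_)
  private module R[X] = CommutativeRing polynomialRing
  open Determinant polynomialRing using (∣∣≡det; det-cong; det-permute)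

  -- A permutation of the vertices conjugates X I - A: being injective, it preserves the diagonal,
  -- where X stands.
  charPoly-permute : ∀ {n} (A B : SquareMatrix n) (π : Permutation′ n) →
    (∀ i j → A (π ⟨$⟩ʳ i) (π ⟨$⟩ʳ j) ≡ B i j) →
    charPoly (CommutativeRing.rawRing R) A ≈ₚ charPoly (CommutativeRing.rawRing R) B
  charPoly-permute {n} A B π A≡B = begin
    charPoly (CommutativeRing.rawRing R) A              ≡⟨ ∣∣≡det (entry A) ⟨
    ∣ entry A ∣                                         ≈⟨ det-permute (entry A) π ⟨
    ∣ (λ i j → entry A (π ⟨$⟩ʳ i) (π ⟨$⟩ʳ j)) ∣         ≈⟨ det-cong {n} {λ i j → entry A (π ⟨$⟩ʳ i) (π ⟨$⟩ʳ j)} {entry B} (λ i j → R[X].reflexive (entry≡ i j)) ⟩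
    ∣ entry B ∣                                         ≡⟨ ∣∣≡det (entry B) ⟩
    charPoly (CommutativeRing.rawRing R) B              ∎
    where
    open SetoidReasoning R[X].setoid
    open Determinant polynomialRing using (∣_∣)
    entry : SquareMatrix n → Fin n → Fin n → R[X].Carrier
    entry A i j = (if does (i Fin.≟ j) then X else []) R[X].+ R[X].- const (A i j)
    entry≡ : ∀ i j → entry A (π ⟨$⟩ʳ i) (π ⟨$⟩ʳ j) ≡ entry B i j
    entry≡ i j = ≡.cong₂ (λ b a → (if b then X else []) R[X].+ R[X].- const a)
      (does-⇔ (mk⇔ (λ eq → ≡.trans (≡.sym (Permutation.inverseˡ π)) (≡.trans (≡.cong (π ⟨$⟩ˡ_) eq) (Permutation.inverseˡ π))) (≡.cong (π ⟨$⟩ʳ_))) (π ⟨$⟩ʳ i Fin.≟ π ⟨$⟩ʳ j) (i Fin.≟ j))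
      (A≡B i j)

module _ {a p} {A : Set a} {P : A → Set p} (P? : Decidable P) where

  count-cong : ∀ {b q} {B : Set b} {Q : B → Set q} (Q? : Decidable Q) {n} (f : Fin n → A) (g : Fin n → B) →
    (∀ i → does (P? (f i)) ≡ does (Q? (g i))) → count P? (Vec.tabulate f) ≡ count Q? (Vec.tabulate g)
  count-cong Q? {zero}  f g eq = ≡.refl
  count-cong Q? {suc n} f g eq = ≡.cong₂ (λ b k → (if b then suc else id) k) (eq zero) (count-cong Q? (f ∘ suc) (g ∘ suc) (eq ∘ suc))

  count≡0 : ∀ {n} (f : Fin n → A) → count P? (Vec.tabulate f) ≡ 0 → ∀ i → ¬ P (f i)
  count≡0 {suc n} f eq i Pfi with P? (f zero)
  count≡0 {suc n} f eq zero    Pfi | no ¬P = ¬P Pfi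
  count≡0 {suc n} f eq (suc i) Pfi | no _  = count≡0 (f ∘ suc) eq i Pfi

  count≡1 : ∀ {n} (f : Fin n → A) → count P? (Vec.tabulate f) ≡ 1 →
    ∃ λ i → P (f i) × (∀ k → P (f k) → k ≡ i)
  count≡1 {suc n} f eq with P? (f zero)
  ... | yes Pf₀ = zero , Pf₀ , λ
    { zero    _  → ≡.refl
    ; (suc k) Pk → contradiction Pk (count≡0 (f ∘ suc) (ℕ.suc-injective eq) k) }
  ... | no ¬Pf₀ with count≡1 (f ∘ suc) eq
  ...   | i , Pi , unique = suc i , Pi , λ
    { zero    P₀ → contradiction P₀ ¬Pf₀
    ; (suc k) Pk → ≡.cong suc (unique k Pk) }

  count≡2 : ∀ {n} (f : Fin n → A) → count P? (Vec.tabulate f) ≡ 2 →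
    ∃₂ λ i j → i ≢ j × P (f i) × P (f j) × (∀ k → P (f k) → k ≡ i ⊎ k ≡ j)
  count≡2 {suc n} f eq with P? (f zero)
  ... | yes Pf₀ with count≡1 (f ∘ suc) (ℕ.suc-injective eq)
  ...   | j , Pj , unique = zero , suc j , (λ ()) , Pf₀ , Pj , λ
    { zero    _  → inj₁ ≡.refl
    ; (suc k) Pk → inj₂ (≡.cong suc (unique k Pk)) }
  count≡2 {suc n} f eq | no ¬Pf₀ with count≡2 (f ∘ suc) eq
  ...   | i , j , i≢j , Pi , Pj , unique = suc i , suc j , i≢j ∘ Fin.suc-injective , Pi , Pj , λ
    { zero    P₀ → contradiction P₀ ¬Pf₀
    ; (suc k) Pk → Sum.map (≡.cong suc) (≡.cong suc) (unique k Pk) }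

-- The adjacency of `Cycle`, detached from the bound on n that the graph carries.
CycleAdjacent : (n : ℕ) → Fin n → Fin n → Set
CycleAdjacent n i j = Next n i j ⊎ Next n j i

module GroupListing {c ℓ} (G : Group c ℓ) where
  open Group G
  open GroupProperties G
  open SetoidReasoning setoid

  record Listing (n : ℕ) : Set (c Level.⊔ ℓ) where
    field
      element   : Fin n → Carrier
      injective : ∀ {i j} → element i ≈ element j → i ≡ j
      covers    : ∀ x → ∃ λ i → x ≈ element i

    enumeration : Inverse (≡.setoid (Fin n)) setoid
    enumeration = record
      { to        = element
      ; from      = λ x → proj₁ (covers x)
      ; to-cong   = λ { ≡.refl → refl }
      ; from-cong = λ {x} {y} x≈y → injective (trans (sym (proj₂ (covers x))) (trans x≈y (proj₂ (covers y))))
      ; inverse   = (λ { {x} ≡.refl → sym (proj₂ (covers x)) })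
                  , (λ {i} {x} x≈i → injective (trans (sym (proj₂ (covers x))) x≈i))
      }

  open Listing

  finite⇒≟ : Finite G → Rel₂.Decidable _≈_
  finite⇒≟ (n , enum) x y = map′
    (λ eq → trans (sym (Inverse.strictlyInverseˡ enum x)) (trans (Inverse.to-cong enum eq) (Inverse.strictlyInverseˡ enum y)))
    (Inverse.from-cong enum) (Inverse.from enum x Fin.≟ Inverse.from enum y)

  -- Two enumerations of the same group differ by a bijection of their index sets. It shows that
  -- their lengths agree, and then serves as the relabelling.
  listing-permutation : ∀ {n} (enum : Inverse (≡.setoid (Fin n)) setoid) {m} → Listing m → Permutation m n
  listing-permutation enum l = permutation
    (λ i → Inverse.from enum (element l i))
    (λ i → proj₁ (covers l (Inverse.to enum i)))
    (λ i → ≡.trans (Inverse.from-cong enum (sym (proj₂ (covers l (Inverse.to enum i))))) (Inverse.strictlyInverseʳ enum i))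
    (λ i → injective l (trans (sym (proj₂ (covers l _))) (Inverse.strictlyInverseˡ enum (element l i))))

  -- A Hamiltonian cycle of a Cayley graph of valency 2, along which σ and τ
  -- are the multiplications by the two elements of the connection set.
  record CycleListing (C : ConnectionSet G) (n : ℕ) : Set (c Level.⊔ ℓ) where
    open ConnectionSet C
    field
      listing    : Listing n
      s t        : Carrier
      s∈S        : S s
      t∈S        : S t
      S⊆st       : ∀ {x} → S x → x ≈ s ⊎ x ≈ t
      σ τ        : Fin n → Fin n
      σ-step     : ∀ i → s ∙ element listing i ≈ element listing (σ i)
      τ-step     : ∀ i → t ∙ element listing i ≈ element listing (τ i)
      neighbours : ∀ i j → CycleAdjacent n i j ⇔ (j ≡ σ i ⊎ j ≡ τ i)

    private v = element listing

    adjacency : ∀ i j → S (v j ∙ v i ⁻¹) ⇔ CycleAdjacent n i j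
    adjacency i j = mk⇔
      (λ Sx → Equivalence.from (neighbours i j) (Sum.map (index σ σ-step) (index τ τ-step) (S⊆st Sx)))
      (λ adj → member (Equivalence.to (neighbours i j) adj))
      where
      member : j ≡ σ i ⊎ j ≡ τ i → S (v j ∙ v i ⁻¹)
      member (inj₁ ≡.refl) = S-resp (x≈z//y s _ _ (σ-step i)) s∈S
      member (inj₂ ≡.refl) = S-resp (x≈z//y t _ _ (τ-step i)) t∈S
      index : ∀ {s} (σ : Fin n → Fin n) → (∀ i → s ∙ v i ≈ v (σ i)) → v j ∙ v i ⁻¹ ≈ s → j ≡ σ i
      index {s} σ moves eq = injective listing (begin
        v j                   ≈⟨ //-rightDividesˡ (v i) (v j) ⟨
        v j ∙ v i ⁻¹ ∙ v i    ≈⟨ ∙-congʳ eq ⟩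
        s ∙ v i               ≈⟨ moves i ⟩
        v (σ i)               ∎)

    module _ (enum : Inverse (≡.setoid (Fin n)) setoid) (3≤n : 3 ℕ.≤ n) where
      private
        Γ = Cay G (n , enum) C
        Δ = Cycle n 3≤n

      relabelling : Permutation′ n
      relabelling = listing-permutation enum listing

      relabelled-adjacency : ∀ i j →
        does (Graph.adj? Γ (Graph.vertex Γ (relabelling ⟨$⟩ʳ i)) (Graph.vertex Γ (relabelling ⟨$⟩ʳ j))) ≡
        does (Graph.adj? Δ i j)
      relabelled-adjacency i j = does-⇔ (mk⇔
          (λ adj → Equivalence.to (adjacency i j) (S-resp (//-cong₂ (vertex≈ j) (vertex≈ i)) adj))
          (λ adj → S-resp (sym (//-cong₂ (vertex≈ j) (vertex≈ i))) (Equivalence.from (adjacency i j) adj)))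
        (Graph.adj? Γ _ _) (Graph.adj? Δ i j)
        where
        vertex≈ : ∀ i → Graph.vertex Γ (relabelling ⟨$⟩ʳ i) ≈ v i
        vertex≈ i = Inverse.strictlyInverseˡ enum (v i)

      module _ (K : Extension) where
        open Extension K using (rawRing)
        open Matrix rawRing using (adjacencyMatrix)
        private module K = CommutativeRing (commutativeRing K)

        charPoly-Cay : ∀ k → Polynomial.coeff rawRing (charPoly rawRing (adjacencyMatrix Γ)) k K.≈
          Polynomial.coeff rawRing (charPoly rawRing (adjacencyMatrix Δ)) k
        charPoly-Cay = charPoly-permute (commutativeRing K) (adjacencyMatrix Γ) (adjacencyMatrix Δ) relabelling λ i j →
          ≡.cong (λ b → if b then K.1# else K.0#) (relabelled-adjacency i j)

        cay⇒cycle : IsSplittingField K Γ → IsSplittingField K Δ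
        cay⇒cycle splitting = record
          { eigenvalue = eigenvalue
          ; splits     = λ k → K.trans (K.sym (charPoly-Cay k)) (splits k)
          ; smallest   = smallest
          }
          where open IsSplittingField splitting

        cycle⇒cay : IsSplittingField K Δ → IsSplittingField K Γ
        cycle⇒cay splitting = record
          { eigenvalue = eigenvalue
          ; splits     = λ k → K.trans (charPoly-Cay k) (splits k)
          ; smallest   = smallest
          }
          where open IsSplittingField splitting

  cay⇒order : ∀ {C m n} (enum : Inverse (≡.setoid (Fin m)) setoid) → CycleListing C n → 3 ℕ.≤ n →
    TwoIntegral (Cay G (m , enum) C) → n ∈ twoIntegralOrders
  cay⇒order {C} {m} {n} enum l 3≤n = relabel (↔⇒≡ (listing-permutation enum (CycleListing.listing l))) enum
    where
    -- The enumeration varies along with m, so that the equality of the two lengths can be matched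
    -- and the Cayley graph gets the order n of the cycle.
    relabel : ∀ {m} → n ≡ m → (enum : Inverse (≡.setoid (Fin m)) setoid) →
      TwoIntegral (Cay G (m , enum) C) → n ∈ twoIntegralOrders
    relabel ≡.refl enum (K , splitting , quadratic) =
      cycle⇒order n 3≤n (K , CycleListing.cay⇒cycle l enum 3≤n K splitting , quadratic)

-- Cyclic groups and the groups ℤ/n.

least : ∀ {p} {P : ℕ → Set p} → Decidable P → ∀ m → P m → ∃ λ d → P d × (∀ k → k ℕ.< d → ¬ P k)
least P? m Pm with P? 0
... | yes P0 = 0 , P0 , λ k ()
least P? zero    Pm | no ¬P0 = contradiction Pm ¬P0
least P? (suc m) Pm | no ¬P0 with least (P? ∘ suc) m Pm
... | d , Pd , minimal = suc d , Pd , λ { zero _ → ¬P0 ; (suc k) (s≤s k<d) → minimal k k<d }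

module _ {n : ℕ} where
  open Group (ℤ/ n) using () renaming (_≈_ to _≡ₙ_; sym to ≡ₙ-sym)

  -- Powers of a generator have natural exponents, so the signed quotient is split into a
  -- nonnegative multiple of n on one side or the other.
  ≡ₙ⇒multiple : ∀ a b → + a ≡ₙ + b → ∃ λ q → a ≡ b ℕ.+ q ℕ.* n ⊎ b ≡ a ℕ.+ q ℕ.* n
  ≡ₙ⇒multiple a b (ℤ.divides (+ q) eq)    = q , inj₁ (ℤ.+-injective (begin
    + a                       ≡⟨ solve 2 (λ a b → a := b :+ (a :- b)) ≡.refl (+ a) (+ b) ⟩
    + b ℤ.+ (+ a ℤ.- + b)     ≡⟨ ≡.cong (ℤ._+_ (+ b)) (≡.trans eq (≡.sym (ℤ.pos-* q n))) ⟩
    + (b ℕ.+ q ℕ.* n)         ∎))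
    where
    open ≡.≡-Reasoning
    open ℤSolver.+-*-Solver
  ≡ₙ⇒multiple a b (ℤ.divides -[1+ q ] eq) = suc q , inj₂ (ℤ.+-injective (begin
    + b                           ≡⟨ solve 2 (λ a b → b := a :- (a :- b)) ≡.refl (+ a) (+ b) ⟩
    + a ℤ.- (+ a ℤ.- + b)         ≡⟨ ≡.cong (ℤ._-_ (+ a)) eq ⟩
    + a ℤ.- -[1+ q ] ℤ.* + n      ≡⟨ ≡.cong (ℤ._+_ (+ a)) (ℤ.neg-distribˡ-* -[1+ q ] (+ n)) ⟩
    + a ℤ.+ + suc q ℤ.* + n       ≡⟨ ≡.cong (ℤ._+_ (+ a)) (≡.sym (ℤ.pos-* (suc q) n)) ⟩
    + (a ℕ.+ suc q ℕ.* n)         ∎))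
    where
    open ≡.≡-Reasoning
    open ℤSolver.+-*-Solver

  ≡ₙ-unique : ∀ {a b} → a ℕ.< n → b ℕ.< n → + a ≡ₙ + b → a ≡ b
  ≡ₙ-unique {a} {b} a<n b<n a≡b with ≡ₙ⇒multiple a b a≡b
  ... | zero  , inj₁ eq = ≡.trans eq (ℕ.+-identityʳ b)
  ... | zero  , inj₂ eq = ≡.sym (≡.trans eq (ℕ.+-identityʳ a))
  ... | suc q , inj₁ eq = contradiction a<n (ℕ.≤⇒≯ (≡.subst (n ℕ.≤_) (≡.sym eq) (ℕ.m≤n⇒m≤o+n b (ℕ.m≤m+n n (q ℕ.* n)))))
  ... | suc q , inj₂ eq = contradiction b<n (ℕ.≤⇒≯ (≡.subst (n ℕ.≤_) (≡.sym eq) (ℕ.m≤n⇒m≤o+n a (ℕ.m≤m+n n (q ℕ.* n)))))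

  module _ .{{_ : ℕ.NonZero n}} where

    residue≡ₙ : ∀ i → + (i ℤ.%ℕ n) ≡ₙ i
    residue≡ₙ i = ≡ₙ-sym {i} {+ (i ℤ.%ℕ n)} (ℤ.divides (i ℤ./ℕ n) (begin
      i ℤ.- + r                                 ≡⟨ ≡.cong (ℤ._- + r) (ℤ.a≡a%ℕn+[a/ℕn]*n i n) ⟩
      + r ℤ.+ (i ℤ./ℕ n) ℤ.* + n ℤ.- + r        ≡⟨ solve 2 (λ r q → r :+ q :- r := q) ≡.refl (+ r) ((i ℤ./ℕ n) ℤ.* + n) ⟩
      (i ℤ./ℕ n) ℤ.* + n                        ∎))
      where
      open ≡.≡-Reasoning
      open ℤSolver.+-*-Solver
      r = i ℤ.%ℕ n

module CyclicGroups {c ℓ} (G : Group c ℓ) where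
  open Group G
  open GroupProperties G
  open GroupListing G
  open MonoidMultiples monoid using (×-homo-+) renaming (_×_ to _·_)
  open SetoidReasoning setoid

  power-comm : ∀ g k → k · g ∙ g ≈ g ∙ k · g
  power-comm g zero    = trans (identityˡ g) (sym (identityʳ g))
  power-comm g (suc k) = trans (assoc _ _ _) (∙-congˡ (power-comm g k))

  power-cancel : ∀ {g} i k → i · g ≈ (i ℕ.+ k) · g → k · g ≈ ε
  power-cancel {g} i k eq = ∙-cancelˡ (i · g) (k · g) ε (begin
    i · g ∙ k · g      ≈⟨ ×-homo-+ g i k ⟨
    (i ℕ.+ k) · g      ≈⟨ eq ⟨
    i · g              ≈⟨ identityʳ _ ⟨
    i · g ∙ ε          ∎)

  record Cyclic (n : ℕ) : Set (c Level.⊔ ℓ) where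
    field
      generator : Carrier
      period    : n · generator ≈ ε
      distinct  : ∀ {i j} → i ℕ.< n → j ℕ.< n → i · generator ≈ j · generator → i ≡ j
      generates : ∀ x → ∃ λ i → i ℕ.< n × x ≈ i · generator

    private g = generator

    listing : Listing n
    listing = record
      { element   = λ i → toℕ i · g
      ; injective = λ {i} {j} eq → Fin.toℕ-injective (distinct (Fin.toℕ<n i) (Fin.toℕ<n j) eq)
      ; covers    = λ x → let i , i<n , x≈ = generates x in
          fromℕ< i<n , trans x≈ (reflexive (≡.cong (_· g) (≡.sym (Fin.toℕ-fromℕ< i<n))))
      }

    next⇒ : ∀ i j → Next n i j → toℕ j · g ≈ g ∙ toℕ i · g
    next⇒ i j (inj₁ i+1≡j)         = reflexive (≡.cong (_· g) (≡.sym i+1≡j))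
    next⇒ i j (inj₂ (i+1≡n , j≡0)) = begin
      toℕ j · g         ≡⟨ ≡.cong (_· g) j≡0 ⟩
      ε                 ≈⟨ period ⟨
      n · g             ≡⟨ ≡.cong (_· g) i+1≡n ⟨
      suc (toℕ i) · g   ∎

    ⇒next : ∀ i j → toℕ j · g ≈ g ∙ toℕ i · g → Next n i j
    ⇒next i j eq with ℕ.m≤n⇒m<n∨m≡n (Fin.toℕ<n i)
    ... | inj₁ i+1<n = inj₁ (distinct i+1<n (Fin.toℕ<n j) (sym eq))
    ... | inj₂ i+1≡n = inj₂ (i+1≡n , distinct (Fin.toℕ<n j) (ℕ.≤-trans (s≤s z≤n) (Fin.toℕ<n i)) (begin
      toℕ j · g         ≈⟨ eq ⟩
      suc (toℕ i) · g   ≡⟨ ≡.cong (_· g) i+1≡n ⟩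
      n · g             ≈⟨ period ⟩
      ε                 ∎))

    -- In the list of the powers of g, multiplication by g is the cyclic successor; multiplication
    -- by its inverse is the predecessor, because it undoes the former.
    cycleListing : (C : ConnectionSet G) → ConnectionSet.S C g →
      (∀ {x} → ConnectionSet.S C x → x ≈ g ⊎ x ≈ g ⁻¹) → CycleListing C n
    cycleListing C g∈S S⊆ = record
      { listing    = listing
      ; s          = g
      ; t          = g ⁻¹
      ; s∈S        = g∈S
      ; t∈S        = ConnectionSet.inv-closed C g∈S
      ; S⊆st       = S⊆
      ; σ          = λ i → proj₁ (covers (g ∙ v i))
      ; τ          = λ i → proj₁ (covers (g ⁻¹ ∙ v i))
      ; σ-step     = λ i → proj₂ (covers (g ∙ v i))
      ; τ-step     = λ i → proj₂ (covers (g ⁻¹ ∙ v i))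
      ; neighbours = λ i j → mk⇔
          (Sum.map
            (λ i→j → injective (trans (next⇒ i j i→j) (proj₂ (covers (g ∙ v i)))))
            (λ j→i → injective (trans (y≈x\\z g (v j) (v i) (sym (next⇒ j i j→i))) (proj₂ (covers (g ⁻¹ ∙ v i))))))
          (Sum.map
            (λ { ≡.refl → ⇒next i _ (sym (proj₂ (covers (g ∙ v i)))) })
            (λ { ≡.refl → ⇒next _ i (begin
              v i                                          ≈⟨ \\-leftDividesˡ g (v i) ⟨
              g ∙ (g ⁻¹ ∙ v i)                             ≈⟨ ∙-congˡ (proj₂ (covers (g ⁻¹ ∙ v i))) ⟩
              g ∙ v (proj₁ (covers (g ⁻¹ ∙ v i)))          ∎) }))
      }
      where
      open Listing listing using (covers; injective) renaming (element to v)

    module _ .{{_ : ℕ.NonZero n}} where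
      open Group (ℤ/ n) using () renaming (_≈_ to _≡ₙ_; trans to ≡ₙ-trans; sym to ≡ₙ-sym)
      open GroupMorphisms rawGroup (Group.rawGroup (ℤ/ n))

      multiple : ∀ a q → (a ℕ.+ q ℕ.* n) · g ≈ a · g
      multiple a zero    = reflexive (≡.cong (_· g) (ℕ.+-identityʳ a))
      multiple a (suc q) = begin
        (a ℕ.+ (n ℕ.+ q ℕ.* n)) · g          ≡⟨ ≡.cong (λ k → (a ℕ.+ k) · g) (ℕ.+-comm n (q ℕ.* n)) ⟩
        (a ℕ.+ (q ℕ.* n ℕ.+ n)) · g          ≡⟨ ≡.cong (_· g) (ℕ.+-assoc a (q ℕ.* n) n) ⟨
        (a ℕ.+ q ℕ.* n ℕ.+ n) · g            ≈⟨ ×-homo-+ g (a ℕ.+ q ℕ.* n) n ⟩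
        (a ℕ.+ q ℕ.* n) · g ∙ n · g          ≈⟨ ∙-cong (multiple a q) period ⟩
        a · g ∙ ε                            ≈⟨ identityʳ _ ⟩
        a · g                                ∎

      ≡ₙ⇒≈ : ∀ a b → + a ≡ₙ + b → a · g ≈ b · g
      ≡ₙ⇒≈ a b a≡b with ≡ₙ⇒multiple a b a≡b
      ... | q , inj₁ ≡.refl = multiple b q
      ... | q , inj₂ ≡.refl = sym (multiple a q)

      ≈⇒≡ₙ : ∀ a b → a · g ≈ b · g → + a ≡ₙ + b
      ≈⇒≡ₙ a b a≈b = ≡ₙ-trans {+ a} {+ (a ℕ.% n)} {+ b} (≡ₙ-sym {+ (a ℕ.% n)} {+ a} (residue≡ₙ (+ a)))
        (≡.subst (λ r → + r ≡ₙ + b) (≡.sym residues) (residue≡ₙ (+ b)))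
        where
        residues : a ℕ.% n ≡ b ℕ.% n
        residues = distinct (ℕ.m%n<n a n) (ℕ.m%n<n b n) (begin
          (a ℕ.% n) · g   ≈⟨ ≡ₙ⇒≈ (a ℕ.% n) a (residue≡ₙ (+ a)) ⟩
          a · g           ≈⟨ a≈b ⟩
          b · g           ≈⟨ ≡ₙ⇒≈ (b ℕ.% n) b (residue≡ₙ (+ b)) ⟨
          (b ℕ.% n) · g   ∎)

      logarithm : Carrier → ℕ
      logarithm x = proj₁ (generates x)

      logarithm-≈ : ∀ x → x ≈ logarithm x · g
      logarithm-≈ x = proj₂ (proj₂ (generates x))

      cyclic⇒≅ : G ≅ ℤ/ n
      cyclic⇒≅ = (λ x → + logarithm x) , record
        { isGroupMonomorphism = record
          { isGroupHomomorphism = record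
            { isMonoidHomomorphism = record
              { isMagmaHomomorphism = record
                { isRelHomomorphism = record { cong = λ {x} {y} x≈y →
                    ≈⇒≡ₙ (logarithm x) (logarithm y) (trans (sym (logarithm-≈ x)) (trans x≈y (logarithm-≈ y))) }
                ; homo = λ x y → ≈⇒≡ₙ (logarithm (x ∙ y)) (logarithm x ℕ.+ logarithm y) (product x y)
                }
              ; ε-homo = ≈⇒≡ₙ (logarithm ε) 0 (sym (logarithm-≈ ε))
              }
            -- The logarithms of x⁻¹ and x add up to 0 modulo n; the substitution rewrites this sum
            -- as the difference of the first and the negative of the second.
            ; ⁻¹-homo = λ x → ≡.subst (+ n ℤ.∣_)
                (≡.trans (ℤ.+-identityʳ _) (≡.cong (ℤ._+_ (+ logarithm (x ⁻¹))) (≡.sym (ℤ.neg-involutive (+ logarithm x)))))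
                (≈⇒≡ₙ (logarithm (x ⁻¹) ℕ.+ logarithm x) 0
                  (trans (sym (product (x ⁻¹) x)) (trans (sym (logarithm-≈ (x ⁻¹ ∙ x))) (inverseˡ x))))
            }
          ; injective = λ {x} {y} eq →
              trans (logarithm-≈ x) (trans (≡ₙ⇒≈ (logarithm x) (logarithm y) eq) (sym (logarithm-≈ y)))
          }
        ; surjective = λ i → (i ℤ.%ℕ n) · g , λ {x} x≈ →
            ≡ₙ-trans {+ logarithm x} {+ (i ℤ.%ℕ n)} {i}
              (≈⇒≡ₙ (logarithm x) (i ℤ.%ℕ n) (trans (sym (logarithm-≈ x)) x≈)) (residue≡ₙ i)
        }
        where
        product : ∀ x y → logarithm (x ∙ y) · g ≈ (logarithm x ℕ.+ logarithm y) · g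
        product x y = begin
          logarithm (x ∙ y) · g                  ≈⟨ logarithm-≈ (x ∙ y) ⟨
          x ∙ y                                  ≈⟨ ∙-cong (logarithm-≈ x) (logarithm-≈ y) ⟩
          logarithm x · g ∙ logarithm y · g      ≈⟨ ×-homo-+ g (logarithm x) (logarithm y) ⟨
          (logarithm x ℕ.+ logarithm y) · g      ∎

  module _ {n : ℕ} .{{_ : ℕ.NonZero n}} where
    open Group (ℤ/ n) using () renaming (_≈_ to _≡ₙ_; trans to ≡ₙ-trans; sym to ≡ₙ-sym; ∙-cong to ≡ₙ-∙-cong)

    ≅⇒cyclic : G ≅ ℤ/ n → Cyclic n
    ≅⇒cyclic (f , isomorphism) = record
      { generator = g
      ; period    = injective (≡ₙ-trans {f (n · g)} {+ n} {f ε} (f-power n)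
          (≡ₙ-trans {+ n} {+ 0} {f ε} (ℤ.divides (+ 1) (≡.trans (ℤ.+-identityʳ (+ n)) (≡.sym (ℤ.*-identityˡ (+ n)))))
            (≡ₙ-sym {f ε} {+ 0} ε-homo)))
      ; distinct  = λ {i} {j} i<n j<n eq → ≡ₙ-unique i<n j<n
          (≡ₙ-trans {+ i} {f (i · g)} {+ j} (≡ₙ-sym {f (i · g)} {+ i} (f-power i))
            (≡ₙ-trans {f (i · g)} {f (j · g)} {+ j} (⟦⟧-cong eq) (f-power j)))
      ; generates = λ x → f x ℤ.%ℕ n , ℤ.n%ℕd<d (f x) n , injective
          (≡ₙ-sym {f ((f x ℤ.%ℕ n) · g)} {f x} (≡ₙ-trans {f ((f x ℤ.%ℕ n) · g)} {+ (f x ℤ.%ℕ n)} {f x}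
            (f-power (f x ℤ.%ℕ n)) (residue≡ₙ (f x))))
      }
      where
      open GroupMorphisms.IsGroupIsomorphism isomorphism
      g = proj₁ (surjective (+ 1))
      f-power : ∀ k → f (k · g) ≡ₙ + k
      f-power zero    = ε-homo
      f-power (suc k) = ≡ₙ-trans {f (g ∙ k · g)} {f g ℤ.+ f (k · g)} {+ suc k} (∙-homo g (k · g))
        (≡ₙ-∙-cong {f g} {+ 1} {f (k · g)} {+ k} (proj₂ (surjective (+ 1)) refl) (f-power k))

-- Connection sets with two elements, generators and orders.

<⇒≡+suc : ∀ {i j} → i ℕ.< j → ∃ λ k → j ≡ i ℕ.+ suc k
<⇒≡+suc {i} i<j = let k , i+1+k≡j = ℕ.m≤n⇒∃[o]m+o≡n i<j in k , ≡.trans (≡.sym i+1+k≡j) (≡.sym (ℕ.+-suc i k))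

degree-2-Cycle? : ∀ n (3≤n : 3 ℕ.≤ n) → Dec (∀ i → degree (Cycle n 3≤n) i ≡ 2)
degree-2-Cycle? n 3≤n = Fin.all? λ i → degree (Cycle n 3≤n) i ℕ.≟ 2

-- The degrees are counted by evaluation for each of the four lengths.
degree-2-Cycle : ∀ {n} (3≤n : 3 ℕ.≤ n) → n ∈ twoIntegralOrders → ∀ i → degree (Cycle n 3≤n) i ≡ 2
degree-2-Cycle 3≤n (here ≡.refl)                         = from-yes (degree-2-Cycle? 5 3≤n)
degree-2-Cycle 3≤n (there (here ≡.refl))                 = from-yes (degree-2-Cycle? 8 3≤n)
degree-2-Cycle 3≤n (there (there (here ≡.refl)))         = from-yes (degree-2-Cycle? 10 3≤n)
degree-2-Cycle 3≤n (there (there (there (here ≡.refl)))) = from-yes (degree-2-Cycle? 12 3≤n)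

module _ {c ℓ} (G : Group c ℓ) where
  open Group G
  open GroupProperties G
  open GroupListing G
  open CyclicGroups G
  open MonoidMultiples monoid using () renaming (_×_ to _·_)
  open SetoidReasoning setoid hiding (stop)

  x//ε≈x : ∀ x → x // ε ≈ x
  x//ε≈x x = trans (∙-congˡ ε⁻¹≈ε) (identityʳ x)

  cyclic⇒∈𝒢 : ∀ {n} → n ∈ twoIntegralOrders → 3 ℕ.≤ n → Cyclic n → G ∈𝒢 2
  cyclic⇒∈𝒢 {n} n∈ 3≤n cyclic = finite , C , connected , valency ,
    (let K , splitting , quadratic = order⇒cycle 3≤n n∈
     in K , CycleListing.cycle⇒cay cyclicListing enumeration 3≤n K splitting , quadratic)
    where
    open Cyclic cyclic
    open Listing listing using (enumeration; covers)
    g = generator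
    finite : Finite G
    finite = n , enumeration
    _≟_ = finite⇒≟ finite

    1<n : 1 ℕ.< n
    1<n = ℕ.≤-trans (s≤s (s≤s z≤n)) 3≤n

    g≉ε : ¬ g ≈ ε
    g≉ε g≈ε with distinct 1<n (ℕ.<-trans (s≤s z≤n) 1<n) (trans (identityʳ g) g≈ε)
    ... | ()

    C : ConnectionSet G
    C = record
      { S          = λ x → x ≈ g ⊎ x ≈ g ⁻¹
      ; S?         = λ x → (x ≟ g) ⊎-dec (x ≟ (g ⁻¹))
      ; S-resp     = λ x≈y → Sum.map (trans (sym x≈y)) (trans (sym x≈y))
      ; ε∉S        = Sum.[ (λ ε≈g → g≉ε (sym ε≈g)) , (λ ε≈g⁻¹ → g≉ε (⁻¹-injective (trans (sym ε≈g⁻¹) (sym ε⁻¹≈ε)))) ]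
      ; inv-closed = Sum.[ (λ x≈g → inj₂ (⁻¹-cong x≈g)) , (λ x≈g⁻¹ → inj₁ (trans (⁻¹-cong x≈g⁻¹) (⁻¹-involutive g))) ]
      }

    cyclicListing : CycleListing C n
    cyclicListing = cycleListing C (inj₁ refl) (λ x∈S → x∈S)

    Γ = Cay G finite C
    open Graph Γ using (adj?)

    walk : ∀ k u v → v ≈ k · g ∙ u → Walk Γ u v
    walk zero    u v eq = stop (sym (trans eq (identityˡ u)))
    walk (suc k) u v eq = step (inj₁ (//-rightDividesʳ u g)) (walk k (g ∙ u) v (begin
      v                   ≈⟨ eq ⟩
      g ∙ k · g ∙ u       ≈⟨ ∙-congʳ (power-comm g k) ⟨
      k · g ∙ g ∙ u       ≈⟨ assoc _ _ _ ⟩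
      k · g ∙ (g ∙ u)     ∎))

    connected : Connected Γ
    connected u v = let k , _ , v//u≈ = generates (v // u) in
      walk k u v (trans (sym (//-rightDividesˡ u v)) (∙-congʳ v//u≈))

    -- Counted along the listing, the neighbours of x are those of its position in the cycle.
    valency : HasValency Γ 2
    valency x = let i , x≈i = covers x in ≡.trans
      (count-cong (adj? x) (Graph.adj? (Cycle n 3≤n) i) (Listing.element listing) (λ j → j) λ j → does-⇔ (mk⇔
        (λ adj → Equivalence.to (CycleListing.adjacency cyclicListing i j)
          (ConnectionSet.S-resp C (//-cong₂ refl x≈i) adj))
        (λ adj → ConnectionSet.S-resp C (//-cong₂ refl (sym x≈i))
          (Equivalence.from (CycleListing.adjacency cyclicListing i j) adj)))
        (adj? x _) (Graph.adj? (Cycle n 3≤n) i j))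
      (degree-2-Cycle 3≤n n∈ i)

  module _ {N} (enum : Inverse (≡.setoid (Fin N)) setoid) (C : ConnectionSet G) where
    open ConnectionSet C
    private Γ = Cay G (N , enum) C
    private _≟_ = finite⇒≟ (N , enum)

    record TwoElements : Set (c Level.⊔ ℓ) where
      field
        s t  : Carrier
        s∈S  : S s
        t∈S  : S t
        s≉t  : ¬ s ≈ t
        S⊆st : ∀ {x} → S x → x ≈ s ⊎ x ≈ t

    -- The neighbours of ε are the elements of the connection set, since x ∙ ε⁻¹ ≈ x.
    valency⇒two : HasValency Γ 2 → TwoElements
    valency⇒two valency = record
      { s    = vertex i
      ; t    = vertex j
      ; s∈S  = S-resp (x//ε≈x (vertex i)) Si
      ; t∈S  = S-resp (x//ε≈x (vertex j)) Sj
      ; s≉t  = λ eq → i≢j (≡.trans (≡.sym (Inverse.strictlyInverseʳ enum i))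
                 (≡.trans (Inverse.from-cong enum eq) (Inverse.strictlyInverseʳ enum j)))
      ; S⊆st = λ {x} x∈S → Sum.map (located x) (located x)
                 (only (Inverse.from enum x) (S-resp (sym (trans (x//ε≈x _) (Inverse.strictlyInverseˡ enum x))) x∈S))
      }
      where
      open Graph Γ using (vertex; adj?)
      two = count≡2 (adj? ε) vertex (valency ε)
      i = proj₁ two
      j = proj₁ (proj₂ two)
      i≢j = proj₁ (proj₂ (proj₂ two))
      Si = proj₁ (proj₂ (proj₂ (proj₂ two)))
      Sj = proj₁ (proj₂ (proj₂ (proj₂ (proj₂ two))))
      only = proj₂ (proj₂ (proj₂ (proj₂ (proj₂ two))))
      located : ∀ x {k} → Inverse.from enum x ≡ k → x ≈ vertex k
      located x ≡.refl = sym (Inverse.strictlyInverseˡ enum x)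

    -- Two of the powers with exponents 0 to N coincide by the pigeonhole principle, and cancelling
    -- the smaller leaves a positive exponent that kills g. The order is `suc d` for the least such
    -- d, which keeps it positive.
    order : ∀ g → ∃ λ d → suc d · g ≈ ε × (∀ k → k ℕ.< d → ¬ suc k · g ≈ ε)
    order g = let i , j , i<j , eq = Fin.pigeonhole (ℕ.n<1+n N) (λ i → Inverse.from enum (toℕ i · g))
                  d , j≡i+1+d = <⇒≡+suc i<j in
      least (λ k → (suc k · g) ≟ ε) d (power-cancel (toℕ i) (suc d) (begin
        toℕ i · g                    ≈⟨ Inverse.strictlyInverseˡ enum _ ⟨
        Inverse.to enum (Inverse.from enum (toℕ i · g)) ≈⟨ Inverse.to-cong enum eq ⟩
        Inverse.to enum (Inverse.from enum (toℕ j · g)) ≈⟨ Inverse.strictlyInverseˡ enum _ ⟩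
        toℕ j · g                    ≡⟨ ≡.cong (_· g) j≡i+1+d ⟩
        (toℕ i ℕ.+ suc d) · g        ∎))

    -- An induction principle: in a connected Cayley graph, a property that holds at ε and is
    -- preserved by left multiplication with the connection set holds for all elements.
    reachable : ∀ {p} (P : Carrier → Set p) → (∀ {x y} → x ≈ y → P x → P y) →
      (∀ {s x} → S s → P x → P (s ∙ x)) → ∀ {u v} → Walk Γ u v → P u → P v
    reachable P resp closed (stop u≈v)         Pu = resp u≈v Pu
    reachable P resp closed (step {w} adj walk) Pu =
      reachable P resp closed walk (resp (//-rightDividesˡ _ w) (closed adj Pu))

    -- The powers with exponent below the order of g are closed under multiplication by g and its
    -- inverse, so by connectedness they exhaust the group.
    generated⇒cyclic : ∀ g → (∀ {x} → S x → x ≈ g ⊎ x ≈ g ⁻¹) → Connected Γ →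
      Cyclic (suc (proj₁ (order g)))
    generated⇒cyclic g S⊆ connected = record
      { generator = g
      ; period    = period
      ; distinct  = λ {i} {j} i<n j<n eq → distinct i<n j<n eq (ℕ.<-cmp i j)
      ; generates = λ x → reachable Power (λ { x≈y (i , i<n , x≈) → i , i<n , trans (sym x≈y) x≈ })
          (λ s∈S Px → closed Px (S⊆ s∈S)) (connected ε x) (0 , s≤s z≤n , refl)
      }
      where
      d = proj₁ (order g)
      period = proj₁ (proj₂ (order g))
      minimal = proj₂ (proj₂ (order g))
      Power : Carrier → Set ℓ
      Power x = ∃ λ i → i ℕ.< suc d × x ≈ i · g
      earlier : ∀ {i j} → i ℕ.< j → j ℕ.< suc d → ¬ i · g ≈ j · g
      earlier {i} {j} i<j j<n eq = let k , i+1+k≡j = <⇒≡+suc i<j in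
        minimal k (ℕ.≤-trans (≡.subst (suc k ℕ.≤_) (≡.sym i+1+k≡j) (ℕ.m≤n+m (suc k) i)) (ℕ.≤-pred j<n))
          (power-cancel i (suc k) (trans eq (reflexive (≡.cong (_· g) i+1+k≡j))))
      distinct : ∀ {i j} → i ℕ.< suc d → j ℕ.< suc d → i · g ≈ j · g → Rel₂.Tri (i ℕ.< j) (i ≡ j) (j ℕ.< i) → i ≡ j
      distinct i<n j<n eq (Rel₂.tri< i<j _ _) = contradiction eq (earlier i<j j<n)
      distinct i<n j<n eq (Rel₂.tri≈ _ i≡j _) = i≡j
      distinct i<n j<n eq (Rel₂.tri> _ _ j<i) = contradiction (sym eq) (earlier j<i i<n)
      closed : ∀ {s x} → Power x → s ≈ g ⊎ s ≈ g ⁻¹ → Power (s ∙ x)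
      closed {s} {x} (i , i<n , x≈) (inj₁ s≈g) = forward (ℕ.m≤n⇒m<n∨m≡n i<n)
        where
        forward : suc i ℕ.< suc d ⊎ suc i ≡ suc d → Power (s ∙ x)
        forward (inj₁ i+1<n)  = suc i , i+1<n , ∙-cong s≈g x≈
        forward (inj₂ ≡.refl) = 0 , s≤s z≤n , trans (∙-cong s≈g x≈) period
      closed {s} {x} (suc i , i<n , x≈) (inj₂ s≈g⁻¹) = i , ℕ.<-trans (ℕ.n<1+n i) i<n , (begin
        s ∙ x                  ≈⟨ ∙-cong s≈g⁻¹ x≈ ⟩
        g ⁻¹ ∙ (g ∙ i · g)     ≈⟨ \\-leftDividesʳ g (i · g) ⟩
        i · g                  ∎)
      -- Here x = ε, and g⁻¹ is the d-th power of g because the order is d + 1.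
      closed {s} {x} (zero , _ , x≈) (inj₂ s≈g⁻¹) = d , ℕ.n<1+n d , (begin
        s ∙ x                  ≈⟨ ∙-cong s≈g⁻¹ (trans x≈ (sym period)) ⟩
        g ⁻¹ ∙ (g ∙ d · g)     ≈⟨ \\-leftDividesʳ g (d · g) ⟩
        d · g                  ∎)

-- Abelian groups: a cyclic group or the Klein four-group.

-- Multiplication by s and by t in the list ε, s, s t, t, which runs around the 4-cycle.
σ₄ τ₄ : Fin 4 → Fin 4
σ₄ zero                   = # 1
σ₄ (suc zero)             = # 0
σ₄ (suc (suc zero))       = # 3
σ₄ (suc (suc (suc zero))) = # 2
τ₄ zero                   = # 3
τ₄ (suc zero)             = # 2
τ₄ (suc (suc zero))       = # 1
τ₄ (suc (suc (suc zero))) = # 0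

cycle₄-neighbours : ∀ i j →
  (CycleAdjacent 4 i j → j ≡ σ₄ i ⊎ j ≡ τ₄ i) × (j ≡ σ₄ i ⊎ j ≡ τ₄ i → CycleAdjacent 4 i j)
cycle₄-neighbours = from-yes (Fin.all? λ i → Fin.all? λ j →
  (adjacent? i j →-dec neighbour? i j) ×-dec (neighbour? i j →-dec adjacent? i j))
  where
  adjacent? : ∀ i j → Dec (CycleAdjacent 4 i j)
  adjacent? i j = next? 4 i j ⊎-dec next? 4 j i
  neighbour? : ∀ i j → Dec (j ≡ σ₄ i ⊎ j ≡ τ₄ i)
  neighbour? i j = (j Fin.≟ σ₄ i) ⊎-dec (j Fin.≟ τ₄ i)

module _ {c ℓ} (G : AbelianGroup c ℓ) where
  open AbelianGroup G
  open GroupProperties group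
  open GroupListing group
  open CyclicGroups group
  open SetoidReasoning setoid hiding (stop)

  module _ {N} (enum : Inverse (≡.setoid (Fin N)) setoid) (C : ConnectionSet group)
    (connected : Connected (Cay group (N , enum) C)) where
    open ConnectionSet C

    -- The four elements ε, s, s t, t are closed under both involutions, by commutativity in the
    -- case of t, so connectedness leaves no others. They are distinct because ε, s and t are.
    klein : (two : TwoElements group enum C) → let open TwoElements two in
      s ∙ s ≈ ε → t ∙ t ≈ ε → CycleListing C 4
    klein two s²≈ε t²≈ε = record
      { listing    = record { element = v ; injective = λ {i} {j} → distinct i j ; covers = covers }
      ; s          = s
      ; t          = t
      ; s∈S        = s∈S
      ; t∈S        = t∈S
      ; S⊆st       = S⊆st
      ; σ          = σ₄
      ; τ          = τ₄
      ; σ-step     = σ-step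
      ; τ-step     = τ-step
      ; neighbours = λ i j → mk⇔ (proj₁ (cycle₄-neighbours i j)) (proj₂ (cycle₄-neighbours i j))
      }
      where
      open TwoElements two
      v : Fin 4 → Carrier
      v zero                   = ε
      v (suc zero)             = s
      v (suc (suc zero))       = s ∙ t
      v (suc (suc (suc zero))) = t

      cancelˢ : ∀ x → s ∙ (s ∙ x) ≈ x
      cancelˢ x = trans (sym (assoc s s x)) (trans (∙-congʳ s²≈ε) (identityˡ x))

      σ-step : ∀ i → s ∙ v i ≈ v (σ₄ i)
      σ-step zero                   = identityʳ s
      σ-step (suc zero)             = s²≈ε
      σ-step (suc (suc zero))       = cancelˢ t
      σ-step (suc (suc (suc zero))) = refl

      τ-step : ∀ i → t ∙ v i ≈ v (τ₄ i)
      τ-step zero                   = identityʳ t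
      τ-step (suc zero)             = comm t s
      τ-step (suc (suc zero))       = begin
        t ∙ (s ∙ t)   ≈⟨ comm t (s ∙ t) ⟩
        s ∙ t ∙ t     ≈⟨ assoc s t t ⟩
        s ∙ (t ∙ t)   ≈⟨ ∙-congˡ t²≈ε ⟩
        s ∙ ε         ≈⟨ identityʳ s ⟩
        s             ∎
      τ-step (suc (suc (suc zero))) = t²≈ε

      covers : ∀ x → ∃ λ i → x ≈ v i
      covers x = reachable group enum C (λ x → ∃ λ i → x ≈ v i)
        (λ { x≈y (i , x≈) → i , trans (sym x≈y) x≈ }) (λ r∈S Px → closed Px (S⊆st r∈S)) (connected ε x) (zero , refl)
        where
        closed : ∀ {r x} → (∃ λ i → x ≈ v i) → r ≈ s ⊎ r ≈ t → ∃ λ i → r ∙ x ≈ v i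
        closed (i , x≈) (inj₁ r≈s) = σ₄ i , trans (∙-cong r≈s x≈) (σ-step i)
        closed (i , x≈) (inj₂ r≈t) = τ₄ i , trans (∙-cong r≈t x≈) (τ-step i)

      s≉ε : ¬ s ≈ ε
      s≉ε s≈ε = ε∉S (S-resp s≈ε s∈S)
      t≉ε : ¬ t ≈ ε
      t≉ε t≈ε = ε∉S (S-resp t≈ε t∈S)
      st≉ε : ¬ s ∙ t ≈ ε
      st≉ε st≈ε = s≉t (∙-cancelʳ t s t (trans st≈ε (sym t²≈ε)))
      st≉s : ¬ s ∙ t ≈ s
      st≉s st≈s = t≉ε (∙-cancelˡ s t ε (trans st≈s (sym (identityʳ s))))
      st≉t : ¬ s ∙ t ≈ t
      st≉t st≈t = s≉ε (∙-cancelʳ t s ε (trans st≈t (sym (identityˡ t))))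

      distinct : ∀ i j → v i ≈ v j → i ≡ j
      distinct zero                   zero                   _  = ≡.refl
      distinct zero                   (suc zero)             eq = contradiction (sym eq) s≉ε
      distinct zero                   (suc (suc zero))       eq = contradiction (sym eq) st≉ε
      distinct zero                   (suc (suc (suc zero))) eq = contradiction (sym eq) t≉ε
      distinct (suc zero)             zero                   eq = contradiction eq s≉ε
      distinct (suc zero)             (suc zero)             _  = ≡.refl
      distinct (suc zero)             (suc (suc zero))       eq = contradiction (sym eq) st≉s
      distinct (suc zero)             (suc (suc (suc zero))) eq = contradiction eq s≉t
      distinct (suc (suc zero))       zero                   eq = contradiction eq st≉ε
      distinct (suc (suc zero))       (suc zero)             eq = contradiction eq st≉s
      distinct (suc (suc zero))       (suc (suc zero))       _  = ≡.refl
      distinct (suc (suc zero))       (suc (suc (suc zero))) eq = contradiction eq st≉t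
      distinct (suc (suc (suc zero))) zero                   eq = contradiction eq t≉ε
      distinct (suc (suc (suc zero))) (suc zero)             eq = contradiction (sym eq) s≉t
      distinct (suc (suc (suc zero))) (suc (suc zero))       eq = contradiction (sym eq) st≉t
      distinct (suc (suc (suc zero))) (suc (suc (suc zero))) _  = ≡.refl

    cyclic-case : TwoIntegral (Cay group (N , enum) C) → (two : TwoElements group enum C) → let open TwoElements two in
      s ⁻¹ ≈ t → Σ[ n ∈ ℕ ] (n ∈ twoIntegralOrders) × (group ≅ ℤ/ n)
    cyclic-case twoIntegral two s⁻¹≈t = n , cay⇒order enum (Cyclic.cycleListing cyclic C s∈S S⊆) 3≤n twoIntegral ,
      Cyclic.cyclic⇒≅ cyclic
      where
      open TwoElements two
      S⊆ : ∀ {x} → S x → x ≈ s ⊎ x ≈ s ⁻¹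
      S⊆ x∈S = Sum.map₂ (λ x≈t → trans x≈t (sym s⁻¹≈t)) (S⊆st x∈S)
      n = suc (proj₁ (order group enum C s))
      cyclic : Cyclic n
      cyclic = generated⇒cyclic group enum C s S⊆ connected
      3≤n : 3 ℕ.≤ n
      3≤n = bound (proj₁ (order group enum C s)) (proj₁ (proj₂ (order group enum C s)))
        where
        open MonoidMultiples monoid using () renaming (_×_ to _·_)
        -- Order 1 would put ε into the connection set, and order 2 would give s = s⁻¹ = t.
        bound : ∀ d → suc d · s ≈ ε → 3 ℕ.≤ suc d
        bound zero          s≈ε  = contradiction s∈S λ s∈S → ε∉S (S-resp (trans (sym (identityʳ s)) s≈ε) s∈S)
        bound (suc zero)    s²≈ε = contradiction (trans (inverseˡ-unique s s (trans (∙-congˡ (sym (identityʳ s))) s²≈ε)) s⁻¹≈t) s≉t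
        bound (suc (suc d)) _    = s≤s (s≤s (s≤s z≤n))

    -- Inversion permutes the two elements of the connection set. Either it exchanges them and s
    -- generates the group, or it fixes both and they are involutions.
    two-elements⇒order : TwoIntegral (Cay group (N , enum) C) → TwoElements group enum C →
      Σ[ n ∈ ℕ ] (n ∈ twoIntegralOrders) × (group ≅ ℤ/ n)
    two-elements⇒order twoIntegral two = cases (S⊆st (inv-closed s∈S)) (S⊆st (inv-closed t∈S))
      where
      open TwoElements two
      involution : ∀ {x} → x ⁻¹ ≈ x → x ∙ x ≈ ε
      involution x⁻¹≈x = trans (∙-congˡ (sym x⁻¹≈x)) (inverseʳ _)
      cases : s ⁻¹ ≈ s ⊎ s ⁻¹ ≈ t → t ⁻¹ ≈ s ⊎ t ⁻¹ ≈ t → Σ[ n ∈ ℕ ] (n ∈ twoIntegralOrders) × (group ≅ ℤ/ n)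
      cases (inj₂ s⁻¹≈t) _             = cyclic-case twoIntegral two s⁻¹≈t
      cases (inj₁ s⁻¹≈s) (inj₁ t⁻¹≈s)  = contradiction (sym (⁻¹-injective (trans t⁻¹≈s (sym s⁻¹≈s)))) s≉t
      -- The graph would be a 2-integral 4-cycle, but 4 is not one of the orders.
      cases (inj₁ s⁻¹≈s) (inj₂ t⁻¹≈t)
        with cay⇒order enum (klein two (involution s⁻¹≈s) (involution t⁻¹≈t)) (s≤s (s≤s (s≤s z≤n))) twoIntegral
      ... | there (there (there (there ())))

order≥3 : ∀ {n} → n ∈ twoIntegralOrders → 3 ℕ.≤ n
order≥3 (here ≡.refl)                         = s≤s (s≤s (s≤s z≤n))
order≥3 (there (here ≡.refl))                 = s≤s (s≤s (s≤s z≤n))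
order≥3 (there (there (here ≡.refl)))         = s≤s (s≤s (s≤s z≤n))
order≥3 (there (there (there (here ≡.refl)))) = s≤s (s≤s (s≤s z≤n))

theorem5p1 : ∀ {c ℓ} →
    ((G : AbelianGroup c ℓ) → Finite (AbelianGroup.group G) →
    (AbelianGroup.group G ∈𝒢 2) ⇔
    (Σ[ n ∈ ℕ ] (n ∈ 5 ∷ 8 ∷ 10 ∷ 12 ∷ []) × (AbelianGroup.group G ≅ ℤ/ n)))
    × ((n : ℕ) (3≤n : 3 ≤ n) →
    TwoIntegral (Cycle n 3≤n) ⇔ (n ∈ 5 ∷ 8 ∷ 10 ∷ 12 ∷ []))
theorem5p1 = (λ G _ → mk⇔
    (λ { ((N , enum) , C , connected , valency , twoIntegral) →
      two-elements⇒order G enum C connected twoIntegral (valency⇒two (AbelianGroup.group G) enum C valency) })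
    (λ { (n , n∈ , iso) → let 3≤n = order≥3 n∈ in
      cyclic⇒∈𝒢 (AbelianGroup.group G) n∈ 3≤n
        (CyclicGroups.≅⇒cyclic (AbelianGroup.group G) {{ℕ.>-nonZero (ℕ.≤-trans (s≤s z≤n) 3≤n)}} iso) }))
  , λ n 3≤n → mk⇔ (cycle⇒order n 3≤n) (order⇒cycle 3≤n)
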